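{- Let $p(n)$ denote the number of partitions of $n$ (with $p(0)=1$ and $p(n)=0$ for $n<0$), and let $\sigma(n)$ be the sum of the positive divisors of $n$ (with $\sigma(n)=0$ for $n\le 0$). For an integer $k\ge 1$, define $p^{*k}(n)$ and $\sigma^{*k}(n)$ by \[ \sum_{n\ge 0} p^{*k}(n)X^n=\Big(\sum_{n\ge 0}p(n)X^n\Big)^k,\qquad \sum_{n\ge 0} \sigma^{*k}(n)X^n=\Big(\sum_{n\ge 1}\sigma(n)X^n\Big)^k . \] Then: (i) For $q\in\{5,7,11\}$, the pairs $(k,r)$ with $0<k<q$ and $0\le r<q$ such that $p^{*k}(qn+r)\equiv 0 \pmod q$ for all integers $n\ge 0$ are exactly: for $q=5$: $(1,4),(2,2),(2,3),(2,4),(4,3),(4,4)$; for $q=7$: $(1,5),(4,2),(4,4),(4,5),(4,6),(6,3),(6,4),(6,6)$; for $q=11$: $(1,6),(3,7),(5,8),(7,9),(8,2),(8,4),(8,5),(8,7),(8,8),(8,9),(10,3),(10,6),(10,8),(10,9),(10,10)$. (ii) $p^{*13}(17n+14)\equiv 0\pmod{17}$ for all integers $n\ge 0$. (iii) For $q\in\{5,7\}$, the pairs $(k,r)$ with $0<k<q$ and $0\le r<q$ such that $\sigma^{*k}(qn+r)\equiv 0\pmod q$ for all integers $n\ge 0$ are exactly: for $q=5$: $(2,1),(3,1),(3,2),(4,1),(4,2),(4,3)$; for $q=7$: $(2,6),(4,3),(4,6),(5,3)$.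
   Context: $p^{*k}$ is the $k$-fold (discrete) self-convolution of the partition function (the multipartition function), and $\sigma^{*k}$ is the $k$-fold self-convolution of the divisor function, i.e. $\sigma^{*k}(n)=\sum_{a_1+\dots+a_k=n,\ a_i\ge 0}\sigma(a_1)\cdots\sigma(a_k)$. -}

module Defs where

open import Data.Nat using (ℕ; zero; suc; _+_; _*_; _∸_; _≤_; _<_)
open import Data.Nat.Divisibility using (_∣_; _∣?_)
open import Data.List using (List; []; _∷_; length; concatMap; map; filter; upTo)
open import Data.Nat.ListAction using (sum)
open import Data.Product using (_×_; _,_)
open import Data.List.Membership.Propositional using (_∈_)
open import Function.Bundles using (_⇔_)

-- boundedPartitions n m : the list of all partitions of n into parts ≤ m,
-- each partition a weakly decreasing list of positive parts summing to n.
-- The first part j ranges over 1..min(n,m); the rest is a partition of n ∸ j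
-- into parts ≤ j.  (Fuel = n, which suffices since each step removes j ≥ 1.)
boundedPartitions : (fuel n m : ℕ) → List (List ℕ)
boundedPartitions _        zero m = [] ∷ []
boundedPartitions zero     (suc n) m = []
boundedPartitions (suc fuel) (suc n) m =
  concatMap (λ i → let j = suc i in
               map (j ∷_) (boundedPartitions fuel (suc n ∸ j) j))
            (filter (λ i → suc i Data.Nat.≤? m) (upTo (suc n)))

p : ℕ → ℕ
p n = length (boundedPartitions n n n)

σ : ℕ → ℕ
σ n = sum (map suc (filter (λ i → suc i ∣? n) (upTo n)))

_⋆_ : (ℕ → ℕ) → (ℕ → ℕ) → ℕ → ℕ
(f ⋆ g) n = sum (map (λ i → f i * g (n ∸ i)) (upTo (suc n)))

δ₀ : ℕ → ℕ
δ₀ zero = 1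
δ₀ (suc _) = 0

convPow : ℕ → (ℕ → ℕ) → ℕ → ℕ
convPow zero    f = δ₀
convPow (suc k) f = f ⋆ convPow k f

ExactCongruences : (F : ℕ → ℕ → ℕ) (q : ℕ) (L : List (ℕ × ℕ)) → Set
ExactCongruences F q L =
  ∀ k r → 0 < k → k < q → r < q →
    ((∀ n → q ∣ F k (q * n + r)) ⇔ ((k , r) ∈ L))

{-# OPTIONS --safe #-}

-- Let E = ∏ (1 - Xⁿ), and let P and S be the generating functions of p and σ.  Then P E = 1 and S E = - θ E with
-- θ = X d/dX, and E^q is a series in X^q modulo q.  Hence P^k and S^k vanish modulo q on a residue class of exponents
-- as soon as E^(q-k) and (θ E)^k E^(q-k) do.  Euler's pentagonal number theorem and Jacobi's formula for E³ bound the
-- residues of the exponents that occur in E and E³, and with them those in E⁴ = E · E³ and E⁶ = E³ · E³.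
-- For E⁸ and E¹⁰ modulo 11, split E³ into its components along residue classes.  Some components of
-- (E³)⁴ = E¹¹ · E vanish, which gives polynomial relations between the components of E³, and the components of
-- (E³)¹⁰ = E²² E⁸ and (E³)⁷ = E¹¹ E¹⁰ in question lie in the ideal generated by these relations.  For σ the same is
-- done with the components of E and the relations coming from the vanishing components of E³.
-- Every pair that is not listed is excluded by a coefficient of index less than 30.

module Submission where

open import Defs
open import Algebra.Bundles using (CommutativeRing; RawRing)
open import Algebra.Structures using (IsCommutativeRing)
open import Data.Bool.Base using (Bool; true; false; if_then_else_; _∧_; T)
open import Data.Bool.Properties using (T-∧)
open import Data.Integer.Base as ℤ using (ℤ; +_; -[1+_]; _⊖_)
import Data.Integer.Divisibility.Signed as ℤ∣
import Data.Integer.Properties as ℤₚ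
open import Data.Integer.Tactic.RingSolver using () renaming (solve-∀ to ℤ-solve-∀)
open import Data.List.Base using (List; []; _∷_; _++_; _∷ʳ_; length; map; concatMap; filter; upTo; applyUpTo; replicate)
open import Data.List.Membership.Propositional using (_∈_; _∉_)
open import Data.List.Membership.Propositional.Properties using (∈-upTo⁺; ∈-upTo⁻)
open import Data.List.Properties using (length-++; length-map; map-++; map-cong; map-cong-local; map-applyUpTo; map-upTo; concatMap-cong; filter-++; filter-accept; filter-reject; upTo-∷ʳ; ++-identityʳ)
open import Data.List.Relation.Unary.All as All using (All; []; _∷_)
open import Data.List.Relation.Unary.Any as Any using (Any; here; there)
open import Data.Maybe.Base using (Maybe; just; nothing)
open import Data.Nat.Base as ℕ using (ℕ; zero; suc)
open import Data.Nat.Divisibility using (_∣_; _∣?_; divides; ∣⇒≤; ∣m+n∣m⇒∣n; ∣m∣n⇒∣m+n; ∣-refl; m%n≡0⇒n∣m; n∣m⇒m%n≡0)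
open import Data.Nat.DivMod using (_%_; _/_; %-distribˡ-+; m≡m%n+[m/n]*n; m%n<n; [m+kn]%n≡m%n; m%n%n≡m%n; m<n⇒m%n≡m; m*n%n≡0)
open import Data.Nat.Induction using (<-rec)
open import Data.Nat.ListAction using (sum)
open import Data.Nat.ListAction.Properties using (sum-++)
import Data.Nat.Properties as ℕₚ
open import Data.List.Membership.DecPropositional ℕₚ._≟_ using (_∈?_; _∉?_)
open import Data.Nat.Tactic.RingSolver using (solve-∀)
open import Data.Product.Base using (_×_; _,_; proj₁; proj₂)
open import Data.Product.Properties using (≡-dec)
open import Data.Sum.Base using (_⊎_; inj₁; inj₂)
open import Data.Unit.Base using (tt)
open import Data.Vec.Base using (Vec; []; _∷_; fromList)
open import Function.Bundles using (mk⇔; Equivalence)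
open import Level using (Level; 0ℓ; _⊔_)
open import Relation.Binary.Definitions using (tri<; tri≈; tri>)
open import Relation.Binary.PropositionalEquality.Core as ≡ using (_≡_)
open import Relation.Binary.PropositionalEquality.Properties using (module ≡-Reasoning)
open import Relation.Binary.Structures using (IsEquivalence)
open import Relation.Nullary.Decidable using (Dec; yes; no; does; dec-true; dec-false; does-⇔; True; toWitness; ¬?; _⊎-dec_; _×-dec_)
open import Relation.Nullary.Negation.Core using (contradiction; ¬_)
open import Relation.Unary using (Decidable)

-- Ring solver with integer coefficients

module IntegerCoefficients {c ℓ : Level} (R : CommutativeRing c ℓ) where
  open CommutativeRing R
  open import Algebra.Solver.Ring.AlmostCommutativeRing using (_-Raw-AlmostCommutative⟶_; fromCommutativeRing)
  open import Algebra.Properties.Semiring.Mult.TCOptimised semiring using (1+×; ×-homo-+; ×1-homo-*) renaming (_×_ to _⋅_)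
  open import Algebra.Properties.Ring ring using (-‿distribˡ-*; -‿distribʳ-*; -‿involutive; -0#≈0#)
  open import Algebra.Properties.AbelianGroup +-abelianGroup using (⁻¹-∙-comm)
  open import Relation.Binary.Reasoning.Setoid setoid

  ⟦_⟧ᶻ : ℤ → Carrier
  ⟦ + n      ⟧ᶻ = n ⋅ 1#
  ⟦ -[1+ n ] ⟧ᶻ = - (suc n ⋅ 1#)

  cancel-1# : ∀ a b → a - b ≈ (1# + a) - (1# + b)
  cancel-1# a b = sym (begin
    (1# + a) + - (1# + b)      ≈⟨ +-cong (+-comm 1# a) (sym (⁻¹-∙-comm 1# b)) ⟩
    (a + 1#) + (- 1# + - b)    ≈⟨ +-assoc a 1# _ ⟩
    a + (1# + (- 1# + - b))    ≈⟨ +-congˡ (sym (+-assoc 1# (- 1#) (- b))) ⟩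
    a + ((1# + - 1#) + - b)    ≈⟨ +-congˡ (+-congʳ (-‿inverseʳ 1#)) ⟩
    a + (0# + - b)             ≈⟨ +-congˡ (+-identityˡ (- b)) ⟩
    a - b                      ∎)

  ⊖-homo : ∀ m n → ⟦ m ⊖ n ⟧ᶻ ≈ m ⋅ 1# - n ⋅ 1#
  ⊖-homo m       zero    = sym (trans (+-congˡ -0#≈0#) (+-identityʳ _))
  ⊖-homo zero    (suc n) = sym (+-identityˡ _)
  ⊖-homo (suc m) (suc n) = begin
    ⟦ suc m ⊖ suc n ⟧ᶻ               ≡⟨ ≡.cong ⟦_⟧ᶻ (ℤₚ.[1+m]⊖[1+n]≡m⊖n m n) ⟩
    ⟦ m ⊖ n ⟧ᶻ                       ≈⟨ ⊖-homo m n ⟩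
    m ⋅ 1# - n ⋅ 1#                  ≈⟨ cancel-1# _ _ ⟩
    (1# + m ⋅ 1#) - (1# + n ⋅ 1#)    ≈⟨ +-cong (1+× m 1#) (-‿cong (1+× n 1#)) ⟨
    suc m ⋅ 1# - suc n ⋅ 1#          ∎

  -‿homo : ∀ i → ⟦ ℤ.- i ⟧ᶻ ≈ - ⟦ i ⟧ᶻ
  -‿homo (+ zero)  = sym -0#≈0#
  -‿homo (+ suc n) = refl
  -‿homo -[1+ n ]  = sym (-‿involutive _)

  +-homo : ∀ i j → ⟦ i ℤ.+ j ⟧ᶻ ≈ ⟦ i ⟧ᶻ + ⟦ j ⟧ᶻ
  +-homo (+ m)    (+ n)    = ×-homo-+ 1# m n
  +-homo (+ m)    -[1+ n ] = ⊖-homo m (suc n)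
  +-homo -[1+ m ] (+ n)    = trans (⊖-homo n (suc m)) (+-comm _ _)
  +-homo -[1+ m ] -[1+ n ] = begin
    - (suc (suc (m ℕ.+ n)) ⋅ 1#)           ≡⟨ ≡.cong (λ k → - (suc k ⋅ 1#)) (≡.sym (ℕₚ.+-suc m n)) ⟩
    - ((suc m ℕ.+ suc n) ⋅ 1#)             ≈⟨ -‿cong (×-homo-+ 1# (suc m) (suc n)) ⟩
    - (suc m ⋅ 1# + suc n ⋅ 1#)            ≈⟨ sym (⁻¹-∙-comm _ _) ⟩
    - (suc m ⋅ 1#) + - (suc n ⋅ 1#)        ∎

  pos-*-homo : ∀ m j → ⟦ + m ℤ.* j ⟧ᶻ ≈ m ⋅ 1# * ⟦ j ⟧ᶻ
  pos-*-homo m (+ n) = begin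
    ⟦ + m ℤ.* + n ⟧ᶻ   ≡⟨ ≡.cong ⟦_⟧ᶻ (≡.sym (ℤₚ.pos-* m n)) ⟩
    (m ℕ.* n) ⋅ 1#     ≈⟨ ×1-homo-* m n ⟩
    m ⋅ 1# * n ⋅ 1#    ∎
  pos-*-homo m -[1+ n ] = begin
    ⟦ + m ℤ.* -[1+ n ] ⟧ᶻ             ≡⟨ ≡.cong ⟦_⟧ᶻ (≡.sym (ℤₚ.neg-distribʳ-* (+ m) (+ suc n))) ⟩
    ⟦ ℤ.- (+ m ℤ.* + suc n) ⟧ᶻ        ≈⟨ -‿homo (+ m ℤ.* + suc n) ⟩
    - ⟦ + m ℤ.* + suc n ⟧ᶻ            ≈⟨ -‿cong (pos-*-homo m (+ suc n)) ⟩
    - (m ⋅ 1# * suc n ⋅ 1#)           ≈⟨ -‿distribʳ-* _ _ ⟩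
    m ⋅ 1# * - (suc n ⋅ 1#)           ∎

  *-homo : ∀ i j → ⟦ i ℤ.* j ⟧ᶻ ≈ ⟦ i ⟧ᶻ * ⟦ j ⟧ᶻ
  *-homo (+ m)    j = pos-*-homo m j
  *-homo -[1+ m ] j = begin
    ⟦ -[1+ m ] ℤ.* j ⟧ᶻ            ≡⟨ ≡.cong ⟦_⟧ᶻ (≡.sym (ℤₚ.neg-distribˡ-* (+ suc m) j)) ⟩
    ⟦ ℤ.- (+ suc m ℤ.* j) ⟧ᶻ       ≈⟨ -‿homo (+ suc m ℤ.* j) ⟩
    - ⟦ + suc m ℤ.* j ⟧ᶻ           ≈⟨ -‿cong (pos-*-homo (suc m) j) ⟩
    - (suc m ⋅ 1# * ⟦ j ⟧ᶻ)        ≈⟨ -‿distribˡ-* _ _ ⟩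
    - (suc m ⋅ 1#) * ⟦ j ⟧ᶻ        ∎

  ℤ-rawRing : RawRing 0ℓ 0ℓ
  ℤ-rawRing = CommutativeRing.rawRing ℤₚ.+-*-commutativeRing

  morphism : ℤ-rawRing -Raw-AlmostCommutative⟶ fromCommutativeRing R
  morphism = record
    { ⟦_⟧    = ⟦_⟧ᶻ
    ; +-homo = +-homo
    ; *-homo = *-homo
    ; -‿homo = -‿homo
    ; 0-homo = refl
    ; 1-homo = refl
    }

  coefficient≟ : ∀ i j → Maybe (⟦ i ⟧ᶻ ≈ ⟦ j ⟧ᶻ)
  coefficient≟ i j with i ℤₚ.≟ j
  ... | yes ≡.refl = just refl
  ... | no  _      = nothing

  open import Algebra.Solver.Ring ℤ-rawRing (fromCommutativeRing R) morphism coefficient≟ public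
    using (solve; _:=_; _:+_; _:*_; _:-_; :-_; con)

tri : ℕ → ℕ
tri zero    = 0
tri (suc n) = tri n ℕ.+ suc n

-- The generalized pentagonal numbers m (3m ∓ 1) / 2 for m = n + 1.
pent₁ pent₂ : ℕ → ℕ
pent₁ n = suc n ℕ.* suc n ℕ.+ tri n
pent₂ n = suc n ℕ.* suc n ℕ.+ tri (suc n)

module FiniteIdentities {c ℓ : Level} (R : CommutativeRing c ℓ) (x : CommutativeRing.Carrier R) where
  open CommutativeRing R hiding (zero)
  open IntegerCoefficients R using (solve; _:=_; _:+_; _:*_; _:-_; :-_; con)
  open import Algebra.Properties.Semiring.Exp semiring using (_^_; ^-homo-*)
  open import Algebra.Properties.Ring ring using (-‿distribˡ-*)
  open import Relation.Binary.Reasoning.Setoid setoid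

  ^-+ : ∀ {n} a b → n ≡ a ℕ.+ b → x ^ n ≈ x ^ a * x ^ b
  ^-+ a b ≡.refl = ^-homo-* x a b

  segment : ℕ → ℕ → Carrier
  segment m zero    = 1#
  segment m (suc j) = segment m j * (1# - x ^ suc (m ℕ.+ j))

  Q : ℕ → Carrier
  Q = segment 0

  segment-uncons : ∀ m j → segment m (suc j) ≈ (1# - x ^ suc m) * segment (suc m) j
  segment-uncons m zero = begin
    1# * (1# - x ^ suc (m ℕ.+ 0))  ≡⟨ ≡.cong (λ k → 1# * (1# - x ^ suc k)) (ℕₚ.+-identityʳ m) ⟩
    1# * (1# - x ^ suc m)          ≈⟨ *-comm _ _ ⟩
    (1# - x ^ suc m) * 1#          ∎
  segment-uncons m (suc j) = begin
    segment m (suc j) * (1# - x ^ suc (m ℕ.+ suc j))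
      ≈⟨ *-cong (segment-uncons m j) (reflexive (≡.cong (λ k → 1# - x ^ suc k) (ℕₚ.+-suc m j))) ⟩
    (1# - x ^ suc m) * segment (suc m) j * (1# - x ^ suc (suc m ℕ.+ j))
      ≈⟨ *-assoc _ _ _ ⟩
    (1# - x ^ suc m) * segment (suc m) (suc j) ∎

  segment-1 : ∀ m → segment m 1 ≈ 1# - x ^ suc m
  segment-1 m = trans (segment-uncons m 0) (*-identityʳ _)

  Q-+ : ∀ m j → Q (m ℕ.+ j) ≈ Q m * segment m j
  Q-+ m zero = trans (reflexive (≡.cong Q (ℕₚ.+-identityʳ m))) (sym (*-identityʳ _))
  Q-+ m (suc j) = begin
    Q (m ℕ.+ suc j)                                ≡⟨ ≡.cong Q (ℕₚ.+-suc m j) ⟩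
    Q (m ℕ.+ j) * (1# - x ^ suc (m ℕ.+ j))         ≈⟨ *-congʳ (Q-+ m j) ⟩
    Q m * segment m j * (1# - x ^ suc (m ℕ.+ j))   ≈⟨ *-assoc _ _ _ ⟩
    Q m * segment m (suc j)                        ∎

  sgn : ℕ → Carrier
  sgn zero    = 1#
  sgn (suc n) = - sgn n

  pentTerm : ℕ → Carrier
  pentTerm n = sgn (suc n) * (x ^ pent₁ n + x ^ pent₂ n)

  -- Shanks: the sums S n = Σₛ (-1)ˢ (1-xˢ⁺¹)…(1-xⁿ) x^(sn + s(s+1)/2) grow by the pentagonal terms only.
  -- shanksTail s j is the part of S (s + j) from index s on, up to the sign (-1)ˢ.
  shanksExp : ℕ → ℕ → ℕ
  shanksExp s j = s ℕ.* (s ℕ.+ j) ℕ.+ tri s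

  shanksTail : ℕ → ℕ → Carrier
  shanksTail s zero    = segment s 0 * x ^ shanksExp s 0
  shanksTail s (suc j) = segment s (suc j) * x ^ shanksExp s (suc j) - shanksTail (suc s) j

  shanksTail-step : ∀ t j n → suc t ℕ.+ j ≡ n →
    shanksTail (suc t) (suc j) - shanksTail (suc t) j
      + segment t (suc j) * x ^ (suc t ℕ.* suc n ℕ.+ tri t)
    ≈ sgn (suc j) * (x ^ pent₁ n + x ^ pent₂ n)
  shanksTail-step t zero n eq with ≡.trans (≡.sym (ℕₚ.+-identityʳ (suc t))) eq
  ... | ≡.refl = begin
    segment (suc t) 1 * x ^ shanksExp (suc t) 1 - 1# * x ^ shanksExp (suc (suc t)) 0
      - 1# * x ^ shanksExp (suc t) 0 + segment t 1 * w
      ≈⟨ +-cong (+-cong (+-congʳ (*-cong (segment-1 (suc t)) (^-+ e (suc t) (h₁ t (tri t)))))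
                        (-‿cong (*-congˡ (reflexive (≡.cong (x ^_) (h₂ t (tri t)))))))
                (*-congʳ (segment-1 t)) ⟩
    (1# - y) * (w * z) - 1# * x ^ shanksExp (suc (suc t)) 0 - 1# * w + (1# - z) * w
      ≈⟨ +-congʳ (+-congʳ (+-congˡ (-‿cong (*-congˡ (reflexive (≡.cong (x ^_) (h₃ t (tri t)))))))) ⟩
    (1# - y) * (w * z) - 1# * x ^ pent₂ (suc t) - 1# * w + (1# - z) * w
      ≈⟨ solve 4 (λ y z w v → (con (+ 1) :- y) :* (w :* z) :- con (+ 1) :* v :- con (+ 1) :* w
                              :+ (con (+ 1) :- z) :* w
                           := (:- con (+ 1)) :* (w :* z :* y :+ v)) refl y z w (x ^ pent₂ (suc t)) ⟩
    - 1# * (w * z * y + x ^ pent₂ (suc t))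
      ≈⟨ *-congˡ (+-congʳ (sym (trans (^-+ (e ℕ.+ suc t) (suc (suc t)) (h₄ t (tri t))) (*-congʳ (^-homo-* x e (suc t)))))) ⟩
    - 1# * (x ^ pent₁ (suc t) + x ^ pent₂ (suc t)) ∎
    where
    e = suc t ℕ.* suc (suc t) ℕ.+ tri t
    w = x ^ e
    z = x ^ suc t
    y = x ^ suc (suc t)
    h₁ : ∀ t T → suc t ℕ.* (suc t ℕ.+ 1) ℕ.+ (T ℕ.+ suc t) ≡ (suc t ℕ.* suc (suc t) ℕ.+ T) ℕ.+ suc t
    h₁ = solve-∀
    h₂ : ∀ t T → suc t ℕ.* (suc t ℕ.+ 0) ℕ.+ (T ℕ.+ suc t) ≡ suc t ℕ.* suc (suc t) ℕ.+ T
    h₂ = solve-∀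
    h₃ : ∀ t T → suc (suc t) ℕ.* (suc (suc t) ℕ.+ 0) ℕ.+ (T ℕ.+ suc t ℕ.+ suc (suc t))
         ≡ suc (suc t) ℕ.* suc (suc t) ℕ.+ (T ℕ.+ suc t ℕ.+ suc (suc t))
    h₃ = solve-∀
    h₄ : ∀ t T → suc (suc t) ℕ.* suc (suc t) ℕ.+ (T ℕ.+ suc t)
         ≡ (suc t ℕ.* suc (suc t) ℕ.+ T ℕ.+ suc t) ℕ.+ suc (suc t)
    h₄ = solve-∀
  shanksTail-step t (suc j) n eq = begin
    (segment (suc t) (suc j) * (1# - x ^ suc (suc t ℕ.+ suc j))) * x ^ shanksExp (suc t) (suc (suc j))
      - shanksTail (suc (suc t)) (suc j)
      - (g * x ^ shanksExp (suc t) (suc j) - shanksTail (suc (suc t)) j)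
      + segment t (suc (suc j)) * w
      ≈⟨ +-cong (+-cong (+-congʳ (*-cong (*-congˡ (+-congˡ (-‿cong (reflexive (≡.cong (λ k → x ^ suc k) eq)))))
                                         (^-+ e (suc t) (h₁ t j (tri t) n eq))))
                        (-‿cong (+-congʳ (*-congˡ (reflexive (≡.cong (x ^_) (h₂ t j (tri t) n eq)))))))
                (*-congʳ (segment-uncons t (suc j))) ⟩
    (g * (1# - y)) * (w * z) - a - (g * w - b) + (1# - z) * g * w
      ≈⟨ solve 6 (λ g y w z a b → (g :* (con (+ 1) :- y)) :* (w :* z) :- a :- (g :* w :- b) :+ (con (+ 1) :- z) :* g :* w
                     := :- (a :- b :+ g :* (w :* z :* y))) refl g y w z a b ⟩
    - (a - b + g * (w * z * y))
      ≈⟨ -‿cong (+-congˡ (*-congˡ (sym (trans (^-+ (e ℕ.+ suc t) (suc n) (h₃ t (tri t) n)) (*-congʳ (^-homo-* x e (suc t))))))) ⟩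
    - (a - b + g * x ^ (suc (suc t) ℕ.* suc n ℕ.+ tri (suc t)))
      ≈⟨ -‿cong (shanksTail-step (suc t) j n (≡.trans (≡.sym (ℕₚ.+-suc (suc t) j)) eq)) ⟩
    - (sgn (suc j) * (x ^ pent₁ n + x ^ pent₂ n))
      ≈⟨ -‿distribˡ-* _ _ ⟩
    sgn (suc (suc j)) * (x ^ pent₁ n + x ^ pent₂ n) ∎
    where
    g = segment (suc t) (suc j)
    e = suc t ℕ.* suc n ℕ.+ tri t
    w = x ^ e
    z = x ^ suc t
    y = x ^ suc n
    a = shanksTail (suc (suc t)) (suc j)
    b = shanksTail (suc (suc t)) j
    h₁ : ∀ t j T n → suc t ℕ.+ suc j ≡ n →
         suc t ℕ.* (suc t ℕ.+ suc (suc j)) ℕ.+ (T ℕ.+ suc t) ≡ (suc t ℕ.* suc n ℕ.+ T) ℕ.+ suc t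
    h₁ t j T _ ≡.refl = lemma t j T
      where
      lemma : ∀ t j T → suc t ℕ.* (suc t ℕ.+ suc (suc j)) ℕ.+ (T ℕ.+ suc t)
              ≡ (suc t ℕ.* suc (suc t ℕ.+ suc j) ℕ.+ T) ℕ.+ suc t
      lemma = solve-∀
    h₂ : ∀ t j T n → suc t ℕ.+ suc j ≡ n →
         suc t ℕ.* (suc t ℕ.+ suc j) ℕ.+ (T ℕ.+ suc t) ≡ suc t ℕ.* suc n ℕ.+ T
    h₂ t j T _ ≡.refl = lemma t j T
      where
      lemma : ∀ t j T → suc t ℕ.* (suc t ℕ.+ suc j) ℕ.+ (T ℕ.+ suc t)
              ≡ suc t ℕ.* suc (suc t ℕ.+ suc j) ℕ.+ T
      lemma = solve-∀
    h₃ : ∀ t T n → suc (suc t) ℕ.* suc n ℕ.+ (T ℕ.+ suc t) ≡ (suc t ℕ.* suc n ℕ.+ T ℕ.+ suc t) ℕ.+ suc n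
    h₃ = solve-∀

  shanksSum : ℕ → Carrier
  shanksSum = shanksTail 0

  shanksSum-suc : ∀ n → shanksSum (suc n) ≈ shanksSum n + pentTerm n
  shanksSum-suc zero =
    solve 1 (λ x → con (+ 1) :* (con (+ 1) :- x :* con (+ 1)) :* con (+ 1) :- con (+ 1) :* (x :* (x :* con (+ 1)))
              := con (+ 1) :* con (+ 1) :+ (:- con (+ 1)) :* (x :* con (+ 1) :+ x :* (x :* con (+ 1)))) refl x
  shanksSum-suc (suc j) = begin
    g * (1# - y) * 1# - a ≈⟨ solve 4 (λ g y a b → g :* (con (+ 1) :- y) :* con (+ 1) :- a
                               := g :* con (+ 1) :- b :- (a :- b :+ g :* y)) refl g y a b ⟩
    g * 1# - b - (a - b + g * y) ≈⟨ +-congˡ (-‿cong (+-congˡ (*-congˡ (reflexive (≡.cong (x ^_) (h j)))))) ⟩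
    g * 1# - b - (a - b + g * x ^ (1 ℕ.* suc (suc j) ℕ.+ 0)) ≈⟨ +-congˡ (-‿cong (shanksTail-step 0 j (suc j) ≡.refl)) ⟩
    g * 1# - b - sgn (suc j) * (x ^ pent₁ (suc j) + x ^ pent₂ (suc j)) ≈⟨ +-congˡ (-‿distribˡ-* _ _) ⟩
    g * 1# - b + pentTerm (suc j) ∎
    where
    g = segment 0 (suc j)
    y = x ^ suc (suc j)
    a = shanksTail 1 (suc j)
    b = shanksTail 1 j
    h : ∀ j → suc (suc j) ≡ 1 ℕ.* suc (suc j) ℕ.+ 0
    h = solve-∀

  odd : ℕ → Carrier
  odd zero    = 1#
  odd (suc k) = odd k + (1# + 1#)

  -- d n k is the coefficient of zᵏ in (1 - z⁻¹) ∏_{1 ≤ i ≤ n} (1 - z xⁱ) (1 - z⁻¹ xⁱ),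
  -- which is antisymmetric under k ↦ -1 - k.  Weighting it by 2k + 1 amounts to differentiating at z = 1.
  d : ℕ → ℕ → Carrier
  d zero    zero    = 1#
  d zero    (suc k) = 0#
  d (suc n) zero    = (1# + x ^ suc n + x ^ suc n * x ^ suc n) * d n 0 - x ^ suc n * d n 1
  d (suc n) (suc k) = (1# + x ^ suc n * x ^ suc n) * d n (suc k) - x ^ suc n * (d n k + d n (suc (suc k)))

  d-zero : ∀ {n k} → n ℕ.< k → d n k ≈ 0#
  d-zero {zero}  {suc k} _           = refl
  d-zero {suc n} {suc k} (ℕ.s≤s n<k) = begin
    (1# + y * y) * d n (suc k) - y * (d n k + d n (suc (suc k)))
      ≈⟨ +-cong (*-congˡ (d-zero (ℕₚ.m<n⇒m<1+n n<k)))
                (-‿cong (*-congˡ (+-cong (d-zero n<k) (d-zero (ℕₚ.m<n⇒m<1+n (ℕₚ.m<n⇒m<1+n n<k)))))) ⟩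
    (1# + y * y) * 0# - y * (0# + 0#)
      ≈⟨ solve 1 (λ y → (con (+ 1) :+ y :* y) :* con (+ 0) :- y :* (con (+ 0) :+ con (+ 0)) := con (+ 0)) refl y ⟩
    0# ∎
    where y = x ^ suc n

  weightedSum : ℕ → ℕ → Carrier
  weightedSum n zero    = 0#
  weightedSum n (suc m) = weightedSum n m + odd m * d n m

  weightedSum-suc : ∀ n m → weightedSum (suc n) (suc m) ≈
    (1# - x ^ suc n) * (1# - x ^ suc n) * weightedSum n (suc m)
      + x ^ suc n * (odd (suc m) * d n m - odd m * d n (suc m))
  weightedSum-suc n zero =
    solve 3 (λ y a b → con (+ 0) :+ con (+ 1) :* ((con (+ 1) :+ y :+ y :* y) :* a :- y :* b)
              := (con (+ 1) :- y) :* (con (+ 1) :- y) :* (con (+ 0) :+ con (+ 1) :* a)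
                   :+ y :* ((con (+ 1) :+ (con (+ 1) :+ con (+ 1))) :* a :- con (+ 1) :* b))
            refl (x ^ suc n) (d n 0) (d n 1)
  weightedSum-suc n (suc m) = trans (+-congʳ (weightedSum-suc n m))
    (solve 6 (λ y s c e f g →
       (con (+ 1) :- y) :* (con (+ 1) :- y) :* s :+ y :* ((c :+ (con (+ 1) :+ con (+ 1))) :* e :- c :* f)
         :+ (c :+ (con (+ 1) :+ con (+ 1))) :* ((con (+ 1) :+ y :* y) :* f :- y :* (e :+ g))
       := (con (+ 1) :- y) :* (con (+ 1) :- y) :* (s :+ (c :+ (con (+ 1) :+ con (+ 1))) :* f)
            :+ y :* (((c :+ (con (+ 1) :+ con (+ 1))) :+ (con (+ 1) :+ con (+ 1))) :* f
                      :- (c :+ (con (+ 1) :+ con (+ 1))) :* g))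
     refl (x ^ suc n) (weightedSum n (suc m)) (odd m) (d n m) (d n (suc m)) (d n (suc (suc m))))

  weightedSum≈Q² : ∀ n → weightedSum n (suc n) ≈ Q n * Q n
  weightedSum≈Q² zero    = solve 0 (con (+ 0) :+ con (+ 1) :* con (+ 1) := con (+ 1) :* con (+ 1)) refl
  weightedSum≈Q² (suc n) = begin
    weightedSum (suc n) (suc (suc n))
      ≈⟨ weightedSum-suc n (suc n) ⟩
    (1# - y) * (1# - y) * (weightedSum n (suc n) + odd (suc n) * d n (suc n))
      + y * (odd (suc (suc n)) * d n (suc n) - odd (suc n) * d n (suc (suc n)))
      ≈⟨ +-cong (*-congˡ (+-cong (weightedSum≈Q² n) (*-congˡ z₁))) (*-congˡ (+-cong (*-congˡ z₁) (-‿cong (*-congˡ z₂)))) ⟩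
    (1# - y) * (1# - y) * (Q n * Q n + odd (suc n) * 0#) + y * (odd (suc (suc n)) * 0# - odd (suc n) * 0#)
      ≈⟨ solve 4 (λ y q a b → (con (+ 1) :- y) :* (con (+ 1) :- y) :* (q :* q :+ a :* con (+ 0)) :+ y :* (b :* con (+ 0) :- a :* con (+ 0))
                   := q :* (con (+ 1) :- y) :* (q :* (con (+ 1) :- y))) refl y (Q n) (odd (suc n)) (odd (suc (suc n))) ⟩
    Q (suc n) * Q (suc n) ∎
    where
    y = x ^ suc n
    z₁ = d-zero (ℕₚ.n<1+n n)
    z₂ = d-zero (ℕₚ.m<n⇒m<1+n (ℕₚ.n<1+n n))

  d-Closed : ℕ → ℕ → Set _
  d-Closed j k = d (j ℕ.+ k) k * (Q j * Q (suc (j ℕ.+ (k ℕ.+ k)))) ≈ sgn k * x ^ tri k * Q (suc ((j ℕ.+ k) ℕ.+ (j ℕ.+ k)))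

  Q-≡ : ∀ {m n} → m ≡ n → Q m ≈ Q n
  Q-≡ ≡.refl = refl

  d-≡ : ∀ {m n k} → m ≡ n → d m k ≈ d n k
  d-≡ ≡.refl = refl

  d-right : ∀ j k → (∀ i l → i ℕ.+ l ≡ j ℕ.+ k → d-Closed i l) →
    d (j ℕ.+ k) (suc k) * (Q j * Q (suc (suc (j ℕ.+ (k ℕ.+ k)))))
    ≈ sgn (suc k) * x ^ tri (suc k) * (1# - x ^ j) * Q (suc ((j ℕ.+ k) ℕ.+ (j ℕ.+ k)))
  d-right zero k _ = begin
    d k (suc k) * _   ≈⟨ *-congʳ (d-zero (ℕₚ.n<1+n k)) ⟩
    0# * _            ≈⟨ zeroˡ _ ⟩
    0#                ≈⟨ solve 2 (λ a b → con (+ 0) := a :* (con (+ 1) :- con (+ 1)) :* b) refl _ _ ⟩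
    _ * (1# - 1#) * _ ∎
  d-right (suc j) k closed = begin
    d (suc j ℕ.+ k) (suc k) * (Q j * (1# - z) * Q (suc (suc (suc j ℕ.+ (k ℕ.+ k)))))
      ≈⟨ *-cong (d-≡ (≡.sym (ℕₚ.+-suc j k))) (*-congˡ (Q-≡ (h₁ j k))) ⟩
    d (j ℕ.+ suc k) (suc k) * (Q j * (1# - z) * Q (suc (j ℕ.+ (suc k ℕ.+ suc k))))
      ≈⟨ solve 4 (λ a b c e → a :* (b :* c :* e) := a :* (b :* e) :* c) refl _ _ _ _ ⟩
    d (j ℕ.+ suc k) (suc k) * (Q j * Q (suc (j ℕ.+ (suc k ℕ.+ suc k)))) * (1# - z)
      ≈⟨ *-congʳ (closed j (suc k) (ℕₚ.+-suc j k)) ⟩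
    sgn (suc k) * x ^ tri (suc k) * Q (suc ((j ℕ.+ suc k) ℕ.+ (j ℕ.+ suc k))) * (1# - z)
      ≈⟨ solve 3 (λ a b c → a :* b :* c := a :* c :* b) refl _ _ _ ⟩
    sgn (suc k) * x ^ tri (suc k) * (1# - z) * Q (suc ((j ℕ.+ suc k) ℕ.+ (j ℕ.+ suc k)))
      ≈⟨ *-congˡ (Q-≡ (h₂ j k)) ⟩
    sgn (suc k) * x ^ tri (suc k) * (1# - z) * Q (suc ((suc j ℕ.+ k) ℕ.+ (suc j ℕ.+ k))) ∎
    where
    z = x ^ suc j
    h₁ : ∀ j k → suc (suc (suc j ℕ.+ (k ℕ.+ k))) ≡ suc (j ℕ.+ (suc k ℕ.+ suc k))
    h₁ = solve-∀
    h₂ : ∀ j k → suc ((j ℕ.+ suc k) ℕ.+ (j ℕ.+ suc k)) ≡ suc ((suc j ℕ.+ k) ℕ.+ (suc j ℕ.+ k))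
    h₂ = solve-∀

  d-right₂ : ∀ j k → (∀ i l → i ℕ.+ l ≡ j ℕ.+ k → d-Closed i l) →
    d (j ℕ.+ k) (suc (suc k)) * (Q j * Q (suc (suc (suc (j ℕ.+ (k ℕ.+ k))))))
    ≈ sgn k * x ^ tri k * (x ^ suc k * x ^ suc k) * (1# - x ^ j) * (x - x ^ j) * Q (suc ((j ℕ.+ k) ℕ.+ (j ℕ.+ k)))
  d-right₂ zero k _ = begin
    d k (suc (suc k)) * _         ≈⟨ *-congʳ (d-zero (ℕₚ.m<n⇒m<1+n (ℕₚ.n<1+n k))) ⟩
    0# * _                        ≈⟨ zeroˡ _ ⟩
    0#                            ≈⟨ solve 3 (λ a b c → con (+ 0) := a :* (con (+ 1) :- con (+ 1)) :* b :* c) refl _ _ _ ⟩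
    _ * (1# - 1#) * (x - 1#) * _  ∎
  d-right₂ (suc j) k closed = begin
    d (suc j ℕ.+ k) (suc (suc k)) * (Q j * (1# - z) * Q (suc (suc (suc (suc j ℕ.+ (k ℕ.+ k))))))
      ≈⟨ *-cong (d-≡ (≡.sym (ℕₚ.+-suc j k))) (*-congˡ (Q-≡ (h₁ j k))) ⟩
    d (j ℕ.+ suc k) (suc (suc k)) * (Q j * (1# - z) * Q (suc (suc (j ℕ.+ (suc k ℕ.+ suc k)))))
      ≈⟨ solve 4 (λ a b c e → a :* (b :* c :* e) := a :* (b :* e) :* c) refl _ _ _ _ ⟩
    d (j ℕ.+ suc k) (suc (suc k)) * (Q j * Q (suc (suc (j ℕ.+ (suc k ℕ.+ suc k))))) * (1# - z)
      ≈⟨ *-congʳ (d-right j (suc k) (λ i l eq → closed i l (≡.trans eq (ℕₚ.+-suc j k)))) ⟩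
    - - sgn k * x ^ tri (suc (suc k)) * (1# - x ^ j) * Q (suc ((j ℕ.+ suc k) ℕ.+ (j ℕ.+ suc k))) * (1# - z)
      ≈⟨ *-congʳ (*-cong (*-congʳ (*-congˡ (trans (^-homo-* x (tri (suc k)) (suc (suc k))) (*-congʳ (^-homo-* x (tri k) (suc k))))))
                         (Q-≡ (h₂ j k))) ⟩
    - - sgn k * (x ^ tri k * x ^ suc k * (x * x ^ suc k)) * (1# - x ^ j) * Q (suc ((suc j ℕ.+ k) ℕ.+ (suc j ℕ.+ k))) * (1# - z)
      ≈⟨ solve 7 (λ s t b x w q z → (:- (:- s)) :* (t :* b :* (x :* b)) :* (con (+ 1) :- w) :* q :* (con (+ 1) :- z)
                   := s :* t :* (b :* b) :* (con (+ 1) :- z) :* (x :- x :* w) :* q) refl (sgn k) (x ^ tri k) (x ^ suc k) x (x ^ j) _ z ⟩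
    sgn k * x ^ tri k * (x ^ suc k * x ^ suc k) * (1# - z) * (x - z) * Q (suc ((suc j ℕ.+ k) ℕ.+ (suc j ℕ.+ k))) ∎
    where
    z = x ^ suc j
    h₁ : ∀ j k → suc (suc (suc (suc j ℕ.+ (k ℕ.+ k)))) ≡ suc (suc (j ℕ.+ (suc k ℕ.+ suc k)))
    h₁ = solve-∀
    h₂ : ∀ j k → suc ((j ℕ.+ suc k) ℕ.+ (j ℕ.+ suc k)) ≡ suc ((suc j ℕ.+ k) ℕ.+ (suc j ℕ.+ k))
    h₂ = solve-∀

  Q-last₂ : ∀ n {m} y → suc (n ℕ.+ n) ≡ m → x ^ suc n ≈ y →
            Q (suc (suc n ℕ.+ suc n)) ≈ Q m * (1# - y * y) * (1# - x * (y * y))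
  Q-last₂ n y ≡.refl eq = begin
    Q (suc (suc n ℕ.+ suc n))  ≡⟨ ≡.cong (λ k → Q (suc (suc k))) (ℕₚ.+-suc n n) ⟩
    Q (suc (n ℕ.+ n)) * (1# - x ^ suc (suc (n ℕ.+ n))) * (1# - x * x ^ suc (suc (n ℕ.+ n)))
      ≈⟨ *-cong (*-congˡ (+-congˡ (-‿cong e))) (+-congˡ (-‿cong (*-congˡ e))) ⟩
    Q (suc (n ℕ.+ n)) * (1# - y * y) * (1# - x * (y * y)) ∎
    where
    e : x ^ suc (suc (n ℕ.+ n)) ≈ y * y
    e = trans (^-+ (suc n) (suc n) (≡.cong suc (≡.sym (ℕₚ.+-suc n n)))) (*-cong eq eq)

  d-closed-zero : ∀ n → (∀ i l → i ℕ.+ l ≡ n → d-Closed i l) → d-Closed (suc n) 0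
  d-closed-zero n closed = begin
    d (suc n ℕ.+ 0) 0 * (Q (suc n) * Q (suc (suc n ℕ.+ 0)))
      ≈⟨ *-cong (d-≡ {k = 0} (ℕₚ.+-identityʳ (suc n))) (*-congˡ (Q-≡ (≡.cong suc (ℕₚ.+-identityʳ (suc n))))) ⟩
    ((1# + y + y * y) * d n 0 - y * d n 1) * (Q n * (1# - y) * (Q (suc n) * (1# - x * y)))
      ≈⟨ solve 7 (λ y x a b q r s → ((con (+ 1) :+ y :+ y :* y) :* a :- y :* b) :* (q :* (con (+ 1) :- y) :* (r :* (con (+ 1) :- x :* y)))
             := ((con (+ 1) :+ y :+ y :* y) :* (a :* (q :* r)) :* (con (+ 1) :- y) :* (con (+ 1) :- x :* y))
                 :- y :* (b :* (q :* (r :* (con (+ 1) :- x :* y)))) :* (con (+ 1) :- y)) refl y x (d n 0) (d n 1) (Q n) (Q (suc n)) 1# ⟩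
    (1# + y + y * y) * (d n 0 * (Q n * Q (suc n))) * (1# - y) * (1# - x * y)
      - y * (d n 1 * (Q n * (Q (suc n) * (1# - x * y)))) * (1# - y)
      ≈⟨ +-cong (*-congʳ (*-congʳ (*-congˡ e₁))) (-‿cong (*-congʳ (*-congˡ e₂))) ⟩
    (1# + y + y * y) * (1# * 1# * q) * (1# - y) * (1# - x * y)
      - y * (- 1# * (x * 1#) * (1# - x ^ n) * q) * (1# - y)
      ≈⟨ solve 3 (λ x w q → let y = x :* w ; one = con (+ 1) in
           (one :+ y :+ y :* y) :* (one :* one :* q) :* (one :- y) :* (one :- x :* y)
             :- y :* ((:- one) :* (x :* one) :* (one :- w) :* q) :* (one :- y)
           := one :* one :* (q :* (one :- y :* y) :* (one :- x :* (y :* y)))) refl x (x ^ n) q ⟩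
    1# * 1# * (q * (1# - y * y) * (1# - x * (y * y)))
      ≈⟨ *-congˡ (sym (Q-last₂ n y ≡.refl refl)) ⟩
    1# * 1# * Q (suc (suc n ℕ.+ suc n))
      ≈⟨ *-congˡ (Q-≡ (≡.cong₂ (λ a b → suc (a ℕ.+ b)) (≡.sym (ℕₚ.+-identityʳ (suc n))) (≡.sym (ℕₚ.+-identityʳ (suc n))))) ⟩
    1# * 1# * Q (suc ((suc n ℕ.+ 0) ℕ.+ (suc n ℕ.+ 0))) ∎
    where
    y = x ^ suc n
    q = Q (suc (n ℕ.+ n))
    e₁ : d n 0 * (Q n * Q (suc n)) ≈ 1# * 1# * q
    e₁ = trans (*-cong (d-≡ (≡.sym (ℕₚ.+-identityʳ n))) (*-congˡ (Q-≡ (≡.cong suc (≡.sym (ℕₚ.+-identityʳ n))))))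
           (trans (closed n 0 (ℕₚ.+-identityʳ n))
             (*-congˡ (Q-≡ (≡.cong₂ (λ a b → suc (a ℕ.+ b)) (ℕₚ.+-identityʳ n) (ℕₚ.+-identityʳ n)))))
    e₂ : d n 1 * (Q n * Q (suc (suc n))) ≈ - 1# * (x * 1#) * (1# - x ^ n) * q
    e₂ = trans (*-cong (d-≡ (≡.sym (ℕₚ.+-identityʳ n))) (*-congˡ (Q-≡ (≡.cong (λ k → suc (suc k)) (≡.sym (ℕₚ.+-identityʳ n))))))
           (trans (d-right n 0 (λ i l eq → closed i l (≡.trans eq (ℕₚ.+-identityʳ n))))
             (*-congˡ (Q-≡ (≡.cong₂ (λ a b → suc (a ℕ.+ b)) (ℕₚ.+-identityʳ n) (ℕₚ.+-identityʳ n)))))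
  d-closed-suc : ∀ j k → (∀ i l → i ℕ.+ l ≡ j ℕ.+ k → d-Closed i l) → d-Closed j (suc k)
  d-closed-suc j k closed = begin
    d (j ℕ.+ suc k) (suc k) * (Q j * Q (suc (j ℕ.+ (suc k ℕ.+ suc k))))
      ≈⟨ *-cong (d-≡ {k = suc k} (ℕₚ.+-suc j k)) (*-congˡ (Q-≡ (h₁ j k))) ⟩
    ((1# + y * y) * B - y * (A + C)) * (Q j * (q₁ * (1# - x ^ suc (suc m)) * (1# - x * x ^ suc (suc m))))
      ≈⟨ *-cong (+-cong (*-congʳ (+-congˡ (*-cong y≈ y≈))) (-‿cong (*-congʳ y≈)))
                (*-congˡ (*-cong (*-congˡ (+-congˡ (-‿cong p≈))) (+-congˡ (-‿cong (*-congˡ p≈))))) ⟩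
    ((1# + a * b * (a * b)) * B - a * b * (A + C)) * (Q j * (q₁ * (1# - a * (b * b)) * (1# - x * (a * (b * b)))))
      ≈⟨ solve 8 (λ a b x A B C q r → let one = con (+ 1) in
           ((one :+ a :* b :* (a :* b)) :* B :- a :* b :* (A :+ C)) :* (q :* (r :* (one :- a :* (b :* b)) :* (one :- x :* (a :* (b :* b)))))
           := (one :+ a :* b :* (a :* b)) :* (one :- x :* (a :* (b :* b))) :* (B :* (q :* (r :* (one :- a :* (b :* b)))))
              :- a :* b :* (one :- a :* (b :* b)) :* (one :- x :* (a :* (b :* b))) :* (A :* (q :* r))
              :- a :* b :* (C :* (q :* (r :* (one :- a :* (b :* b)) :* (one :- x :* (a :* (b :* b)))))))
           refl a b x A B C (Q j) q₁ ⟩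
    (1# + a * b * (a * b)) * (1# - x * (a * (b * b))) * (B * (Q j * (q₁ * (1# - a * (b * b)))))
      - a * b * (1# - a * (b * b)) * (1# - x * (a * (b * b))) * (A * (Q j * q₁))
      - a * b * (C * (Q j * (q₁ * (1# - a * (b * b)) * (1# - x * (a * (b * b))))))
      ≈⟨ +-cong (+-cong (*-congˡ eB) (-‿cong (*-congˡ (closed j k ≡.refl)))) (-‿cong (*-congˡ eC)) ⟩
    (1# + a * b * (a * b)) * (1# - x * (a * (b * b))) * (- s * (t * b) * (1# - a) * q)
      - a * b * (1# - a * (b * b)) * (1# - x * (a * (b * b))) * (s * t * q)
      - a * b * (s * t * (b * b) * (1# - a) * (x - a) * q)
      ≈⟨ solve 6 (λ a b x s t q → let one = con (+ 1) in
           (one :+ a :* b :* (a :* b)) :* (one :- x :* (a :* (b :* b))) :* ((:- s) :* (t :* b) :* (one :- a) :* q)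
             :- a :* b :* (one :- a :* (b :* b)) :* (one :- x :* (a :* (b :* b))) :* (s :* t :* q)
             :- a :* b :* (s :* t :* (b :* b) :* (one :- a) :* (x :- a) :* q)
           := (:- s) :* (t :* b) :* (q :* (one :- a :* b :* (a :* b)) :* (one :- x :* (a :* b :* (a :* b))))) refl a b x s t q ⟩
    - s * (t * b) * (q * (1# - a * b * (a * b)) * (1# - x * (a * b * (a * b))))
      ≈⟨ *-cong (*-congˡ (sym t≈)) (sym (Q-last₂ n (a * b) ≡.refl y≈)) ⟩
    - s * x ^ tri (suc k) * Q (suc (suc n ℕ.+ suc n))
      ≈⟨ *-congˡ (Q-≡ (≡.cong₂ (λ a b → suc (a ℕ.+ b)) (≡.sym (ℕₚ.+-suc j k)) (≡.sym (ℕₚ.+-suc j k)))) ⟩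
    - s * x ^ tri (suc k) * Q (suc ((j ℕ.+ suc k) ℕ.+ (j ℕ.+ suc k))) ∎
    where
    n = j ℕ.+ k
    m = j ℕ.+ (k ℕ.+ k)
    y = x ^ suc n
    a = x ^ j
    b = x ^ suc k
    A = d n k
    B = d n (suc k)
    C = d n (suc (suc k))
    s = sgn k
    t = x ^ tri k
    q = Q (suc (n ℕ.+ n))
    q₁ = Q (suc m)
    h₁ : ∀ j k → suc (j ℕ.+ (suc k ℕ.+ suc k)) ≡ suc (suc (suc (j ℕ.+ (k ℕ.+ k))))
    h₁ = solve-∀
    h₂ : ∀ j k → suc (suc (j ℕ.+ (k ℕ.+ k))) ≡ j ℕ.+ (suc k ℕ.+ suc k)
    h₂ = solve-∀
    y≈ : y ≈ a * b
    y≈ = ^-+ j (suc k) (≡.sym (ℕₚ.+-suc j k))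
    p≈ : x ^ suc (suc m) ≈ a * (b * b)
    p≈ = trans (^-+ j (suc k ℕ.+ suc k) (h₂ j k)) (*-congˡ (^-homo-* x (suc k) (suc k)))
    t≈ : x ^ tri (suc k) ≈ t * b
    t≈ = ^-homo-* x (tri k) (suc k)
    eB : B * (Q j * (q₁ * (1# - a * (b * b)))) ≈ - s * (t * b) * (1# - a) * q
    eB = trans (*-congˡ (*-congˡ (*-congˡ (+-congˡ (-‿cong (sym p≈))))))
           (trans (d-right j k closed) (*-congʳ (*-congʳ (*-congˡ t≈))))
    eC : C * (Q j * (q₁ * (1# - a * (b * b)) * (1# - x * (a * (b * b))))) ≈ s * t * (b * b) * (1# - a) * (x - a) * q
    eC = trans (*-congˡ (*-congˡ (*-cong (*-congˡ (+-congˡ (-‿cong (sym p≈)))) (+-congˡ (-‿cong (*-congˡ (sym p≈)))))))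
           (d-right₂ j k closed)

  d-closed : ∀ n j k → j ℕ.+ k ≡ n → d-Closed j k
  d-closed zero zero zero _ =
    solve 1 (λ x → con (+ 1) :* (con (+ 1) :* (con (+ 1) :* (con (+ 1) :- x :* con (+ 1))))
               := con (+ 1) :* con (+ 1) :* (con (+ 1) :* (con (+ 1) :- x :* con (+ 1)))) refl x
  d-closed (suc n) j zero eq with ≡.trans (≡.sym (ℕₚ.+-identityʳ j)) eq
  ... | ≡.refl = d-closed-zero n (d-closed n)
  d-closed (suc n) j (suc k) eq with ℕₚ.suc-injective (≡.trans (≡.sym (ℕₚ.+-suc j k)) eq)
  ... | ≡.refl = d-closed-suc j k (d-closed n)

-- Formal power series

module PowerSeries {c ℓ : Level} (A : CommutativeRing c ℓ) where
  private
    module A = CommutativeRing A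
    open import Relation.Binary.Reasoning.Setoid A.setoid

  Series : Set c
  Series = ℕ → A.Carrier

  infix 4 _≋_
  record _≋_ (f g : Series) : Set ℓ where
    constructor pointwise
    field at : ∀ n → f n A.≈ g n
  open _≋_ public

  tail : Series → Series
  tail f n = f (suc n)

  infixl 7 _⊛_
  _⊛_ : Series → Series → Series
  (f ⊛ g) zero    = f 0 A.* g 0
  (f ⊛ g) (suc n) = f 0 A.* g (suc n) A.+ (tail f ⊛ g) n

  ⊛-local : ∀ n {f f′ g g′} → (∀ i j → i ℕ.+ j ≡ n → f i A.* g j A.≈ f′ i A.* g′ j) → (f ⊛ g) n A.≈ (f′ ⊛ g′) n
  ⊛-local zero    h = h 0 0 ≡.refl
  ⊛-local (suc n) h = A.+-cong (h 0 (suc n) ≡.refl) (⊛-local n (λ i j eq → h (suc i) j (≡.cong suc eq)))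

  ⊛-zero : ∀ n {f g} → (∀ i j → i ℕ.+ j ≡ n → f i A.* g j A.≈ A.0#) → (f ⊛ g) n A.≈ A.0#
  ⊛-zero zero    h = h 0 0 ≡.refl
  ⊛-zero (suc n) h = A.trans (A.+-cong (h 0 (suc n) ≡.refl) (⊛-zero n (λ i j eq → h (suc i) j (≡.cong suc eq)))) (A.+-identityˡ _)

  ⊛-cong : ∀ {f f′ g g′} → f ≋ f′ → g ≋ g′ → f ⊛ g ≋ f′ ⊛ g′
  ⊛-cong p q = pointwise λ n → ⊛-local n λ i j _ → A.*-cong (at p i) (at q j)

  infixl 6 _⊞_
  _⊞_ : Series → Series → Series
  (f ⊞ g) n = f n A.+ g n

  ⊟_ : Series → Series
  (⊟ f) n = A.- f n

  𝟘 𝟙 : Series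
  𝟘 _ = A.0#
  𝟙 zero    = A.1#
  𝟙 (suc _) = A.0#

  open IntegerCoefficients A using (solve; _:=_; _:+_; _:*_)

  ⊛-suc : ∀ f g n → (f ⊛ g) (suc n) A.≈ (f ⊛ tail g) n A.+ f (suc n) A.* g 0
  ⊛-suc f g zero    = A.refl
  ⊛-suc f g (suc n) = A.trans (A.+-congˡ (⊛-suc (tail f) g n)) (A.sym (A.+-assoc _ _ _))

  ⊛-comm : ∀ n f g → (f ⊛ g) n A.≈ (g ⊛ f) n
  ⊛-comm zero    f g = A.*-comm _ _
  ⊛-comm (suc n) f g = begin
    f 0 A.* g (suc n) A.+ (tail f ⊛ g) n   ≈⟨ A.+-cong (A.*-comm _ _) (⊛-comm n (tail f) g) ⟩
    g (suc n) A.* f 0 A.+ (g ⊛ tail f) n   ≈⟨ A.+-comm _ _ ⟩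
    (g ⊛ tail f) n A.+ g (suc n) A.* f 0   ≈⟨ ⊛-suc g f n ⟨
    (g ⊛ f) (suc n)                        ∎

  ⊛-distribʳ : ∀ n f g h → ((g ⊞ h) ⊛ f) n A.≈ (g ⊛ f) n A.+ (h ⊛ f) n
  ⊛-distribʳ zero    f g h = A.distribʳ _ _ _
  ⊛-distribʳ (suc n) f g h = begin
    (g 0 A.+ h 0) A.* f (suc n) A.+ ((tail g ⊞ tail h) ⊛ f) n
      ≈⟨ A.+-congˡ (⊛-distribʳ n f (tail g) (tail h)) ⟩
    (g 0 A.+ h 0) A.* f (suc n) A.+ ((tail g ⊛ f) n A.+ (tail h ⊛ f) n)
      ≈⟨ solve 5 (λ a b c e k → (a :+ b) :* c :+ (e :+ k) := a :* c :+ e :+ (b :* c :+ k)) A.refl _ _ _ _ _ ⟩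
    (g ⊛ f) (suc n) A.+ (h ⊛ f) (suc n) ∎

  ⊛-scale : ∀ n a f g → ((λ i → a A.* f i) ⊛ g) n A.≈ a A.* (f ⊛ g) n
  ⊛-scale zero    a f g = A.*-assoc _ _ _
  ⊛-scale (suc n) a f g = begin
    a A.* f 0 A.* g (suc n) A.+ ((λ i → a A.* tail f i) ⊛ g) n
      ≈⟨ A.+-congˡ (⊛-scale n a (tail f) g) ⟩
    a A.* f 0 A.* g (suc n) A.+ a A.* (tail f ⊛ g) n
      ≈⟨ solve 4 (λ a b c e → a :* b :* c :+ a :* e := a :* (b :* c :+ e)) A.refl _ _ _ _ ⟩
    a A.* (f ⊛ g) (suc n) ∎

  ⊛-assoc : ∀ n f g h → ((f ⊛ g) ⊛ h) n A.≈ (f ⊛ (g ⊛ h)) n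
  ⊛-assoc zero    f g h = A.*-assoc _ _ _
  ⊛-assoc (suc n) f g h = begin
    f 0 A.* g 0 A.* h (suc n) A.+ (((λ i → f 0 A.* tail g i) ⊞ (tail f ⊛ g)) ⊛ h) n
      ≈⟨ A.+-congˡ (⊛-distribʳ n h _ _) ⟩
    f 0 A.* g 0 A.* h (suc n) A.+ (((λ i → f 0 A.* tail g i) ⊛ h) n A.+ ((tail f ⊛ g) ⊛ h) n)
      ≈⟨ A.+-congˡ (A.+-cong (⊛-scale n (f 0) (tail g) h) (⊛-assoc n (tail f) g h)) ⟩
    f 0 A.* g 0 A.* h (suc n) A.+ (f 0 A.* (tail g ⊛ h) n A.+ (tail f ⊛ (g ⊛ h)) n)
      ≈⟨ solve 5 (λ a b c e k → a :* b :* c :+ (a :* e :+ k) := a :* (b :* c :+ e) :+ k) A.refl _ _ _ _ _ ⟩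
    (f ⊛ (g ⊛ h)) (suc n) ∎

  ⊛-identityˡ : ∀ n f → (𝟙 ⊛ f) n A.≈ f n
  ⊛-identityˡ zero    f = A.*-identityˡ _
  ⊛-identityˡ (suc n) f = begin
    A.1# A.* f (suc n) A.+ (𝟘 ⊛ f) n  ≈⟨ A.+-cong (A.*-identityˡ _) (⊛-zero n (λ _ _ _ → A.zeroˡ _)) ⟩
    f (suc n) A.+ A.0#                ≈⟨ A.+-identityʳ _ ⟩
    f (suc n)                         ∎

  ≋-isEquivalence : IsEquivalence _≋_
  ≋-isEquivalence = record
    { refl  = pointwise λ _ → A.refl
    ; sym   = λ p → pointwise λ n → A.sym (at p n)
    ; trans = λ p q → pointwise λ n → A.trans (at p n) (at q n)
    }

  isCommutativeRing : IsCommutativeRing _≋_ _⊞_ _⊛_ ⊟_ 𝟘 𝟙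
  isCommutativeRing = record
    { isRing = record
      { +-isAbelianGroup = record
        { isGroup = record
          { isMonoid = record
            { isSemigroup = record
              { isMagma = record
                { isEquivalence = ≋-isEquivalence
                ; ∙-cong = λ p q → pointwise λ n → A.+-cong (at p n) (at q n)
                }
              ; assoc = λ f g h → pointwise λ n → A.+-assoc _ _ _
              }
            ; identity = (λ f → pointwise λ n → A.+-identityˡ _) , (λ f → pointwise λ n → A.+-identityʳ _)
            }
          ; inverse = (λ f → pointwise λ n → A.-‿inverseˡ _) , (λ f → pointwise λ n → A.-‿inverseʳ _)
          ; ⁻¹-cong = λ p → pointwise λ n → A.-‿cong (at p n)
          }
        ; comm = λ f g → pointwise λ n → A.+-comm _ _
        }
      ; *-cong = ⊛-cong
      ; *-assoc = λ f g h → pointwise λ n → ⊛-assoc n f g h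
      ; *-identity = (λ f → pointwise λ n → ⊛-identityˡ n f)
                   , (λ f → pointwise λ n → A.trans (⊛-comm n f 𝟙) (⊛-identityˡ n f))
      ; distrib = (λ f g h → pointwise λ n → A.trans (⊛-comm n f (g ⊞ h))
                     (A.trans (⊛-distribʳ n f g h) (A.+-cong (⊛-comm n g f) (⊛-comm n h f))))
                , (λ f g h → pointwise λ n → ⊛-distribʳ n f g h)
      }
    ; *-comm = λ f g → pointwise λ n → ⊛-comm n f g
    }

  seriesRing : CommutativeRing c ℓ
  seriesRing = record { isCommutativeRing = isCommutativeRing }

  X : Series
  X zero          = A.0#
  X (suc zero)    = A.1#
  X (suc (suc _)) = A.0#

  private module S = CommutativeRing seriesRing
  open import Algebra.Properties.Semiring.Exp S.semiring using () renaming (_^_ to _^ˢ_)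

  X⊛-zero : ∀ f → (X ⊛ f) 0 A.≈ A.0#
  X⊛-zero f = A.zeroˡ _

  X⊛-suc : ∀ f n → (X ⊛ f) (suc n) A.≈ f n
  X⊛-suc f n = begin
    A.0# A.* f (suc n) A.+ (tail X ⊛ f) n  ≈⟨ A.+-cong (A.zeroˡ _) (⊛-local n (λ i j _ → A.*-congʳ (tailX i))) ⟩
    A.0# A.+ (𝟙 ⊛ f) n                     ≈⟨ A.+-identityˡ _ ⟩
    (𝟙 ⊛ f) n                              ≈⟨ ⊛-identityˡ n f ⟩
    f n                                    ∎
    where
    tailX : ∀ i → tail X i A.≈ 𝟙 i
    tailX zero    = A.refl
    tailX (suc i) = A.refl

  X^⊛-+ : ∀ d f n → (X ^ˢ d ⊛ f) (d ℕ.+ n) A.≈ f n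
  X^⊛-+ zero    f n = ⊛-identityˡ n f
  X^⊛-+ (suc d) f n = begin
    ((X ⊛ X ^ˢ d) ⊛ f) (suc d ℕ.+ n)  ≈⟨ ⊛-assoc (suc d ℕ.+ n) X (X ^ˢ d) f ⟩
    (X ⊛ (X ^ˢ d ⊛ f)) (suc d ℕ.+ n)  ≈⟨ X⊛-suc (X ^ˢ d ⊛ f) (d ℕ.+ n) ⟩
    (X ^ˢ d ⊛ f) (d ℕ.+ n)            ≈⟨ X^⊛-+ d f n ⟩
    f n                               ∎

  X^⊛-< : ∀ d f {n} → n ℕ.< d → (X ^ˢ d ⊛ f) n A.≈ A.0#
  X^⊛-< (suc d) f {zero}  _         = A.trans (⊛-assoc 0 X (X ^ˢ d) f) (X⊛-zero (X ^ˢ d ⊛ f))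
  X^⊛-< (suc d) f {suc n} (ℕ.s≤s h) = A.trans (⊛-assoc (suc n) X (X ^ˢ d) f) (A.trans (X⊛-suc (X ^ˢ d ⊛ f) n) (X^⊛-< d f h))

  infix 4 _≋[_]_
  _≋[_]_ : Series → ℕ → Series → Set ℓ
  f ≋[ n ] g = ∀ i → i ℕ.≤ n → f i A.≈ g i

  ≋⇒≋[] : ∀ {f g n} → f ≋ g → f ≋[ n ] g
  ≋⇒≋[] p i _ = at p i

  ≋[]-sym : ∀ {f g n} → f ≋[ n ] g → g ≋[ n ] f
  ≋[]-sym p i h = A.sym (p i h)

  ≋[]-trans : ∀ {f g h n} → f ≋[ n ] g → g ≋[ n ] h → f ≋[ n ] h
  ≋[]-trans p q i h = A.trans (p i h) (q i h)

  ⊛-cong[] : ∀ {f f′ g g′ n} → f ≋[ n ] f′ → g ≋[ n ] g′ → f ⊛ g ≋[ n ] f′ ⊛ g′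
  ⊛-cong[] {n = n} p q i h = ⊛-local i λ a b eq →
    A.*-cong (p a (ℕₚ.≤-trans (ℕₚ.m≤m+n a b) (ℕₚ.≤-trans (ℕₚ.≤-reflexive eq) h)))
             (q b (ℕₚ.≤-trans (ℕₚ.m≤n+m b a) (ℕₚ.≤-trans (ℕₚ.≤-reflexive eq) h)))

  ^-cong[] : ∀ {f g n} k → f ≋[ n ] g → f ^ˢ k ≋[ n ] g ^ˢ k
  ^-cong[] zero    p = λ _ _ → A.refl
  ^-cong[] (suc k) p = ⊛-cong[] p (^-cong[] k p)

  ⊛-cancelʳ[] : ∀ {f g u} n → u 0 A.≈ A.1# → f ⊛ u ≋[ n ] g ⊛ u → f ≋[ n ] g
  ⊛-cancelʳ[] {f} {g} {u} n u₀ p = go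
    where
    head : f 0 A.≈ g 0
    head = begin
      f 0               ≈⟨ A.*-identityʳ _ ⟨
      f 0 A.* A.1#      ≈⟨ A.*-congˡ u₀ ⟨
      f 0 A.* u 0       ≈⟨ p 0 ℕ.z≤n ⟩
      g 0 A.* u 0       ≈⟨ A.*-congˡ u₀ ⟩
      g 0 A.* A.1#      ≈⟨ A.*-identityʳ _ ⟩
      g 0               ∎
    go : f ≋[ n ] g
    go zero    _         = head
    go (suc i) (ℕ.s≤s {n = n′} h) =
      ⊛-cancelʳ[] {tail f} {tail g} n′ u₀ (λ j h′ → +-cancel (p (suc j) (ℕ.s≤s h′))) i h
      where
      open import Algebra.Properties.Group A.+-group using (∙-cancelˡ)
      +-cancel : ∀ {j} → (f ⊛ u) (suc j) A.≈ (g ⊛ u) (suc j) → (tail f ⊛ u) j A.≈ (tail g ⊛ u) j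
      +-cancel {j} e = ∙-cancelˡ (f 0 A.* u (suc j)) _ _ (A.trans e (A.+-congʳ (A.*-congʳ (A.sym head))))

  X^⊛-cong[] : ∀ d {f g n} → f ≋[ n ] g → X ^ˢ d ⊛ f ≋[ d ℕ.+ n ] X ^ˢ d ⊛ g
  X^⊛-cong[] d {f} {g} {n} p i i≤ with i ℕₚ.<? d
  ... | yes i<d = A.trans (X^⊛-< d f i<d) (A.sym (X^⊛-< d g i<d))
  ... | no  i≮d = ≡.subst (λ k → (X ^ˢ d ⊛ f) k A.≈ (X ^ˢ d ⊛ g) k) (ℕₚ.m+[n∸m]≡n (ℕₚ.≮⇒≥ i≮d)) (begin
    (X ^ˢ d ⊛ f) (d ℕ.+ (i ℕ.∸ d))  ≈⟨ X^⊛-+ d f (i ℕ.∸ d) ⟩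
    f (i ℕ.∸ d)                     ≈⟨ p (i ℕ.∸ d) (ℕₚ.m≤n+o⇒m∸n≤o i d i≤) ⟩
    g (i ℕ.∸ d)                     ≈⟨ X^⊛-+ d g (i ℕ.∸ d) ⟨
    (X ^ˢ d ⊛ g) (d ℕ.+ (i ℕ.∸ d))  ∎)

module EulerProduct {c ℓ : Level} (A : CommutativeRing c ℓ) where
  open PowerSeries A
  private module A = CommutativeRing A
  open CommutativeRing seriesRing hiding (zero)
  open import Algebra.Properties.Semiring.Exp semiring using (_^_)
  open IntegerCoefficients seriesRing using (solve; _:=_; _:+_; _:*_; _:-_; :-_; con)
  open FiniteIdentities seriesRing X public
  open import Algebra.Properties.Ring ring using (-0#≈0#)

  +-cong[] : ∀ {f f′ g g′ n} → f ≋[ n ] f′ → g ≋[ n ] g′ → f + g ≋[ n ] f′ + g′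
  +-cong[] p q i h = A.+-cong (p i h) (q i h)

  -‿cong[] : ∀ {f f′ n} → f ≋[ n ] f′ → - f ≋[ n ] - f′
  -‿cong[] p i h = A.-‿cong (p i h)

  ≋[]-refl : ∀ {f n} → f ≋[ n ] f
  ≋[]-refl _ _ = A.refl

  X^-vanish : ∀ {n} d → n ℕ.< d → X ^ d ≋[ n ] 0#
  X^-vanish d n<d i i≤n = A.trans (A.sym (at (*-identityʳ (X ^ d)) i)) (X^⊛-< d 1# (ℕₚ.≤-<-trans i≤n n<d))

  segment≋1 : ∀ m j → segment m j ≋[ m ] 1#
  segment≋1 m zero    = ≋[]-refl
  segment≋1 m (suc j) = ≋[]-trans
    (⊛-cong[] (segment≋1 m j) (+-cong[] ≋[]-refl (-‿cong[] (X^-vanish (suc (m ℕ.+ j)) (ℕ.s≤s (ℕₚ.m≤m+n m j))))))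
    (≋⇒≋[] (solve 0 (con (+ 1) :* (con (+ 1) :- con (+ 0)) := con (+ 1)) refl))

  Q-stable : ∀ {m n} → m ℕ.≤ n → Q n ≋[ m ] Q m
  Q-stable {m} {n} m≤n = ≡.subst (λ k → Q k ≋[ m ] Q m) (ℕₚ.m+[n∸m]≡n m≤n)
    (≋[]-trans (≋⇒≋[] (Q-+ m (n ℕ.∸ m)))
      (≋[]-trans (⊛-cong[] ≋[]-refl (segment≋1 m (n ℕ.∸ m))) (≋⇒≋[] (*-identityʳ _))))

  E : Series
  E n = Q n n

  E≋Q : ∀ n → E ≋[ n ] Q n
  E≋Q n i i≤n = A.sym (Q-stable i≤n i ℕₚ.≤-refl)

  Q₀≈1 : ∀ n → Q n 0 A.≈ A.1#
  Q₀≈1 n = Q-stable {0} {n} ℕ.z≤n 0 ℕₚ.≤-refl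

  shanksTail-vanish : ∀ s j → shanksTail (suc s) j ≋[ suc s ℕ.+ j ] 0#
  shanksTail-vanish s j = go s j
    where
    bound : ∀ s j → suc s ℕ.+ j ℕ.< shanksExp (suc s) j
    bound s j = ℕₚ.≤-<-trans (ℕₚ.m≤m+n (suc s ℕ.+ j) (s ℕ.* (suc s ℕ.+ j) ℕ.+ tri s))
      (ℕₚ.<-≤-trans (ℕₚ.m<m+n _ (ℕ.s≤s (ℕ.z≤n {s})))
        (ℕₚ.≤-reflexive (h s j (tri s))))
      where
      h : ∀ s j T → suc s ℕ.+ j ℕ.+ (s ℕ.* (suc s ℕ.+ j) ℕ.+ T) ℕ.+ suc s
                  ≡ suc s ℕ.* (suc s ℕ.+ j) ℕ.+ (T ℕ.+ suc s)
      h = solve-∀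
    term : ∀ s j → segment (suc s) j * X ^ shanksExp (suc s) j ≋[ suc s ℕ.+ j ] 0#
    term s j = ≋[]-trans (⊛-cong[] ≋[]-refl (X^-vanish _ (bound s j))) (≋⇒≋[] (zeroʳ _))
    go : ∀ s j → shanksTail (suc s) j ≋[ suc s ℕ.+ j ] 0#
    go s zero    = term s zero
    go s (suc j) = ≋[]-trans
      (+-cong[] (term s (suc j)) (-‿cong[] (≡.subst (λ k → shanksTail (suc (suc s)) j ≋[ k ] 0#) (≡.sym (ℕₚ.+-suc (suc s) j)) (go (suc s) j))))
      (≋⇒≋[] (trans (+-identityˡ _) -0#≈0#))

  pentagonal : ∀ n → E ≋[ n ] shanksSum n
  pentagonal n = ≋[]-trans (E≋Q n) (≋[]-sym (go n))
    where
    go : ∀ n → shanksSum n ≋[ n ] Q n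
    go zero    = ≋⇒≋[] (*-identityʳ 1#)
    go (suc j) = ≋[]-trans (+-cong[] ≋[]-refl (-‿cong[] (shanksTail-vanish 0 j)))
      (≋⇒≋[] (solve 1 (λ a → a :* con (+ 1) :- con (+ 0) := a) refl (Q (suc j))))

  tri-≥ : ∀ k → k ℕ.≤ tri k
  tri-≥ zero    = ℕ.z≤n
  tri-≥ (suc k) = ℕₚ.m≤n+m (suc k) (tri k)

  Q*d≋ : ∀ j k → Q (j ℕ.+ k) * d (j ℕ.+ k) k ≋[ j ℕ.+ k ] sgn k * X ^ tri k
  Q*d≋ j k = ≋[]-trans (≋⇒≋[] step₁) (≋[]-trans (⊛-cong[] step₂ ≋[]-refl) (≋[]-trans (≋⇒≋[] step₃)
               (≋[]-trans (⊛-cong[] ≋[]-refl step₄) (≋⇒≋[] (*-congˡ (*-identityʳ _))))))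
    where
    n = j ℕ.+ k
    step₁ : Q n * d n k ≈ d n k * Q j * segment j k
    step₁ = trans (*-congʳ (Q-+ j k)) (solve 3 (λ a b c → a :* b :* c := c :* a :* b) refl _ _ _)
    step₂ : d n k * Q j ≋[ n ] sgn k * X ^ tri k
    step₂ = ⊛-cancelʳ[] n (Q₀≈1 (suc (n ℕ.+ n)))
      (≋[]-trans (≋⇒≋[] (*-assoc _ _ _))
        (≋[]-trans (⊛-cong[] (≋[]-refl {d n k}) (⊛-cong[] (≋[]-refl {Q j})
          (≋[]-trans (Q-stable (ℕₚ.m≤n⇒m≤1+n (ℕₚ.m≤m+n n n)))
            (≋[]-sym (Q-stable (ℕₚ.m≤n⇒m≤1+n (ℕₚ.+-monoʳ-≤ j (ℕₚ.m≤m+n k k))))))))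
          (≋⇒≋[] (d-closed n j k ≡.refl))))
    step₃ : sgn k * X ^ tri k * segment j k ≈ sgn k * (X ^ tri k * segment j k)
    step₃ = *-assoc _ _ _
    step₄ : X ^ tri k * segment j k ≋[ n ] X ^ tri k * 1#
    step₄ i i≤n = X^⊛-cong[] (tri k) (segment≋1 j k) i
      (ℕₚ.≤-trans i≤n (ℕₚ.≤-trans (ℕₚ.≤-reflexive (ℕₚ.+-comm j k)) (ℕₚ.+-monoˡ-≤ j (tri-≥ k))))

  jacobiSum : ℕ → Series
  jacobiSum zero    = 0#
  jacobiSum (suc m) = jacobiSum m + odd m * (sgn m * X ^ tri m)

  jacobi : ∀ n → E ^ 3 ≋[ n ] jacobiSum (suc n)
  jacobi n = ≋[]-trans (^-cong[] 3 (E≋Q n)) (≋[]-trans (≋⇒≋[] step) (go (suc n) ℕₚ.≤-refl))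
    where
    step : Q n ^ 3 ≈ Q n * weightedSum n (suc n)
    step = *-congˡ (trans (*-congˡ (*-identityʳ _)) (sym (weightedSum≈Q² n)))
    term : ∀ k → k ℕ.≤ n → Q n * d n k ≋[ n ] sgn k * X ^ tri k
    term k k≤n = ≡.subst (λ m → Q m * d m k ≋[ m ] sgn k * X ^ tri k) (ℕₚ.m∸n+n≡m k≤n) (Q*d≋ (n ℕ.∸ k) k)
    go : ∀ m → m ℕ.≤ suc n → Q n * weightedSum n m ≋[ n ] jacobiSum m
    go zero    _         = ≋⇒≋[] (zeroʳ _)
    go (suc m) (ℕ.s≤s h) = ≋[]-trans
      (≋⇒≋[] (solve 4 (λ q s o e → q :* (s :+ o :* e) := q :* s :+ o :* (q :* e)) refl (Q n) (weightedSum n m) (odd m) (d n m)))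
      (+-cong[] (go m (ℕₚ.m≤n⇒m≤1+n h)) (⊛-cong[] ≋[]-refl (term m h)))

-- Partitions and divisor sums

module Counting where
  open ≡ using (refl; sym; trans; cong; cong₂)
  open ≡-Reasoning

  sum-upTo-suc : ∀ (f : ℕ → ℕ) n → sum (map f (upTo (suc n))) ≡ sum (map f (upTo n)) ℕ.+ f n
  sum-upTo-suc f n = begin
    sum (map f (upTo (suc n)))                 ≡⟨ cong (λ xs → sum (map f xs)) (sym (upTo-∷ʳ n)) ⟩
    sum (map f (upTo n ∷ʳ n))                  ≡⟨ cong sum (map-++ f (upTo n) (n ∷ [])) ⟩
    sum (map f (upTo n) ++ f n ∷ [])           ≡⟨ sum-++ (map f (upTo n)) (f n ∷ []) ⟩
    sum (map f (upTo n)) ℕ.+ (f n ℕ.+ 0)       ≡⟨ cong (sum (map f (upTo n)) ℕ.+_) (ℕₚ.+-identityʳ (f n)) ⟩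
    sum (map f (upTo n)) ℕ.+ f n               ∎

  length-concatMap : ∀ {a b} {A : Set a} {B : Set b} (f : A → List B) xs → length (concatMap f xs) ≡ sum (map (λ x → length (f x)) xs)
  length-concatMap f []       = refl
  length-concatMap f (x ∷ xs) = trans (length-++ (f x)) (cong (length (f x) ℕ.+_) (length-concatMap f xs))

  sum-filter : ∀ {P : ℕ → Set} (P? : Decidable P) (f : ℕ → ℕ) xs →
    sum (map f (filter P? xs)) ≡ sum (map (λ x → if does (P? x) then f x else 0) xs)
  sum-filter P? f []       = refl
  sum-filter P? f (x ∷ xs) with does (P? x)
  ... | true  = cong (f x ℕ.+_) (sum-filter P? f xs)
  ... | false = sum-filter P? f xs

  filter-upTo : ∀ m n → filter (λ i → suc i ℕₚ.≤? m) (upTo n) ≡ upTo (n ℕ.⊓ m)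
  filter-upTo m zero    = refl
  filter-upTo m (suc n) = begin
    filter P? (upTo (suc n))                   ≡⟨ cong (filter P?) (sym (upTo-∷ʳ n)) ⟩
    filter P? (upTo n ∷ʳ n)                    ≡⟨ filter-++ P? (upTo n) (n ∷ []) ⟩
    filter P? (upTo n) ++ filter P? (n ∷ [])   ≡⟨ cong (_++ filter P? (n ∷ [])) (filter-upTo m n) ⟩
    upTo (n ℕ.⊓ m) ++ filter P? (n ∷ [])       ≡⟨ last ⟩
    upTo (suc n ℕ.⊓ m)                         ∎
    where
    P? = λ i → suc i ℕₚ.≤? m
    last : upTo (n ℕ.⊓ m) ++ filter P? (n ∷ []) ≡ upTo (suc n ℕ.⊓ m)
    last with suc n ℕₚ.≤? m
    ... | yes n<m = begin
      upTo (n ℕ.⊓ m) ++ filter P? (n ∷ [])  ≡⟨ cong₂ _++_ (cong upTo (ℕₚ.m≤n⇒m⊓n≡m (ℕₚ.<⇒≤ n<m))) (filter-accept P? n<m) ⟩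
      upTo n ∷ʳ n                           ≡⟨ upTo-∷ʳ n ⟩
      upTo (suc n)                          ≡⟨ cong upTo (sym (ℕₚ.m≤n⇒m⊓n≡m n<m)) ⟩
      upTo (suc n ℕ.⊓ m)                    ∎
    ... | no n≮m = begin
      upTo (n ℕ.⊓ m) ++ filter P? (n ∷ [])  ≡⟨ cong (upTo (n ℕ.⊓ m) ++_) (filter-reject P? n≮m) ⟩
      upTo (n ℕ.⊓ m) ++ []                  ≡⟨ ++-identityʳ _ ⟩
      upTo (n ℕ.⊓ m)                        ≡⟨ cong upTo (ℕₚ.m≥n⇒m⊓n≡n m≤n) ⟩
      upTo m                                ≡⟨ cong upTo (sym (ℕₚ.m≥n⇒m⊓n≡n (ℕₚ.m≤n⇒m≤1+n m≤n))) ⟩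
      upTo (suc n ℕ.⊓ m)                    ∎
      where m≤n = ℕₚ.≮⇒≥ n≮m

  fuel-irrelevant : ∀ f g {n} m → n ℕ.≤ f → n ℕ.≤ g → boundedPartitions f n m ≡ boundedPartitions g n m
  fuel-irrelevant f       g       {zero}  m _           _           = refl
  fuel-irrelevant (suc f) (suc g) {suc n} m (ℕ.s≤s n≤f) (ℕ.s≤s n≤g) =
    concatMap-cong (λ i → cong (map (suc i ∷_))
        (fuel-irrelevant f g (suc i) (ℕₚ.≤-trans (ℕₚ.m∸n≤m n i) n≤f) (ℕₚ.≤-trans (ℕₚ.m∸n≤m n i) n≤g)))
      (filter (λ i → suc i ℕₚ.≤? m) (upTo (suc n)))

  p≤ : ℕ → ℕ → ℕ
  p≤ m n = length (boundedPartitions n n m)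

  p≤-unfold : ∀ m n → p≤ m (suc n) ≡ sum (map (λ i → p≤ (suc i) (n ℕ.∸ i)) (upTo (suc n ℕ.⊓ m)))
  p≤-unfold m n = begin
    p≤ m (suc n)
      ≡⟨ length-concatMap part (filter (λ i → suc i ℕₚ.≤? m) (upTo (suc n))) ⟩
    sum (map (λ i → length (part i)) (filter (λ i → suc i ℕₚ.≤? m) (upTo (suc n))))
      ≡⟨ cong (λ xs → sum (map (λ i → length (part i)) xs)) (filter-upTo m (suc n)) ⟩
    sum (map (λ i → length (part i)) (upTo (suc n ℕ.⊓ m)))
      ≡⟨ cong sum (map-cong (λ i → trans (length-map (suc i ∷_) (boundedPartitions n (n ℕ.∸ i) (suc i)))
           (cong length (fuel-irrelevant n (n ℕ.∸ i) (suc i) (ℕₚ.m∸n≤m n i) ℕₚ.≤-refl))) (upTo (suc n ℕ.⊓ m))) ⟩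
    sum (map (λ i → p≤ (suc i) (n ℕ.∸ i)) (upTo (suc n ℕ.⊓ m))) ∎
    where
    part : ℕ → List (List ℕ)
    part i = map (suc i ∷_) (boundedPartitions n (n ℕ.∸ i) (suc i))

  p≤-zero : ∀ n → p≤ 0 (suc n) ≡ 0
  p≤-zero n = p≤-unfold 0 n

  p≤-small : ∀ {m n} → n ℕ.≤ m → p≤ (suc m) n ≡ p≤ m n
  p≤-small {m} {zero}  _   = refl
  p≤-small {m} {suc n} n<m = begin
    p≤ (suc m) (suc n)                    ≡⟨ p≤-unfold (suc m) n ⟩
    sum (map f (upTo (suc n ℕ.⊓ suc m)))  ≡⟨ cong (λ k → sum (map f (upTo k))) (trans (ℕₚ.m≤n⇒m⊓n≡m (ℕₚ.m≤n⇒m≤1+n n<m)) (sym (ℕₚ.m≤n⇒m⊓n≡m n<m))) ⟩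
    sum (map f (upTo (suc n ℕ.⊓ m)))      ≡⟨ p≤-unfold m n ⟨
    p≤ m (suc n)                          ∎
    where f = λ i → p≤ (suc i) (n ℕ.∸ i)

  p≤-step : ∀ m k → p≤ (suc m) (suc m ℕ.+ k) ≡ p≤ m (suc m ℕ.+ k) ℕ.+ p≤ (suc m) k
  p≤-step m k = begin
    p≤ (suc m) (suc (m ℕ.+ k))                                  ≡⟨ p≤-unfold (suc m) (m ℕ.+ k) ⟩
    sum (map f (upTo (suc (m ℕ.+ k) ℕ.⊓ suc m)))                ≡⟨ cong (λ l → sum (map f (upTo l))) (ℕₚ.m≥n⇒m⊓n≡n (ℕ.s≤s (ℕₚ.m≤m+n m k))) ⟩
    sum (map f (upTo (suc m)))                                  ≡⟨ sum-upTo-suc f m ⟩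
    sum (map f (upTo m)) ℕ.+ p≤ (suc m) (m ℕ.+ k ℕ.∸ m)         ≡⟨ cong₂ ℕ._+_ (cong (λ l → sum (map f (upTo l))) (sym (ℕₚ.m≥n⇒m⊓n≡n (ℕₚ.m≤n⇒m≤1+n (ℕₚ.m≤m+n m k)))))
                                                                             (cong (p≤ (suc m)) (ℕₚ.m+n∸m≡n m k)) ⟩
    sum (map f (upTo (suc (m ℕ.+ k) ℕ.⊓ m))) ℕ.+ p≤ (suc m) k   ≡⟨ cong (ℕ._+ p≤ (suc m) k) (sym (p≤-unfold m (m ℕ.+ k))) ⟩
    p≤ m (suc m ℕ.+ k) ℕ.+ p≤ (suc m) k                         ∎
    where f = λ i → p≤ (suc i) (m ℕ.+ k ℕ.∸ i)

  p≡p≤ : ∀ {m n} → n ℕ.≤ m → p n ≡ p≤ m n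
  p≡p≤ {m} {n} n≤m = ≡.subst (λ l → p n ≡ p≤ l n) (ℕₚ.m∸n+n≡m n≤m) (go (m ℕ.∸ n))
    where
    go : ∀ j → p n ≡ p≤ (j ℕ.+ n) n
    go zero    = refl
    go (suc j) = trans (go j) (sym (p≤-small (ℕₚ.m≤n+m n j)))

  divisorPart : ℕ → ℕ → ℕ
  divisorPart d zero    = 0
  divisorPart d (suc n) = if does (d ∣? suc n) then d else 0

  σ≤ : ℕ → ℕ → ℕ
  σ≤ zero    n = 0
  σ≤ (suc m) n = σ≤ m n ℕ.+ divisorPart (suc m) n

  divisorPart-small : ∀ {d n} → n ℕ.< d → divisorPart d n ≡ 0
  divisorPart-small {d} {zero}  _   = refl
  divisorPart-small {d} {suc n} n<d =
    cong (λ b → if b then d else 0) (dec-false (d ∣? suc n) (λ d∣n → contradiction (∣⇒≤ d∣n) (ℕₚ.<⇒≱ n<d)))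

  divisorPart-self : ∀ d → divisorPart (suc d) (suc d) ≡ suc d
  divisorPart-self d = cong (λ b → if b then suc d else 0) (dec-true (suc d ∣? suc d) ∣-refl)

  divisorPart-shift : ∀ d n → divisorPart (suc d) (suc d ℕ.+ suc n) ≡ divisorPart (suc d) (suc n)
  divisorPart-shift d n = cong (λ b → if b then suc d else 0)
    (does-⇔ (mk⇔ (λ h → ∣m+n∣m⇒∣n h ∣-refl) (∣m∣n⇒∣m+n ∣-refl)) (suc d ∣? (suc d ℕ.+ suc n)) (suc d ∣? suc n))

  σ≤-zero : ∀ m → σ≤ m 0 ≡ 0
  σ≤-zero zero    = refl
  σ≤-zero (suc m) = trans (ℕₚ.+-identityʳ _) (σ≤-zero m)

  σ≡σ≤ : ∀ {m n} → n ℕ.≤ m → σ n ≡ σ≤ m n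
  σ≡σ≤ {m} {n} n≤m = ≡.subst (λ l → σ n ≡ σ≤ l n) (ℕₚ.m∸n+n≡m n≤m) (go (m ℕ.∸ n))
    where
    start : ∀ n → σ n ≡ σ≤ n n
    start zero    = refl
    start (suc n) = trans (sum-filter (λ i → suc i ∣? suc n) suc (upTo (suc n))) (sums (suc n))
      where
      sums : ∀ m → sum (map (λ i → divisorPart (suc i) (suc n)) (upTo m)) ≡ σ≤ m (suc n)
      sums zero    = refl
      sums (suc m) = trans (sum-upTo-suc (λ i → divisorPart (suc i) (suc n)) m) (cong (ℕ._+ divisorPart (suc m) (suc n)) (sums m))
    go : ∀ j → σ n ≡ σ≤ (j ℕ.+ n) n
    go zero    = start n
    go (suc j) = trans (go j) (sym (trans (cong (σ≤ (j ℕ.+ n) n ℕ.+_) (divisorPart-small (ℕ.s≤s (ℕₚ.m≤n+m n j)))) (ℕₚ.+-identityʳ _)))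

module GeneratingFunctions {c ℓ : Level} (A : CommutativeRing c ℓ) where
  open PowerSeries A
  open EulerProduct A
  private
    module A = CommutativeRing A
    module AS = IntegerCoefficients A
  open CommutativeRing seriesRing hiding (zero)
  open import Algebra.Properties.Semiring.Exp semiring using (_^_; ^-congˡ; ^-homo-*)
  open import Algebra.Properties.CommutativeSemiring.Exp commutativeSemiring using (^-distrib-*)
  open import Algebra.Properties.Semiring.Mult.TCOptimised A.semiring using (×-homo-+; ×1-homo-*) renaming (_×_ to _⋅_)
  open IntegerCoefficients seriesRing using (solve; _:=_; _:+_; _:*_; _:-_; :-_; con)
  open Counting
  open import Relation.Binary.Reasoning.Setoid setoid

  ι : ℕ → A.Carrier
  ι n = n ⋅ A.1#

  ι-cong : ∀ {m n} → m ≡ n → ι m A.≈ ι n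
  ι-cong ≡.refl = A.refl

  cast : (ℕ → ℕ) → Series
  cast f n = ι (f n)

  pointwise-split : ∀ d {f g : Series} → (∀ n → n ℕ.< d → f n A.≈ g n) → (∀ k → f (d ℕ.+ k) A.≈ g (d ℕ.+ k)) → f ≈ g
  pointwise-split d {f} {g} below above = pointwise go
    where
    go : ∀ n → f n A.≈ g n
    go n with n ℕₚ.<? d
    ... | yes n<d = below n n<d
    ... | no  n≮d = ≡.subst (λ k → f k A.≈ g k) (ℕₚ.m+[n∸m]≡n (ℕₚ.≮⇒≥ n≮d)) (above (n ℕ.∸ d))

  p≤-recurrence : ∀ m → cast (p≤ (suc m)) ≈ cast (p≤ m) + X ^ suc m * cast (p≤ (suc m))
  p≤-recurrence m = pointwise-split (suc m)
    (λ n n≤m → A.trans (ι-cong (p≤-small (ℕ.s≤s⁻¹ n≤m)))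
      (A.sym (A.trans (A.+-congˡ (X^⊛-< (suc m) (cast (p≤ (suc m))) n≤m)) (A.+-identityʳ _))))
    (λ k → A.trans (ι-cong (p≤-step m k)) (A.trans (×-homo-+ A.1# (p≤ m (suc m ℕ.+ k)) (p≤ (suc m) k))
      (A.+-congˡ (A.sym (X^⊛-+ (suc m) (cast (p≤ (suc m))) k)))))

  p≤*Q : ∀ m → cast (p≤ m) * Q m ≈ 1#
  p≤*Q zero = trans (*-identityʳ _) (pointwise λ { zero → A.refl ; (suc n) → ι-cong (p≤-zero n) })
  p≤*Q (suc m) = begin
    u * (Q m * (1# - y))   ≈⟨ solve 3 (λ u q y → u :* (q :* (con (+ 1) :- y)) := (u :- y :* u) :* q) refl u (Q m) y ⟩
    (u - y * u) * Q m      ≈⟨ *-congʳ (+-congʳ (p≤-recurrence m)) ⟩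
    (v + y * u - y * u) * Q m  ≈⟨ solve 4 (λ u q y v → (v :+ y :* u :- y :* u) :* q := v :* q) refl u (Q m) y v ⟩
    v * Q m                ≈⟨ p≤*Q m ⟩
    1#                     ∎
    where
    u = cast (p≤ (suc m))
    v = cast (p≤ m)
    y = X ^ suc m

  p*E : cast p * E ≈ 1#
  p*E = pointwise λ n → A.trans
    (⊛-cong[] (λ i i≤n → ι-cong (p≡p≤ i≤n)) (E≋Q n) n ℕₚ.≤-refl)
    (at (p≤*Q n) n)

  θ : Series → Series
  θ f n = ι n A.* f n

  ⊛-merge : ∀ n a {f g f′ g′ h k : Series} →
    (∀ i j → i ℕ.+ j ≡ n → f i A.* g j A.+ f′ i A.* g′ j A.≈ a A.* (h i A.* k j)) →
    (f ⊛ g) n A.+ (f′ ⊛ g′) n A.≈ a A.* (h ⊛ k) n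
  ⊛-merge zero    a e = e 0 0 ≡.refl
  ⊛-merge (suc n) a {f} {g} {f′} {g′} {h} {k} e = A.trans
    (AS.solve 4 (λ p q r s → (p AS.:+ q) AS.:+ (r AS.:+ s) AS.:= (p AS.:+ r) AS.:+ (q AS.:+ s)) A.refl _ _ _ _)
    (A.trans (A.+-cong (e 0 (suc n) ≡.refl) (⊛-merge n a {tail f} {g} {tail f′} {g′} {tail h} {k} (λ i j eq → e (suc i) j (≡.cong suc eq))))
      (A.sym (A.distribˡ _ _ _)))

  θ-* : ∀ f g → θ (f * g) ≈ θ f * g + f * θ g
  θ-* f g = pointwise λ n → A.sym (⊛-merge n (ι n) {θ f} {g} {f} {θ g} {f} {g} λ i j eq → A.trans
    (AS.solve 4 (λ a b x y → (a AS.:* x) AS.:* y AS.:+ x AS.:* (b AS.:* y) AS.:= (a AS.:+ b) AS.:* (x AS.:* y)) A.refl (ι i) (ι j) (f i) (g j))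
    (A.*-congʳ (A.trans (A.sym (×-homo-+ A.1# i j)) (ι-cong eq))))

  θ-cong[] : ∀ {f g n} → f ≋[ n ] g → θ f ≋[ n ] θ g
  θ-cong[] e i i≤n = A.*-congˡ (e i i≤n)

  θ-1 : θ 1# ≈ 0#
  θ-1 = pointwise λ { zero → A.zeroˡ _ ; (suc n) → A.zeroʳ _ }

  θ-‿- : ∀ f g → θ (f - g) ≈ θ f - θ g
  θ-‿- f g = pointwise λ n → AS.solve 3 (λ a x y → a AS.:* (x AS.:- y) AS.:= a AS.:* x AS.:- a AS.:* y) A.refl (ι n) (f n) (g n)

  const : ℕ → Series
  const d n = d ⋅ (1# n)

  const-suc : ∀ d → const (suc d) ≈ 1# + const d
  const-suc d = pointwise λ n → 1+× d (1# n)
    where open import Algebra.Properties.Semiring.Mult.TCOptimised A.semiring using (1+×)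

  θ-X : θ X ≈ X
  θ-X = pointwise λ { zero → A.zeroˡ _ ; (suc zero) → A.*-identityˡ _ ; (suc (suc n)) → A.zeroʳ _ }

  θ-cong : ∀ {f g} → f ≈ g → θ f ≈ θ g
  θ-cong e = pointwise λ n → A.*-congˡ (at e n)

  θ-X^ : ∀ d → θ (X ^ d) ≈ const d * X ^ d
  θ-X^ zero    = trans θ-1 (sym (trans (*-identityʳ _) (pointwise λ _ → A.refl)))
  θ-X^ (suc d) = begin
    θ (X * X ^ d)                        ≈⟨ θ-* X (X ^ d) ⟩
    θ X * X ^ d + X * θ (X ^ d)          ≈⟨ +-cong (*-congʳ θ-X) (*-congˡ (θ-X^ d)) ⟩
    X * X ^ d + X * (const d * X ^ d)    ≈⟨ solve 3 (λ x y c → x :* y :+ x :* (c :* y) := (con (+ 1) :+ c) :* (x :* y)) refl X (X ^ d) (const d) ⟩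
    (1# + const d) * (X * X ^ d)         ≈⟨ *-congʳ (sym (const-suc d)) ⟩
    const (suc d) * (X * X ^ d)          ∎

  divisorPart-recurrence : ∀ d → cast (divisorPart (suc d)) ≈ X ^ suc d * (const (suc d) + cast (divisorPart (suc d)))
  divisorPart-recurrence d = pointwise-split (suc d)
    (λ n n≤d → A.trans (ι-cong (divisorPart-small n≤d)) (A.sym (X^⊛-< (suc d) _ n≤d)))
    (λ k → A.trans (coefficient k) (A.sym (X^⊛-+ (suc d) _ k)))
    where
    open import Algebra.Properties.Monoid.Mult.TCOptimised A.+-monoid using (×ᵤ≈×)
    open import Algebra.Properties.Monoid.Mult A.+-monoid using () renaming (_×_ to _⋅ᵤ_)
    ⋅-zero : ∀ n → n ⋅ A.0# A.≈ A.0#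
    ⋅-zero n = A.trans (A.sym (×ᵤ≈× n A.0#)) (go n)
      where
      go : ∀ n → n ⋅ᵤ A.0# A.≈ A.0#
      go zero    = A.refl
      go (suc n) = A.trans (A.+-identityˡ _) (go n)
    coefficient : ∀ k → ι (divisorPart (suc d) (suc d ℕ.+ k)) A.≈ (const (suc d) + cast (divisorPart (suc d))) k
    coefficient zero = A.trans (ι-cong (≡.trans (≡.cong (divisorPart (suc d)) (ℕₚ.+-identityʳ (suc d))) (divisorPart-self d)))
      (A.sym (A.+-identityʳ _))
    coefficient (suc k) = A.trans (ι-cong (divisorPart-shift d k))
      (A.sym (A.trans (A.+-congʳ (⋅-zero (suc d))) (A.+-identityˡ _)))

  θQ : ∀ m → θ (Q m) ≈ - (Q m * cast (σ≤ m))
  θQ zero = trans θ-1 (sym (solve 1 (λ a → :- (con (+ 1) :* con (+ 0)) := con (+ 0)) refl 1#))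
  θQ (suc m) = begin
    θ (q * (1# - y))                       ≈⟨ θ-* q (1# - y) ⟩
    θ q * (1# - y) + q * θ (1# - y)        ≈⟨ +-cong (*-congʳ (θQ m)) (*-congˡ (trans (θ-‿- 1# y) (+-cong θ-1 (-‿cong (θ-X^ (suc m)))))) ⟩
    - (q * s) * (1# - y) + q * (0# - k * y)
      ≈⟨ solve 5 (λ q s y k l → (:- (q :* s)) :* (con (+ 1) :- y) :+ q :* (con (+ 0) :- k :* y)
               := (:- (q :* s)) :* (con (+ 1) :- y) :- q :* (y :* (k :+ l) :- y :* l)) refl q s y k l ⟩
    - (q * s) * (1# - y) - q * (y * (k + l) - y * l)
      ≈⟨ +-congˡ (-‿cong (*-congˡ (+-congʳ (sym (divisorPart-recurrence m))))) ⟩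
    - (q * s) * (1# - y) - q * (l - y * l)
      ≈⟨ solve 4 (λ q s y l → (:- (q :* s)) :* (con (+ 1) :- y) :- q :* (l :- y :* l) := :- (q :* (con (+ 1) :- y) :* (s :+ l))) refl q s y l ⟩
    - (q * (1# - y) * (s + l))
      ≈⟨ -‿cong (*-congˡ (pointwise λ n → A.sym (×-homo-+ A.1# (σ≤ m n) (divisorPart (suc m) n)))) ⟩
    - (q * (1# - y) * cast (σ≤ (suc m))) ∎
    where
    q = Q m
    s = cast (σ≤ m)
    y = X ^ suc m
    k = const (suc m)
    l = cast (divisorPart (suc m))

  σ*E : cast σ * E ≈ - θ E
  σ*E = pointwise λ n → A.trans
    (⊛-cong[] (λ i i≤n → ι-cong (σ≡σ≤ i≤n)) (E≋Q n) n ℕₚ.≤-refl)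
    (A.trans (at (solve 2 (λ s q → s :* q := :- (:- (q :* s))) refl (cast (σ≤ n)) (Q n)) n)
      (A.-‿cong (A.trans (A.sym (at (θQ n) n)) (θ-cong[] (≋[]-sym (E≋Q n)) n ℕₚ.≤-refl))))

  cast-⋆ : ∀ f g → cast (f ⋆ g) ≈ cast f * cast g
  cast-⋆ f g = pointwise λ n → go n f g
    where
    go : ∀ n f g → ι ((f ⋆ g) n) A.≈ (cast f * cast g) n
    go n f g = A.trans (ι-cong (≡.cong sum (map-applyUpTo (λ i → i) (λ i → f i ℕ.* g (n ℕ.∸ i)) (suc n)))) (applied n f g)
      where
      applied : ∀ n f g → ι (sum (applyUpTo (λ i → f i ℕ.* g (n ℕ.∸ i)) (suc n))) A.≈ (cast f * cast g) n
      applied zero    f g = A.trans (ι-cong (ℕₚ.+-identityʳ (f 0 ℕ.* g 0))) (×1-homo-* (f 0) (g 0))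
      applied (suc n) f g = A.trans (×-homo-+ A.1# (f 0 ℕ.* g (suc n)) _)
        (A.+-cong (×1-homo-* (f 0) (g (suc n))) (applied n (λ i → f (suc i)) g))

  cast-convPow : ∀ k f → cast (convPow k f) ≈ cast f ^ k
  cast-convPow zero    f = pointwise λ { zero → A.refl ; (suc n) → A.refl }
  cast-convPow (suc k) f = trans (cast-⋆ f (convPow k f)) (*-congˡ (cast-convPow k f))

  p^*E^ : ∀ k l → cast p ^ k * E ^ (k ℕ.+ l) ≈ E ^ l
  p^*E^ k l = begin
    cast p ^ k * E ^ (k ℕ.+ l)      ≈⟨ *-congˡ (^-homo-* E k l) ⟩
    cast p ^ k * (E ^ k * E ^ l)    ≈⟨ *-assoc _ _ _ ⟨
    cast p ^ k * E ^ k * E ^ l      ≈⟨ *-congʳ (^-distrib-* (cast p) E k) ⟨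
    (cast p * E) ^ k * E ^ l        ≈⟨ *-congʳ (^-congˡ k p*E) ⟩
    1# ^ k * E ^ l                  ≈⟨ *-congʳ (1^ k) ⟩
    1# * E ^ l                      ≈⟨ *-identityˡ _ ⟩
    E ^ l                           ∎
    where
    1^ : ∀ k → 1# ^ k ≈ 1#
    1^ zero    = refl
    1^ (suc k) = trans (*-identityˡ _) (1^ k)

  σ^*E^ : ∀ k l → cast σ ^ k * E ^ (k ℕ.+ l) ≈ (- θ E) ^ k * E ^ l
  σ^*E^ k l = begin
    cast σ ^ k * E ^ (k ℕ.+ l)      ≈⟨ *-congˡ (^-homo-* E k l) ⟩
    cast σ ^ k * (E ^ k * E ^ l)    ≈⟨ *-assoc _ _ _ ⟨
    cast σ ^ k * E ^ k * E ^ l      ≈⟨ *-congʳ (^-distrib-* (cast σ) E k) ⟨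
    (cast σ * E) ^ k * E ^ l        ≈⟨ *-congʳ (^-congˡ k σ*E) ⟩
    (- θ E) ^ k * E ^ l             ∎

-- Polynomials with natural number coefficients

-- The dense recursive representation: a polynomial in n + 1 variables is the list of its coefficients
-- with respect to the first variable.
Poly : ℕ → Set
Poly zero    = ℕ
Poly (suc n) = List (Poly n)

zeroᵖ : ∀ n → Poly n
zeroᵖ zero    = 0
zeroᵖ (suc n) = []

constᵖ : ∀ n → ℕ → Poly n
constᵖ zero    c = c
constᵖ (suc n) c = constᵖ n c ∷ []

addᵖ : ∀ n → Poly n → Poly n → Poly n
addᵖ zero    a        b        = a ℕ.+ b
addᵖ (suc n) []       q        = q
addᵖ (suc n) (a ∷ p)  []       = a ∷ p
addᵖ (suc n) (a ∷ p)  (b ∷ q)  = addᵖ n a b ∷ addᵖ (suc n) p q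

mulᵖ : ∀ n → Poly n → Poly n → Poly n
mulᵖ zero    a       b = a ℕ.* b
mulᵖ (suc n) []      q = []
mulᵖ (suc n) (a ∷ p) q = addᵖ (suc n) (map (mulᵖ n a) q) (zeroᵖ n ∷ mulᵖ (suc n) p q)

powᵖ : ∀ n → Poly n → ℕ → Poly n
powᵖ n p zero    = constᵖ n 1
powᵖ n p (suc k) = mulᵖ n p (powᵖ n p k)

linᵖ : (ℕ → ℕ) → (cs : List ℕ) → Poly (length cs)
linᵖ g []       = 0
linᵖ g (c ∷ cs) = linᵖ g cs ∷ constᵖ (length cs) (g c) ∷ []

monoᵖ : ∀ {n} → ℕ → Vec ℕ n → Poly n
monoᵖ c []                 = c
monoᵖ {suc n} c (e ∷ es)   = replicate e (zeroᵖ n) ++ monoᵖ c es ∷ []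

termsᵖ : ∀ {n} → List (ℕ × Vec ℕ n) → Poly n
termsᵖ {n} []             = zeroᵖ n
termsᵖ {n} ((c , e) ∷ ts) = addᵖ n (monoᵖ c e) (termsᵖ ts)

divisibleᵖ : (q : ℕ) .{{_ : ℕ.NonZero q}} → ∀ n → Poly n → Bool
divisibleᵖ q zero    a       = a % q ℕ.≡ᵇ 0
divisibleᵖ q (suc n) []      = true
divisibleᵖ q (suc n) (a ∷ p) = divisibleᵖ q n a ∧ divisibleᵖ q (suc n) p

-- The monomials whose weight, increased by w, is r modulo q.  The weights ws of the variables stand for the
-- residue classes of the exponents in the series substituted for them.
partᵖ : (q : ℕ) .{{_ : ℕ.NonZero q}} (r : ℕ) → ∀ {n} → Vec ℕ n → ℕ → Poly n → Poly n
partᵖ q r []       w a       = if w % q ℕ.≡ᵇ r then a else 0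
partᵖ q r (v ∷ ws) w []      = []
partᵖ q r (v ∷ ws) w (a ∷ p) = partᵖ q r ws w a ∷ partᵖ q r (v ∷ ws) (w ℕ.+ v) p

module Evaluation {c ℓ : Level} (R : CommutativeRing c ℓ) where
  open CommutativeRing R hiding (zero)
  open IntegerCoefficients R using (solve; _:=_; _:+_; _:*_; con)
  open import Algebra.Properties.Semiring.Exp semiring using (_^_)
  open import Algebra.Properties.Semiring.Mult.TCOptimised semiring using (×-homo-+; ×1-homo-*) renaming (_×_ to _⋅_)
  open import Relation.Binary.Reasoning.Setoid setoid

  eval : ∀ {n} → Poly n → Vec Carrier n → Carrier
  eval a       []       = a ⋅ 1#
  eval []      (x ∷ xs) = 0#
  eval (a ∷ p) (x ∷ xs) = eval a xs + x * eval p (x ∷ xs)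

  eval-zero : ∀ {n} (xs : Vec Carrier n) → eval (zeroᵖ n) xs ≈ 0#
  eval-zero []       = refl
  eval-zero (x ∷ xs) = refl

  eval-const : ∀ {n} k (xs : Vec Carrier n) → eval (constᵖ n k) xs ≈ k ⋅ 1#
  eval-const k []       = refl
  eval-const k (x ∷ xs) = trans (+-cong (eval-const k xs) (zeroʳ x)) (+-identityʳ _)

  eval-add : ∀ {n} (p q : Poly n) xs → eval (addᵖ n p q) xs ≈ eval p xs + eval q xs
  eval-add a       b       []       = ×-homo-+ 1# a b
  eval-add []      q       (x ∷ xs) = sym (+-identityˡ _)
  eval-add (a ∷ p) []      (x ∷ xs) = sym (+-identityʳ _)
  eval-add (a ∷ p) (b ∷ q) (x ∷ xs) = trans (+-cong (eval-add a b xs) (*-congˡ (eval-add p q (x ∷ xs))))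
    (solve 5 (λ x a b p q → (a :+ b) :+ x :* (p :+ q) := a :+ x :* p :+ (b :+ x :* q)) refl x _ _ _ _)

  eval-mul : ∀ {n} (p q : Poly n) xs → eval (mulᵖ n p q) xs ≈ eval p xs * eval q xs
  eval-mul a       b []       = ×1-homo-* a b
  eval-mul []      q (x ∷ xs) = sym (zeroˡ _)
  eval-mul {suc n} (a ∷ p) q (x ∷ xs) = begin
    eval (addᵖ (suc n) (map (mulᵖ n a) q) (zeroᵖ n ∷ mulᵖ (suc n) p q)) (x ∷ xs)
      ≈⟨ eval-add (map (mulᵖ n a) q) (zeroᵖ n ∷ mulᵖ (suc n) p q) (x ∷ xs) ⟩
    eval (map (mulᵖ n a) q) (x ∷ xs) + (eval (zeroᵖ n) xs + x * eval (mulᵖ (suc n) p q) (x ∷ xs))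
      ≈⟨ +-cong (scale q) (+-cong (eval-zero xs) (*-congˡ (eval-mul p q (x ∷ xs)))) ⟩
    eval a xs * eval q (x ∷ xs) + (0# + x * (eval p (x ∷ xs) * eval q (x ∷ xs)))
      ≈⟨ solve 4 (λ x a p q → a :* q :+ (con (+ 0) :+ x :* (p :* q)) := (a :+ x :* p) :* q) refl x _ _ _ ⟩
    (eval a xs + x * eval p (x ∷ xs)) * eval q (x ∷ xs) ∎
    where
    scale : ∀ q → eval (map (mulᵖ n a) q) (x ∷ xs) ≈ eval a xs * eval q (x ∷ xs)
    scale []      = sym (zeroʳ _)
    scale (b ∷ q) = trans (+-cong (eval-mul a b xs) (*-congˡ (scale q)))
      (solve 4 (λ x a b q → a :* b :+ x :* (a :* q) := a :* (b :+ x :* q)) refl x _ _ _)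

  eval-pow : ∀ {n} (p : Poly n) xs k → eval (powᵖ n p k) xs ≈ eval p xs ^ k
  eval-pow p xs zero    = eval-const 1 xs
  eval-pow p xs (suc k) = trans (eval-mul p (powᵖ _ p k) xs) (*-congˡ (eval-pow p xs k))

  module _ {q : ℕ} .{{q≢0 : ℕ.NonZero q}} (q≈0 : q ⋅ 1# ≈ 0#) where
    multiple≈0 : ∀ {n} → q ∣ n → n ⋅ 1# ≈ 0#
    multiple≈0 (divides k ≡.refl) = trans (×1-homo-* k q) (trans (*-congˡ q≈0) (zeroʳ _))

    eval-divisible : ∀ {n} (p : Poly n) xs → T (divisibleᵖ q n p) → eval p xs ≈ 0#
    eval-divisible a       []       h = multiple≈0 (m%n≡0⇒n∣m a q (ℕₚ.≡ᵇ⇒≡ (a % q) 0 h))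
    eval-divisible []      (x ∷ xs) h = refl
    eval-divisible (a ∷ p) (x ∷ xs) h with Equivalence.to T-∧ h
    ... | h₁ , h₂ = trans (+-cong (eval-divisible a xs h₁) (*-congˡ (eval-divisible p (x ∷ xs) h₂))) (trans (+-identityˡ _) (zeroʳ x))

-- Certificates modulo q.  partᵖ q r … p is the component of residue class r of p; if some components of a
-- power series given by p vanish, then so does every combination of the corresponding parts of p.
combinationᵖ : (q : ℕ) .{{_ : ℕ.NonZero q}} → ∀ {n} → Vec ℕ n → Poly n → List (ℕ × Poly n) → Poly n
combinationᵖ q {n} ws p []             = zeroᵖ n
combinationᵖ q {n} ws p ((r , h) ∷ hs) = addᵖ n (mulᵖ n h (partᵖ q r ws 0 p)) (combinationᵖ q ws p hs)

certifies : (q : ℕ) .{{_ : ℕ.NonZero q}} → ∀ {n} → Vec ℕ n → Poly n → List (ℕ × Poly n) → ℕ → Poly n → Bool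
certifies q {n} ws p hs r t = divisibleᵖ q n (addᵖ n (partᵖ q r ws 0 t) (combinationᵖ q ws p hs))

module ResidueClasses {c ℓ : Level} (A : CommutativeRing c ℓ) (q : ℕ) .{{q≢0 : ℕ.NonZero q}} where
  open PowerSeries A
  private module A = CommutativeRing A
  open CommutativeRing seriesRing hiding (zero)
  open Evaluation seriesRing
  open import Algebra.Properties.Semiring.Mult.TCOptimised semiring using () renaming (_×_ to _⋅_)

  Vanishes : ℕ → Series → Set ℓ
  Vanishes r f = ∀ n → n % q ≡ r → f n A.≈ A.0#

  Vanishes-resp : ∀ {r f g} → f ≈ g → Vanishes r f → Vanishes r g
  Vanishes-resp e v n h = A.trans (A.sym (at e n)) (v n h)

  ResiduesIn : List ℕ → Series → Set ℓ
  ResiduesIn cs f = ∀ n → f n A.≈ A.0# ⊎ n % q ∈ cs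

  Supported : ℕ → Series → Set ℓ
  Supported v = ResiduesIn (v % q ∷ [])

  data AllSupported : ∀ {n} → Vec ℕ n → Vec Series n → Set (c ⊔ ℓ) where
    []  : AllSupported [] []
    _∷_ : ∀ {n v f} {vs : Vec ℕ n} {fs} → Supported v f → AllSupported vs fs → AllSupported (v ∷ vs) (f ∷ fs)

  %-+-cong : ∀ {a b} c → a % q ≡ b % q → (a ℕ.+ c) % q ≡ (b ℕ.+ c) % q
  %-+-cong {a} {b} c e = ≡.trans (%-distribˡ-+ a c q) (≡.trans (≡.cong (λ x → (x ℕ.+ c % q) % q) e) (≡.sym (%-distribˡ-+ b c q)))

  shift-class : ∀ {i j N v w} → i ℕ.+ j ≡ N → i % q ≡ v % q → (j ℕ.+ (w ℕ.+ v)) % q ≡ (N ℕ.+ w) % q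
  shift-class {i} {j} {N} {v} {w} ≡.refl e =
    ≡.trans (≡.cong (_% q) (h₁ j w v)) (≡.trans (%-+-cong (j ℕ.+ w) (≡.sym e)) (≡.cong (_% q) (≡.sym (ℕₚ.+-assoc i j w))))
    where
    h₁ : ∀ j w v → j ℕ.+ (w ℕ.+ v) ≡ v ℕ.+ (j ℕ.+ w)
    h₁ j w v = ≡.trans (≡.sym (ℕₚ.+-assoc j w v)) (ℕₚ.+-comm (j ℕ.+ w) v)

  constant-suc : ∀ a n → (a ⋅ 1#) (suc n) A.≈ A.0#
  constant-suc a n = go a
    where
    go : ∀ a → (a ⋅ 1#) (suc n) A.≈ A.0#
    go zero          = A.refl
    go (suc zero)    = A.refl
    go (suc (suc a)) = A.trans (A.+-identityʳ _) (go (suc a))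

  part-same : ∀ r {n} {ws : Vec ℕ n} {xs} w p → AllSupported ws xs →
    ∀ N → (N ℕ.+ w) % q ≡ r → eval p xs N A.≈ eval (partᵖ q r ws w p) xs N
  part-same r w a       []       zero    h =
    A.reflexive (≡.cong (λ b → ((if b then a else 0) ⋅ 1#) 0) (≡.sym (dec-true (w % q ℕₚ.≟ r) h)))
  part-same r w a       []       (suc N) h = A.trans (constant-suc a N) (A.sym (constant-suc (partᵖ q r [] w a) N))
  part-same r w []      (s ∷ ss) N       h = A.refl
  part-same r w (a ∷ p) (_∷_ {v = v} s ss) N h = A.+-cong (part-same r w a ss N h) (⊛-local N λ i j eq → term i j eq (s i))
    where
    term : ∀ i j → i ℕ.+ j ≡ N → _ A.≈ A.0# ⊎ i % q ∈ (v % q ∷ []) → _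
    term i j eq (inj₁ z) = A.trans (A.trans (A.*-congʳ z) (A.zeroˡ _)) (A.sym (A.trans (A.*-congʳ z) (A.zeroˡ _)))
    term i j eq (inj₂ (here e)) = A.*-congˡ (part-same r (w ℕ.+ v) p (s ∷ ss) j (≡.trans (shift-class {w = w} eq e) h))

  part-other : ∀ r {n} {ws : Vec ℕ n} {xs} w p → AllSupported ws xs →
    ∀ N → ¬ (N ℕ.+ w) % q ≡ r → eval (partᵖ q r ws w p) xs N A.≈ A.0#
  part-other r w a       []       zero    h =
    A.reflexive (≡.cong (λ b → ((if b then a else 0) ⋅ 1#) 0) (dec-false (w % q ℕₚ.≟ r) h))
  part-other r w a       []       (suc N) h = constant-suc (partᵖ q r [] w a) N
  part-other r w []      (s ∷ ss) N       h = A.refl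
  part-other r w (a ∷ p) (_∷_ {v = v} s ss) N h = A.trans (A.+-cong (part-other r w a ss N h) (⊛-zero N λ i j eq → term i j eq (s i))) (A.+-identityˡ _)
    where
    term : ∀ i j → i ℕ.+ j ≡ N → _ A.≈ A.0# ⊎ i % q ∈ (v % q ∷ []) → _
    term i j eq (inj₁ z) = A.trans (A.*-congʳ z) (A.zeroˡ _)
    term i j eq (inj₂ (here e)) = A.trans (A.*-congˡ (part-other r (w ℕ.+ v) p (s ∷ ss) j (λ h′ → h (≡.trans (≡.sym (shift-class {w = w} eq e)) h′)))) (A.zeroʳ _)

  part≈0 : ∀ r {n} {ws : Vec ℕ n} {xs} p → AllSupported ws xs → Vanishes r (eval p xs) → eval (partᵖ q r ws 0 p) xs ≈ 0#
  part≈0 r p ss v = pointwise go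
    where
    go : ∀ N → _
    go N with (N ℕ.+ 0) % q ℕₚ.≟ r
    ... | yes h = A.trans (A.sym (part-same r 0 p ss N h)) (v N (≡.trans (≡.cong (_% q) (≡.sym (ℕₚ.+-identityʳ N))) h))
    ... | no h  = part-other r 0 p ss N h

  module _ (q≈0 : q ⋅ 1# ≈ 0#) where
    combination≈0 : ∀ {n} {ws : Vec ℕ n} {xs} p → AllSupported ws xs → ∀ hs →
      All (λ (r , _) → Vanishes r (eval p xs)) hs → eval (combinationᵖ q ws p hs) xs ≈ 0#
    combination≈0 {xs = xs} p ss []             _        = eval-zero xs
    combination≈0 {ws = ws} {xs} p ss ((r , h) ∷ hs) (v ∷ vs) =
      trans (eval-add (mulᵖ _ h (partᵖ q r ws 0 p)) (combinationᵖ q ws p hs) xs)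
        (trans (+-cong (trans (eval-mul h (partᵖ q r ws 0 p) xs) (trans (*-congˡ (part≈0 r p ss v)) (zeroʳ _)))
                       (combination≈0 p ss hs vs))
               (+-identityˡ _))

    certified : ∀ {n} {ws : Vec ℕ n} {xs} p → AllSupported ws xs → ∀ hs → All (λ (r , _) → Vanishes r (eval p xs)) hs →
      ∀ r t → T (certifies q ws p hs r t) → Vanishes r (eval t xs)
    certified {ws = ws} {xs} p ss hs vs r t cert N h =
      A.trans (part-same r 0 t ss N (≡.trans (≡.cong (_% q) (ℕₚ.+-identityʳ N)) h)) (at target≈0 N)
      where
      target≈0 : eval (partᵖ q r ws 0 t) xs ≈ 0#
      target≈0 = trans (sym (+-identityʳ _)) (trans (+-congˡ (sym (combination≈0 p ss hs vs)))
        (trans (sym (eval-add (partᵖ q r ws 0 t) (combinationᵖ q ws p hs) xs))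
               (eval-divisible q≈0 (addᵖ _ (partᵖ q r ws 0 t) (combinationᵖ q ws p hs)) xs cert)))

-- (1 + y)^q - (1 + y^q) with -1 replaced by q - 1.
freshman : ℕ → Poly 1
freshman q = addᵖ 1 (powᵖ 1 (1 ∷ 1 ∷ []) q)
                    (mulᵖ 1 (constᵖ 1 (ℕ.pred q)) (addᵖ 1 (constᵖ 1 1) (powᵖ 1 (0 ∷ 1 ∷ []) q)))

module Congruences {c ℓ : Level} (A : CommutativeRing c ℓ) (q : ℕ) .{{q≢0 : ℕ.NonZero q}} where
  open PowerSeries A
  open EulerProduct A
  open GeneratingFunctions A
  open ResidueClasses A q
  private module A = CommutativeRing A
  open CommutativeRing seriesRing hiding (zero)
  open Evaluation seriesRing
  open IntegerCoefficients seriesRing using (solve; _:=_; _:+_; _:*_; _:-_; :-_; con)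
  open import Algebra.Properties.Semiring.Exp semiring using (_^_; ^-congˡ; ^-homo-*; ^-assocʳ)
  open import Algebra.Properties.CommutativeSemiring.Exp commutativeSemiring using (^-distrib-*)
  open import Algebra.Properties.Semiring.Mult.TCOptimised semiring using (1+×) renaming (_×_ to _⋅_)
  open import Algebra.Properties.Group +-group using (∙-cancelʳ)
  open import Algebra.Properties.Ring ring using (-‿distribˡ-*)
  open import Relation.Binary.Reasoning.Setoid setoid

  module _ {cs : List ℕ} where
    ResiduesIn-resp : ∀ {f g} → f ≈ g → ResiduesIn cs f → ResiduesIn cs g
    ResiduesIn-resp e h n with h n
    ... | inj₁ z = inj₁ (A.trans (A.sym (at e n)) z)
    ... | inj₂ m = inj₂ m

    ResiduesIn-0 : ResiduesIn cs 0#
    ResiduesIn-0 n = inj₁ A.refl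

    ResiduesIn-+ : ∀ {f g} → ResiduesIn cs f → ResiduesIn cs g → ResiduesIn cs (f + g)
    ResiduesIn-+ hf hg n with hf n | hg n
    ... | inj₂ m | _      = inj₂ m
    ... | inj₁ _ | inj₂ m = inj₂ m
    ... | inj₁ y | inj₁ z = inj₁ (A.trans (A.+-cong y z) (A.+-identityˡ _))

    ResiduesIn-‿- : ∀ {f} → ResiduesIn cs f → ResiduesIn cs (- f)
    ResiduesIn-‿- h n with h n
    ... | inj₁ z = inj₁ (A.trans (A.-‿cong z) -0#≈0#)
      where open import Algebra.Properties.Ring A.ring using (-0#≈0#)
    ... | inj₂ m = inj₂ m

    ResiduesIn-sgn* : ∀ k {f} → ResiduesIn cs f → ResiduesIn cs (sgn k * f)
    ResiduesIn-sgn* zero    h = ResiduesIn-resp (sym (*-identityˡ _)) h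
    ResiduesIn-sgn* (suc k) h = ResiduesIn-resp (-‿distribˡ-* _ _) (ResiduesIn-‿- (ResiduesIn-sgn* k h))

    ResiduesIn-odd* : ∀ k {f} → ResiduesIn cs f → ResiduesIn cs (odd k * f)
    ResiduesIn-odd* zero    h = ResiduesIn-resp (sym (*-identityˡ _)) h
    ResiduesIn-odd* (suc k) {f} h = ResiduesIn-resp
      (solve 2 (λ o f → o :* f :+ (f :+ f) := (o :+ (con (+ 1) :+ con (+ 1))) :* f) refl (odd k) f)
      (ResiduesIn-+ (ResiduesIn-odd* k h) (ResiduesIn-+ h h))

    ResiduesIn-X^ : ∀ e → e % q ∈ cs → ResiduesIn cs (X ^ e)
    ResiduesIn-X^ e h n with ℕₚ.<-cmp n e
    ... | tri< n<e _ _ = inj₁ (X^-vanish e n<e n ℕₚ.≤-refl)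
    ... | tri≈ _ ≡.refl _ = inj₂ h
    ... | tri> _ _ e<n = inj₁ (≡.subst (λ k → (X ^ e) k A.≈ A.0#) (≡.trans (ℕₚ.+-suc e _) (ℕₚ.m+[n∸m]≡n e<n))
                          (A.trans (A.sym (at (*-identityʳ (X ^ e)) _)) (X^⊛-+ e 1# (suc (n ℕ.∸ suc e)))))

    ResiduesIn⇒Vanishes : ∀ {f r} → ResiduesIn cs f → r ∉ cs → Vanishes r f
    ResiduesIn⇒Vanishes h r∉ n ≡.refl with h n
    ... | inj₁ z = z
    ... | inj₂ m = contradiction m r∉

  ResiduesIn-*⇒Vanishes : ∀ {cs ds f g r} → ResiduesIn cs f → ResiduesIn ds g →
    All (λ a → All (λ b → ¬ (a ℕ.+ b) % q ≡ r) ds) cs → Vanishes r (f * g)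
  ResiduesIn-*⇒Vanishes {f = f} {g} hf hg apart n n≡r = ⊛-zero n term
    where
    term : ∀ i j → i ℕ.+ j ≡ n → f i A.* g j A.≈ A.0#
    term i j ≡.refl with hf i | hg j
    ... | inj₁ z | _      = A.trans (A.*-congʳ z) (A.zeroˡ _)
    ... | inj₂ _ | inj₁ z = A.trans (A.*-congˡ z) (A.zeroʳ _)
    ... | inj₂ a | inj₂ b = contradiction (≡.trans (≡.sym (%-distribˡ-+ i j q)) n≡r) (All.lookup (All.lookup apart a) b)

  periodic : ∀ (f : ℕ → ℕ) → (∀ n → f (n ℕ.+ q) % q ≡ f n % q) → ∀ n → f n % q ≡ f (n % q) % q
  periodic f h n = ≡.trans (≡.cong (λ k → f k % q) (m≡m%n+[m/n]*n n q)) (go (n % q) (n / q))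
    where
    go : ∀ m k → f (m ℕ.+ k ℕ.* q) % q ≡ f m % q
    go m zero    = ≡.cong (λ k → f k % q) (ℕₚ.+-identityʳ m)
    go m (suc k) = ≡.trans (≡.cong (λ k → f k % q) (≡.trans (≡.cong (m ℕ.+_) (ℕₚ.+-comm q (k ℕ.* q))) (≡.sym (ℕₚ.+-assoc m (k ℕ.* q) q))))
                     (≡.trans (h (m ℕ.+ k ℕ.* q)) (go m k))

  tri-+ : ∀ n m → tri (n ℕ.+ m) ≡ tri n ℕ.+ n ℕ.* m ℕ.+ tri m
  tri-+ n zero    = ≡.trans (≡.cong tri (ℕₚ.+-identityʳ n)) (h n (tri n))
    where
    h : ∀ n T → T ≡ T ℕ.+ n ℕ.* 0 ℕ.+ 0
    h = solve-∀
  tri-+ n (suc m) = ≡.trans (≡.cong tri (ℕₚ.+-suc n m)) (≡.trans (≡.cong (ℕ._+ suc (n ℕ.+ m)) (tri-+ n m)) (h n m (tri n) (tri m)))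
    where
    h : ∀ n m S T → S ℕ.+ n ℕ.* m ℕ.+ T ℕ.+ suc (n ℕ.+ m) ≡ S ℕ.+ n ℕ.* suc m ℕ.+ (T ℕ.+ suc m)
    h = solve-∀

  module _ (q∣tri : q ∣ tri q) where
    t : ℕ
    t = _∣_.quotient q∣tri

    tri-shift : ∀ n → tri (n ℕ.+ q) ≡ tri n ℕ.+ (n ℕ.+ t) ℕ.* q
    tri-shift n = ≡.trans (tri-+ n q) (≡.trans (≡.cong (tri n ℕ.+ n ℕ.* q ℕ.+_) (_∣_.equality q∣tri)) (h n q t (tri n)))
      where
      h : ∀ n q t T → T ℕ.+ n ℕ.* q ℕ.+ t ℕ.* q ≡ T ℕ.+ (n ℕ.+ t) ℕ.* q
      h = solve-∀

    tri-periodic : ∀ n → tri n % q ≡ tri (n % q) % q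
    tri-periodic = periodic tri λ n → ≡.trans (≡.cong (_% q) (tri-shift n)) ([m+kn]%n≡m%n (tri n) (n ℕ.+ t) q)

    pent₁-periodic : ∀ n → pent₁ n % q ≡ pent₁ (n % q) % q
    pent₁-periodic = periodic pent₁ λ n →
      ≡.trans (≡.cong (_% q) (≡.trans (≡.cong (suc (n ℕ.+ q) ℕ.* suc (n ℕ.+ q) ℕ.+_) (tri-shift n)) (h n q t (tri n))))
              ([m+kn]%n≡m%n (pent₁ n) (suc n ℕ.+ suc n ℕ.+ q ℕ.+ n ℕ.+ t) q)
      where
      h : ∀ n q t T → suc (n ℕ.+ q) ℕ.* suc (n ℕ.+ q) ℕ.+ (T ℕ.+ (n ℕ.+ t) ℕ.* q)
                      ≡ suc n ℕ.* suc n ℕ.+ T ℕ.+ (suc n ℕ.+ suc n ℕ.+ q ℕ.+ n ℕ.+ t) ℕ.* q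
      h = solve-∀

    pent₂-periodic : ∀ n → pent₂ n % q ≡ pent₂ (n % q) % q
    pent₂-periodic = periodic pent₂ λ n →
      ≡.trans (≡.cong (_% q) (≡.trans (≡.cong (λ T → suc (n ℕ.+ q) ℕ.* suc (n ℕ.+ q) ℕ.+ (T ℕ.+ suc (n ℕ.+ q))) (tri-shift n)) (h n q t (tri n))))
              ([m+kn]%n≡m%n (pent₂ n) (suc (suc n ℕ.+ suc n ℕ.+ q ℕ.+ n ℕ.+ t)) q)
      where
      h : ∀ n q t T → suc (n ℕ.+ q) ℕ.* suc (n ℕ.+ q) ℕ.+ (T ℕ.+ (n ℕ.+ t) ℕ.* q ℕ.+ suc (n ℕ.+ q))
                      ≡ suc n ℕ.* suc n ℕ.+ (T ℕ.+ suc n) ℕ.+ suc (suc n ℕ.+ suc n ℕ.+ q ℕ.+ n ℕ.+ t) ℕ.* q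
      h = solve-∀

    residue∈ : ∀ n → n % q ∈ upTo q
    residue∈ n = ∈-upTo⁺ (m%n<n n q)

    E-residues : ∀ {cs} → 0 % q ∈ cs → All (λ i → pent₁ i % q ∈ cs × pent₂ i % q ∈ cs) (upTo q) → ResiduesIn cs E
    E-residues {cs} 0∈ pent∈ n with sums n n
      where
      sums : ∀ m → ResiduesIn cs (shanksSum m)
      sums zero    = ResiduesIn-resp (sym (*-identityˡ _)) (ResiduesIn-X^ 0 0∈)
      sums (suc m) = ResiduesIn-resp (sym (shanksSum-suc m))
        (ResiduesIn-+ (sums m) (ResiduesIn-sgn* (suc m) (ResiduesIn-+
          (ResiduesIn-X^ (pent₁ m) (≡.subst (_∈ cs) (≡.sym (pent₁-periodic m)) (proj₁ (All.lookup pent∈ (residue∈ m)))))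
          (ResiduesIn-X^ (pent₂ m) (≡.subst (_∈ cs) (≡.sym (pent₂-periodic m)) (proj₂ (All.lookup pent∈ (residue∈ m))))))))
    ... | inj₁ z = inj₁ (A.trans (pentagonal n n ℕₚ.≤-refl) z)
    ... | inj₂ m = inj₂ m

    module _ (q≈0 : q ⋅ 1# ≈ 0#) where
      odd≈ : ∀ k → odd k ≈ suc (k ℕ.+ k) ⋅ 1#
      odd≈ zero    = refl
      odd≈ (suc k) = begin
        odd k + (1# + 1#)                  ≈⟨ +-congʳ (odd≈ k) ⟩
        suc (k ℕ.+ k) ⋅ 1# + (1# + 1#)     ≈⟨ solve 1 (λ a → a :+ (con (+ 1) :+ con (+ 1)) := con (+ 1) :+ (con (+ 1) :+ a)) refl _ ⟩
        1# + (1# + suc (k ℕ.+ k) ⋅ 1#)     ≈⟨ +-congˡ (1+× (suc (k ℕ.+ k)) 1#) ⟨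
        1# + suc (suc (k ℕ.+ k)) ⋅ 1#      ≈⟨ 1+× (suc (suc (k ℕ.+ k))) 1# ⟨
        suc (suc (suc (k ℕ.+ k))) ⋅ 1#     ≡⟨ ≡.cong (λ m → suc (suc m) ⋅ 1#) (≡.sym (ℕₚ.+-suc k k)) ⟩
        suc (suc k ℕ.+ suc k) ⋅ 1#         ∎

      odd-periodic : ∀ n → suc (n ℕ.+ n) % q ≡ suc (n % q ℕ.+ n % q) % q
      odd-periodic = periodic (λ n → suc (n ℕ.+ n)) λ n → ≡.trans (≡.cong (_% q) (h n q)) ([m+kn]%n≡m%n (suc (n ℕ.+ n)) 2 q)
        where
        h : ∀ n q → suc (n ℕ.+ q ℕ.+ (n ℕ.+ q)) ≡ suc (n ℕ.+ n) ℕ.+ 2 ℕ.* q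
        h = solve-∀

      E³-residues : ∀ {cs} → All (λ i → suc (i ℕ.+ i) % q ≡ 0 ⊎ tri i % q ∈ cs) (upTo q) → ResiduesIn cs (E ^ 3)
      E³-residues {cs} tri∈ n with sums (suc n) n
        where
        term : ∀ m → ResiduesIn cs (odd m * (sgn m * X ^ tri m))
        term m with All.lookup tri∈ (residue∈ m)
        ... | inj₁ q∣odd = ResiduesIn-resp
          (sym (trans (*-congʳ (trans (odd≈ m) (multiple≈0 q≈0 (m%n≡0⇒n∣m (suc (m ℕ.+ m)) q (≡.trans (odd-periodic m) q∣odd))))) (zeroˡ _)))
          ResiduesIn-0
        ... | inj₂ h = ResiduesIn-odd* m (ResiduesIn-sgn* m (ResiduesIn-X^ (tri m) (≡.subst (_∈ cs) (≡.sym (tri-periodic m)) h)))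
        sums : ∀ m → ResiduesIn cs (jacobiSum m)
        sums zero    = ResiduesIn-0
        sums (suc m) = ResiduesIn-+ (sums m) (term m)
      ... | inj₁ z = inj₁ (A.trans (jacobi n n ℕₚ.≤-refl) z)
      ... | inj₂ m = inj₂ m

  Supported-X : Supported 1 X
  Supported-X zero          = inj₁ A.refl
  Supported-X (suc zero)    = inj₂ (here ≡.refl)
  Supported-X (suc (suc n)) = inj₁ A.refl

  Supported-1 : Supported 0 1#
  Supported-1 zero    = inj₂ (here ≡.refl)
  Supported-1 (suc n) = inj₁ A.refl

  Supported-* : ∀ {v w f g} → Supported v f → Supported w g → Supported (v ℕ.+ w) (f * g)
  Supported-* {v} {w} {f} {g} hf hg n with n % q ℕₚ.≟ (v ℕ.+ w) % q
  ... | yes e = inj₂ (here e)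
  ... | no ≢  = inj₁ (⊛-zero n term)
    where
    term : ∀ i j → i ℕ.+ j ≡ n → f i A.* g j A.≈ A.0#
    term i j ≡.refl with hf i | hg j
    ... | inj₁ z | _      = A.trans (A.*-congʳ z) (A.zeroˡ _)
    ... | inj₂ _ | inj₁ z = A.trans (A.*-congˡ z) (A.zeroʳ _)
    ... | inj₂ (here a) | inj₂ (here b) = contradiction
      (≡.trans (%-distribˡ-+ i j q) (≡.trans (≡.cong₂ (λ a b → (a ℕ.+ b) % q) a b) (≡.sym (%-distribˡ-+ v w q)))) ≢

  Supported-^ : ∀ {v f} k → Supported v f → Supported (k ℕ.* v) (f ^ k)
  Supported-^ zero    h = Supported-1
  Supported-^ (suc k) h = Supported-* h (Supported-^ k h)

  Supported-≡% : ∀ {v w f} → v % q ≡ w % q → Supported v f → Supported w f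
  Supported-≡% e h n with h n
  ... | inj₁ z = inj₁ z
  ... | inj₂ (here m) = inj₂ (here (≡.trans m e))

  Vanishes-* : ∀ {D f r} → Supported 0 D → Vanishes r f → Vanishes r (D * f)
  Vanishes-* {D} {f} hD hf n n≡r = ⊛-zero n term
    where
    term : ∀ i j → i ℕ.+ j ≡ n → D i A.* f j A.≈ A.0#
    term i j ≡.refl with hD i
    ... | inj₁ z = A.trans (A.*-congʳ z) (A.zeroˡ _)
    ... | inj₂ (here e) = A.trans (A.*-congˡ (hf j (≡.trans (≡.sym (%-+-cong {i} {0} j e)) n≡r))) (A.zeroʳ _)

  Vanishes-divide : ∀ {D f r} → D 0 A.≈ A.1# → Supported 0 D → Vanishes r (D * f) → Vanishes r f
  Vanishes-divide {D} {f} {r} D₀ hD hDf = <-rec _ step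
    where
    step : ∀ n → (∀ {m} → m ℕ.< n → m % q ≡ r → f m A.≈ A.0#) → n % q ≡ r → f n A.≈ A.0#
    step zero    rec n≡r = A.trans (A.sym (A.trans (A.*-congʳ D₀) (A.*-identityˡ _))) (hDf 0 n≡r)
    step (suc n) rec n≡r = A.trans (A.sym (A.trans (A.+-cong (A.trans (A.*-congʳ D₀) (A.*-identityˡ _)) (⊛-zero n term)) (A.+-identityʳ _))) (hDf (suc n) n≡r)
      where
      term : ∀ i j → i ℕ.+ j ≡ n → D (suc i) A.* f j A.≈ A.0#
      term i j ≡.refl with hD (suc i)
      ... | inj₁ z = A.trans (A.*-congʳ z) (A.zeroˡ _)
      ... | inj₂ (here e) = A.trans (A.*-congˡ (rec (ℕ.s≤s (ℕₚ.m≤n+m j i)) (≡.trans (≡.sym (%-+-cong {suc i} {0} j e)) n≡r))) (A.zeroʳ _)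

  restrict except : ℕ → Series → Series
  restrict v f n = if n % q ℕ.≡ᵇ v then f n else A.0#
  except   v f n = if n % q ℕ.≡ᵇ v then A.0# else f n

  components : (cs : List ℕ) → Series → Vec Series (length cs)
  components []       f = []
  components (v ∷ cs) f = restrict v f ∷ components cs (except v f)

  restrict-Supported : ∀ v f → Supported v (restrict v f)
  restrict-Supported v f n with n % q ℕₚ.≟ v
  ... | yes ≡.refl = inj₂ (here (≡.sym (m%n%n≡m%n n q)))
  ... | no ≢v      = inj₁ (A.reflexive (≡.cong (λ b → if b then f n else A.0#) (dec-false (n % q ℕₚ.≟ v) ≢v)))

  components-Supported : ∀ cs f → AllSupported (fromList cs) (components cs f)
  components-Supported []       f = []
  components-Supported (v ∷ cs) f = restrict-Supported v f ∷ components-Supported cs (except v f)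

  restrict+except : ∀ v f → restrict v f + except v f ≈ f
  restrict+except v f = pointwise λ n → go n (n % q ℕ.≡ᵇ v)
    where
    go : ∀ n b → (if b then f n else A.0#) A.+ (if b then A.0# else f n) A.≈ f n
    go n true  = A.+-identityʳ _
    go n false = A.+-identityˡ _

  except-residues : ∀ {v cs f} → ResiduesIn (v ∷ cs) f → ResiduesIn cs (except v f)
  except-residues {v} {cs} {f} h n with h n
  ... | inj₂ (here e)  = inj₁ (A.reflexive (≡.cong (λ b → if b then A.0# else f n) (dec-true (n % q ℕₚ.≟ v) e)))
  ... | inj₂ (there m) = inj₂ m
  ... | inj₁ z         = inj₁ (go (n % q ℕ.≡ᵇ v))
    where
    go : ∀ b → (if b then A.0# else f n) A.≈ A.0#
    go true  = A.refl
    go false = z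

  constant-* : ∀ k f n → (k ⋅ 1# * f) n A.≈ ι k A.* f n
  constant-* zero    f n = A.trans (at (zeroˡ f) n) (A.sym (A.zeroˡ _))
  constant-* (suc k) f n = A.trans (at (trans (*-congʳ (1+× k 1#)) (trans (distribʳ f 1# (k ⋅ 1#)) (+-congʳ (*-identityˡ f)))) n)
    (A.trans (A.+-cong (A.sym (A.*-identityˡ _)) (constant-* k f n))
      (A.trans (A.sym (A.distribʳ (f n) A.1# (ι k))) (A.*-congʳ (A.sym (1+×ᴬ k A.1#)))))
    where open import Algebra.Properties.Semiring.Mult.TCOptimised A.semiring using () renaming (1+× to 1+×ᴬ)

  eval-linᵖ-∷ : ∀ g v cs f fs → eval (linᵖ g (v ∷ cs)) (f ∷ fs) ≈ (g v ⋅ 1#) * f + eval (linᵖ g cs) fs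
  eval-linᵖ-∷ g v cs f fs = trans (+-congˡ (*-congˡ (trans (+-congˡ (zeroʳ f)) (trans (+-identityʳ _) (eval-const (g v) fs)))))
    (trans (+-comm _ _) (+-congʳ (*-comm _ _)))

  eval-components : ∀ cs {f} → ResiduesIn cs f → eval (linᵖ (λ _ → 1) cs) (components cs f) ≈ f
  eval-components []       {f} h = pointwise λ n → go n (h n)
    where
    go : ∀ n → f n A.≈ A.0# ⊎ n % q ∈ [] → A.0# A.≈ f n
    go n (inj₁ z) = A.sym z
  eval-components (v ∷ cs) {f} h = begin
    eval (linᵖ (λ _ → 1) (v ∷ cs)) (components (v ∷ cs) f)
      ≈⟨ eval-linᵖ-∷ (λ _ → 1) v cs (restrict v f) (components cs (except v f)) ⟩
    1# * restrict v f + eval (linᵖ (λ _ → 1) cs) (components cs (except v f))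
      ≈⟨ +-cong (*-identityˡ _) (eval-components cs (except-residues h)) ⟩
    restrict v f + except v f
      ≈⟨ restrict+except v f ⟩
    f ∎

  module Prime (q≈0 : ι q A.≈ A.0#) (q∣tri : q ∣ tri q) (frobenius : T (divisibleᵖ q 1 (freshman q))) where
    q⋅1≈0 : q ⋅ 1# ≈ 0#
    q⋅1≈0 = pointwise λ n → A.trans (A.sym (at (*-identityʳ (q ⋅ 1#)) n))
      (A.trans (constant-* q 1# n) (A.trans (A.*-congʳ q≈0) (A.zeroˡ _)))

    ι-residue : ∀ n → ι n A.≈ ι (n % q)
    ι-residue n = A.trans (ι-cong (m≡m%n+[m/n]*n n q)) (A.trans (×-homo-+ A.1# (n % q) (n / q ℕ.* q))
      (A.trans (A.+-congˡ (A.trans (×1-homo-* (n / q) q) (A.trans (A.*-congˡ q≈0) (A.zeroʳ _)))) (A.+-identityʳ _)))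
      where open import Algebra.Properties.Semiring.Mult.TCOptimised A.semiring using (×-homo-+; ×1-homo-*)

    eval-θ-components : ∀ cs {f} → ResiduesIn cs f → eval (linᵖ (λ v → v) cs) (components cs f) ≈ θ f
    eval-θ-components []       {f} h = pointwise λ n → go n (h n)
      where
      go : ∀ n → f n A.≈ A.0# ⊎ n % q ∈ [] → A.0# A.≈ ι n A.* f n
      go n (inj₁ z) = A.sym (A.trans (A.*-congˡ z) (A.zeroʳ _))
    eval-θ-components (v ∷ cs) {f} h = begin
      eval (linᵖ (λ v → v) (v ∷ cs)) (components (v ∷ cs) f)
        ≈⟨ eval-linᵖ-∷ (λ v → v) v cs (restrict v f) (components cs (except v f)) ⟩
      (v ⋅ 1#) * restrict v f + eval (linᵖ (λ v → v) cs) (components cs (except v f))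
        ≈⟨ +-cong (pointwise λ n → A.trans (constant-* v (restrict v f) n) (weight n)) (eval-θ-components cs (except-residues h)) ⟩
      θ (restrict v f) + θ (except v f)
        ≈⟨ (pointwise λ n → A.sym (A.distribˡ (ι n) _ _)) ⟩
      θ (restrict v f + except v f)
        ≈⟨ θ-cong (restrict+except v f) ⟩
      θ f ∎
      where
      weight : ∀ n → ι v A.* restrict v f n A.≈ ι n A.* restrict v f n
      weight n with n % q ℕₚ.≟ v
      ... | yes ≡.refl = A.*-congʳ (A.sym (ι-residue n))
      ... | no ≢v = A.trans (A.*-congˡ zero′) (A.trans (A.zeroʳ _) (A.sym (A.trans (A.*-congˡ zero′) (A.zeroʳ _))))
        where
        zero′ : restrict v f n A.≈ A.0#
        zero′ = A.reflexive (≡.cong (λ b → if b then f n else A.0#) (dec-false (n % q ℕₚ.≟ v) ≢v))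

    freshman's-dream : ∀ y → (1# + y) ^ q ≈ 1# + y ^ q
    freshman's-dream y = ∙-cancelʳ (ℕ.pred q ⋅ 1# * u) _ _ (begin
      (1# + y) ^ q + ℕ.pred q ⋅ 1# * u        ≈⟨ sym expand ⟩
      eval (freshman q) (y ∷ [])              ≈⟨ eval-divisible q⋅1≈0 (freshman q) (y ∷ []) frobenius ⟩
      0#                                      ≈⟨ trans (*-congʳ q⋅1≈0) (zeroˡ u) ⟨
      q ⋅ 1# * u                              ≡⟨ ≡.cong (λ k → k ⋅ 1# * u) (≡.sym (ℕₚ.suc-pred q)) ⟩
      suc (ℕ.pred q) ⋅ 1# * u                 ≈⟨ *-congʳ (1+× (ℕ.pred q) 1#) ⟩
      (1# + ℕ.pred q ⋅ 1#) * u                ≈⟨ solve 2 (λ a u → (con (+ 1) :+ a) :* u := u :+ a :* u) refl (ℕ.pred q ⋅ 1#) u ⟩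
      u + ℕ.pred q ⋅ 1# * u                   ∎)
      where
      u = 1# + y ^ q
      one+y one var : Poly 1
      one+y = 1 ∷ 1 ∷ []
      one = constᵖ 1 1
      var = 0 ∷ 1 ∷ []
      eval-one+y : eval one+y (y ∷ []) ≈ 1# + y
      eval-one+y = solve 1 (λ y → con (+ 1) :+ y :* (con (+ 1) :+ y :* con (+ 0)) := con (+ 1) :+ y) refl y
      eval-var : eval var (y ∷ []) ≈ y
      eval-var = solve 1 (λ y → con (+ 0) :+ y :* (con (+ 1) :+ y :* con (+ 0)) := y) refl y
      expand : eval (freshman q) (y ∷ []) ≈ (1# + y) ^ q + ℕ.pred q ⋅ 1# * u
      expand = trans (eval-add (powᵖ 1 one+y q) (mulᵖ 1 (constᵖ 1 (ℕ.pred q)) (addᵖ 1 one (powᵖ 1 var q))) (y ∷ []))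
        (+-cong (trans (eval-pow one+y (y ∷ []) q) (^-congˡ q eval-one+y))
          (trans (eval-mul (constᵖ 1 (ℕ.pred q)) (addᵖ 1 one (powᵖ 1 var q)) (y ∷ []))
            (*-cong (eval-const (ℕ.pred q) (y ∷ []))
              (trans (eval-add one (powᵖ 1 var q) (y ∷ []))
                (+-cong (eval-const 1 (y ∷ [])) (trans (eval-pow var (y ∷ []) q) (^-congˡ q eval-var)))))))

    q*k%q : ∀ k → (q ℕ.* k) % q ≡ 0 % q
    q*k%q k = ≡.trans (≡.cong (_% q) (ℕₚ.*-comm q k)) (≡.trans (m*n%n≡0 k q) (≡.sym (m*n%n≡0 0 q)))

    Q^q-Supported : ∀ n → Supported 0 (Q n ^ q)
    Q^q-Supported zero    = Supported-≡% (q*k%q 0) (Supported-^ q Supported-1)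
    Q^q-Supported (suc n) = ResiduesIn-resp (sym (^-distrib-* (Q n) (1# - X ^ suc n) q))
      (Supported-* (Q^q-Supported n) (ResiduesIn-resp (sym (freshman's-dream (- X ^ suc n)))
        (ResiduesIn-+ Supported-1 (Supported-≡% (q*k%q (suc n ℕ.* 1)) (Supported-^ q (ResiduesIn-‿- (Supported-^ (suc n) Supported-X)))))))

    E^q-Supported : Supported 0 (E ^ q)
    E^q-Supported n with Q^q-Supported n n
    ... | inj₁ z = inj₁ (A.trans (^-cong[] q (E≋Q n) n ℕₚ.≤-refl) z)
    ... | inj₂ m = inj₂ m

    E^≈1 : ∀ k → (E ^ k) 0 A.≈ A.1#
    E^≈1 zero    = A.refl
    E^≈1 (suc k) = A.trans (A.*-congˡ (E^≈1 k)) (A.*-identityʳ _)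

    lower : ∀ {m r} → Vanishes r (E ^ (q ℕ.+ m)) → Vanishes r (E ^ m)
    lower {m} v = Vanishes-divide {E ^ q} (E^≈1 q) E^q-Supported (Vanishes-resp (^-homo-* E q m) v)

    raise : ∀ {m r} → Vanishes r (E ^ m) → Vanishes r (E ^ (q ℕ.+ m))
    raise {m} v = Vanishes-resp (sym (^-homo-* E q m)) (Vanishes-* E^q-Supported v)

    p-vanishes : ∀ k {l r} → k ℕ.+ l ≡ q → Vanishes r (E ^ l) → Vanishes r (cast (convPow k p))
    p-vanishes k {l} k+l≡q v = Vanishes-divide {E ^ q} (E^≈1 q) E^q-Supported (Vanishes-resp (begin
      E ^ l                           ≈⟨ p^*E^ k l ⟨
      cast p ^ k * E ^ (k ℕ.+ l)      ≡⟨ ≡.cong (λ m → cast p ^ k * E ^ m) k+l≡q ⟩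
      cast p ^ k * E ^ q              ≈⟨ *-comm _ _ ⟩
      E ^ q * cast p ^ k              ≈⟨ *-congˡ (cast-convPow k p) ⟨
      E ^ q * cast (convPow k p)      ∎) v)

    σ-vanishes : ∀ k {l r} → k ℕ.+ l ≡ q → Vanishes r (θ E ^ k * E ^ l) → Vanishes r (cast (convPow k σ))
    σ-vanishes k {l} k+l≡q v = Vanishes-divide {E ^ q} (E^≈1 q) E^q-Supported (Vanishes-resp (begin
      (- θ E) ^ k * E ^ l             ≈⟨ σ^*E^ k l ⟨
      cast σ ^ k * E ^ (k ℕ.+ l)      ≡⟨ ≡.cong (λ m → cast σ ^ k * E ^ m) k+l≡q ⟩
      cast σ ^ k * E ^ q              ≈⟨ *-comm _ _ ⟩
      E ^ q * cast σ ^ k              ≈⟨ *-congˡ (cast-convPow k σ) ⟨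
      E ^ q * cast (convPow k σ)      ∎) (neg k (E ^ l) v))
      where
      neg : ∀ k g {r} → Vanishes r (θ E ^ k * g) → Vanishes r ((- θ E) ^ k * g)
      neg k g v n h = A.trans (at (sign k g) n) (sgn* k (θ E ^ k * g) n (v n h))
        where
        sign : ∀ k g → (- θ E) ^ k * g ≈ sgn k * (θ E ^ k * g)
        sign zero    g = sym (*-identityˡ _)
        sign (suc k) g = trans (solve 3 (λ a b g → (:- a) :* b :* g := (:- a) :* (b :* g)) refl (θ E) ((- θ E) ^ k) g)
          (trans (*-congˡ (sign k g)) (solve 4 (λ a b s g → (:- a) :* (s :* (b :* g)) := (:- s) :* (a :* b :* g)) refl (θ E) (θ E ^ k) (sgn k) g))
        sgn* : ∀ k f n → f n A.≈ A.0# → (sgn k * f) n A.≈ A.0#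
        sgn* zero    f n z = A.trans (at (*-identityˡ f) n) z
        sgn* (suc k) f n z = A.trans (A.sym (at (-‿distribˡ-* (sgn k) f) n)) (A.trans (A.-‿cong (sgn* k f n z)) -0#≈0#)
          where open import Algebra.Properties.Ring A.ring using (-0#≈0#)

    eval-pow-components : ∀ cs {f} → ResiduesIn cs f → ∀ k → eval (powᵖ _ (linᵖ (λ _ → 1) cs) k) (components cs f) ≈ f ^ k
    eval-pow-components cs {f} h k = trans (eval-pow (linᵖ (λ _ → 1) cs) (components cs f) k) (^-congˡ k (eval-components cs h))

    certified-E³ : ∀ {cs} → ResiduesIn cs (E ^ 3) → ∀ hs → All (λ (r , _) → Vanishes r (E ^ 12)) hs → ∀ k r →
      T (certifies q (fromList cs) (powᵖ _ (linᵖ (λ _ → 1) cs) 4) hs r (powᵖ _ (linᵖ (λ _ → 1) cs) k)) →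
      Vanishes r (E ^ (3 ℕ.* k))
    certified-E³ {cs} h hs vs k r cert = Vanishes-resp (trans (eval-pow-components cs h k) (^-assocʳ E 3 k))
      (certified q⋅1≈0 (powᵖ _ (linᵖ (λ _ → 1) cs) 4) (components-Supported cs (E ^ 3)) hs
        (All.map (Vanishes-resp (sym (trans (eval-pow-components cs h 4) (^-assocʳ E 3 4)))) vs)
        r (powᵖ _ (linᵖ (λ _ → 1) cs) k) cert)

    certified-θE : ∀ {cs} → ResiduesIn cs E → ∀ hs → All (λ (r , _) → Vanishes r (E ^ 3)) hs → ∀ k l r →
      T (certifies q (fromList cs) (powᵖ _ (linᵖ (λ _ → 1) cs) 3) hs r
          (mulᵖ _ (powᵖ _ (linᵖ (λ v → v) cs) k) (powᵖ _ (linᵖ (λ _ → 1) cs) l))) →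
      Vanishes r (θ E ^ k * E ^ l)
    certified-θE {cs} h hs vs k l r cert = Vanishes-resp
      (trans (eval-mul (powᵖ _ (linᵖ (λ v → v) cs) k) (powᵖ _ (linᵖ (λ _ → 1) cs) l) (components cs E))
        (*-cong (trans (eval-pow (linᵖ (λ v → v) cs) (components cs E) k) (^-congˡ k (eval-θ-components cs h)))
                (eval-pow-components cs h l)))
      (certified q⋅1≈0 (powᵖ _ (linᵖ (λ _ → 1) cs) 3) (components-Supported cs E) hs
        (All.map (Vanishes-resp (sym (eval-pow-components cs h 3))) vs)
        r (mulᵖ _ (powᵖ _ (linᵖ (λ v → v) cs) k) (powᵖ _ (linᵖ (λ _ → 1) cs) l)) cert)

-- The integers modulo q

module Modular (q : ℕ) where
  infix 4 _≈_
  _≈_ : ℤ → ℤ → Set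
  i ≈ j = + q ℤ∣.∣ i ℤ.- j

  ≡⇒≈ : ∀ {i j} → i ≡ j → i ≈ j
  ≡⇒≈ {i} ≡.refl = ≡.subst (+ q ℤ∣.∣_) (≡.sym (ℤₚ.+-inverseʳ i)) (ℤ∣.divides ℤ.0ℤ ≡.refl)

  ≈-sym : ∀ {i j} → i ≈ j → j ≈ i
  ≈-sym {i} {j} h = ≡.subst (+ q ℤ∣.∣_) (lemma i j) (ℤ∣.∣m⇒∣-m h)
    where
    lemma : ∀ i j → ℤ.- (i ℤ.- j) ≡ j ℤ.- i
    lemma = ℤ-solve-∀

  ≈-trans : ∀ {i j k} → i ≈ j → j ≈ k → i ≈ k
  ≈-trans {i} {j} {k} h h′ = ≡.subst (+ q ℤ∣.∣_) (lemma i j k) (ℤ∣.∣m∣n⇒∣m+n h h′)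
    where
    lemma : ∀ i j k → i ℤ.- j ℤ.+ (j ℤ.- k) ≡ i ℤ.- k
    lemma = ℤ-solve-∀

  +-cong : ∀ {i j k l} → i ≈ j → k ≈ l → i ℤ.+ k ≈ j ℤ.+ l
  +-cong {i} {j} {k} {l} h h′ = ≡.subst (+ q ℤ∣.∣_) (lemma i j k l) (ℤ∣.∣m∣n⇒∣m+n h h′)
    where
    lemma : ∀ i j k l → i ℤ.- j ℤ.+ (k ℤ.- l) ≡ i ℤ.+ k ℤ.- (j ℤ.+ l)
    lemma = ℤ-solve-∀

  *-cong : ∀ {i j k l} → i ≈ j → k ≈ l → i ℤ.* k ≈ j ℤ.* l
  *-cong {i} {j} {k} {l} h h′ = ≡.subst (+ q ℤ∣.∣_) (lemma i j k l) (ℤ∣.∣m∣n⇒∣m+n (ℤ∣.∣m⇒∣m*n k h) (ℤ∣.∣n⇒∣m*n j h′))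
    where
    lemma : ∀ i j k l → (i ℤ.- j) ℤ.* k ℤ.+ j ℤ.* (k ℤ.- l) ≡ i ℤ.* k ℤ.- j ℤ.* l
    lemma = ℤ-solve-∀

  -‿cong : ∀ {i j} → i ≈ j → ℤ.- i ≈ ℤ.- j
  -‿cong {i} {j} h = ≡.subst (+ q ℤ∣.∣_) (lemma i j) (ℤ∣.∣m⇒∣-m h)
    where
    lemma : ∀ i j → ℤ.- (i ℤ.- j) ≡ ℤ.- i ℤ.- ℤ.- j
    lemma = ℤ-solve-∀

  modularRing : CommutativeRing 0ℓ 0ℓ
  modularRing = record
    { Carrier = ℤ
    ; _≈_ = _≈_
    ; _+_ = ℤ._+_
    ; _*_ = ℤ._*_
    ; -_ = ℤ.-_
    ; 0# = ℤ.0ℤ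
    ; 1# = ℤ.1ℤ
    ; isCommutativeRing = record
      { isRing = record
        { +-isAbelianGroup = record
          { isGroup = record
            { isMonoid = record
              { isSemigroup = record
                { isMagma = record
                  { isEquivalence = record
                    { refl = λ {i} → ≡⇒≈ {i} ≡.refl
                    ; sym = λ {i} {j} → ≈-sym {i} {j}
                    ; trans = λ {i} {j} {k} → ≈-trans {i} {j} {k}
                    }
                  ; ∙-cong = λ {i} {j} {k} {l} → +-cong {i} {j} {k} {l}
                  }
                ; assoc = λ i j k → ≡⇒≈ (ℤₚ.+-assoc i j k)
                }
              ; identity = (λ i → ≡⇒≈ (ℤₚ.+-identityˡ i)) , (λ i → ≡⇒≈ (ℤₚ.+-identityʳ i))
              }
            ; inverse = (λ i → ≡⇒≈ (ℤₚ.+-inverseˡ i)) , (λ i → ≡⇒≈ (ℤₚ.+-inverseʳ i))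
            ; ⁻¹-cong = λ {i} {j} → -‿cong {i} {j}
            }
          ; comm = λ i j → ≡⇒≈ (ℤₚ.+-comm i j)
          }
        ; *-cong = λ {i} {j} {k} {l} → *-cong {i} {j} {k} {l}
        ; *-assoc = λ i j k → ≡⇒≈ (ℤₚ.*-assoc i j k)
        ; *-identity = (λ i → ≡⇒≈ (ℤₚ.*-identityˡ i)) , (λ i → ≡⇒≈ (ℤₚ.*-identityʳ i))
        ; distrib = (λ i j k → ≡⇒≈ (ℤₚ.*-distribˡ-+ i j k)) , (λ i j k → ≡⇒≈ (ℤₚ.*-distribʳ-+ i j k))
        }
      ; *-comm = λ i j → ≡⇒≈ (ℤₚ.*-comm i j)
      }
    }

  open import Algebra.Properties.Semiring.Mult.TCOptimised (CommutativeRing.semiring modularRing) using () renaming (_×_ to _⋅_)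

  n⋅1≡n : ∀ n → n ⋅ ℤ.1ℤ ≡ + n
  n⋅1≡n zero          = ≡.refl
  n⋅1≡n (suc zero)    = ≡.refl
  n⋅1≡n (suc (suc n)) = ≡.trans (≡.cong (ℤ._+ ℤ.1ℤ) (n⋅1≡n (suc n))) (≡.cong +_ (ℕₚ.+-comm (suc n) 1))

  n⋅1-0≡n : ∀ n → n ⋅ ℤ.1ℤ ℤ.- ℤ.0ℤ ≡ + n
  n⋅1-0≡n n = ≡.trans (ℤₚ.+-identityʳ _) (n⋅1≡n n)

  q⋅1≈0 : q ⋅ ℤ.1ℤ ≈ ℤ.0ℤ
  q⋅1≈0 = ≡.subst (+ q ℤ∣.∣_) (≡.sym (n⋅1-0≡n q)) ℤ∣.∣-refl

  ≈0⇒∣ : ∀ {n} → n ⋅ ℤ.1ℤ ≈ ℤ.0ℤ → q ∣ n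
  ≈0⇒∣ {n} h = ℤ∣.∣⇒∣ᵤ (≡.subst (+ q ℤ∣.∣_) (n⋅1-0≡n n) h)

-- Tables of initial coefficients

nth : List ℕ → ℕ → ℕ
nth []       _       = 0
nth (x ∷ xs) zero    = x
nth (x ∷ xs) (suc n) = nth xs n

nth-map-upTo : ∀ (f : ℕ → ℕ) {n N} → n ℕ.< N → nth (map f (upTo N)) n ≡ f n
nth-map-upTo f {n} {N} n<N = ≡.trans (≡.cong (λ xs → nth xs n) (map-upTo f N)) (go f n<N)
  where
  go : ∀ (f : ℕ → ℕ) {n N} → n ℕ.< N → nth (applyUpTo f N) n ≡ f n
  go f {zero}  {suc N} _         = ≡.refl
  go f {suc n} {suc N} (ℕ.s≤s h) = go (λ i → f (suc i)) h

⋆-local : ∀ {f f′ g g′ : ℕ → ℕ} {N} → (∀ {n} → n ℕ.< N → f n ≡ f′ n) → (∀ {n} → n ℕ.< N → g n ≡ g′ n) →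
  ∀ {n} → n ℕ.< N → (f ⋆ g) n ≡ (f′ ⋆ g′) n
⋆-local hf hg {n} n<N = ≡.cong sum (map-cong-local (All.tabulate {xs = upTo (suc n)} λ {i} i∈ → ≡.cong₂ ℕ._*_
  (hf (ℕₚ.<-≤-trans (∈-upTo⁻ i∈) n<N)) (hg (ℕₚ.≤-<-trans (ℕₚ.m∸n≤m n i) n<N))))

powerTable : (N : ℕ) → List ℕ → ℕ → List ℕ
powerTable N xs zero    = map δ₀ (upTo N)
powerTable N xs (suc k) = next (powerTable N xs k)
  where
  next : List ℕ → List ℕ
  next ys = map (nth xs ⋆ nth ys) (upTo N)

powerTable-correct : ∀ {N f} xs → map f (upTo N) ≡ xs → ∀ k {n} → n ℕ.< N → nth (powerTable N xs k) n ≡ convPow k f n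
powerTable-correct xs ≡.refl zero    n<N = nth-map-upTo δ₀ n<N
powerTable-correct {N} {f} xs ≡.refl (suc k) n<N = ≡.trans (nth-map-upTo (nth xs ⋆ nth (powerTable N xs k)) n<N)
  (⋆-local (nth-map-upTo f) (powerTable-correct xs ≡.refl k) n<N)

module _ (q : ℕ) .{{_ : ℕ.NonZero q}} (L : List (ℕ × ℕ)) (N : ℕ) where
  Excluded : List ℕ → ℕ → Set
  Excluded ys r = Any (λ n → q ℕ.* n ℕ.+ r ℕ.< N × ¬ nth ys (q ℕ.* n ℕ.+ r) % q ≡ 0) (upTo N)

  Row : ℕ → List ℕ → Set
  Row k ys = All (λ r → (k , r) ∈ L ⊎ Excluded ys r) (upTo q)

  row? : ∀ k ys → Dec (Row k ys)
  row? k ys = All.all? (λ r → Any.any? (≡-dec ℕₚ._≟_ ℕₚ._≟_ (k , r)) L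
    ⊎-dec Any.any? (λ n → (q ℕ.* n ℕ.+ r ℕₚ.<? N) ×-dec ¬? (nth ys (q ℕ.* n ℕ.+ r) % q ℕₚ.≟ 0)) (upTo N)) (upTo q)

  Rows : List ℕ → Set
  Rows xs = All (λ k → Row (suc k) (powerTable N xs (suc k))) (upTo (ℕ.pred q))

  rows? : ∀ xs → Dec (Rows xs)
  rows? xs = All.all? (λ k → row? (suc k) (powerTable N xs (suc k))) (upTo (ℕ.pred q))

  exactCongruences : ∀ {f} xs → map f (upTo N) ≡ xs → Rows xs →
    All (λ (k , r) → ∀ n → q ∣ convPow k f (q ℕ.* n ℕ.+ r)) L → ExactCongruences (λ k → convPow k f) q L
  exactCongruences {f} xs table rows congruences k r 0<k k<q r<q = mk⇔ to (All.lookup congruences)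
    where
    find : ∀ {k} → 0 ℕ.< k → k ℕ.< q → Row k (powerTable N xs k)
    find {suc k} _ k<q = All.lookup rows (∈-upTo⁺ (ℕ.s≤s⁻¹ (ℕₚ.<-≤-trans k<q (ℕₚ.≤-reflexive (≡.sym (ℕₚ.suc-pred q))))))
    to : (∀ n → q ∣ convPow k f (q ℕ.* n ℕ.+ r)) → (k , r) ∈ L
    to h with All.lookup (find 0<k k<q) (∈-upTo⁺ r<q)
    ... | inj₁ m = m
    ... | inj₂ e with Any.satisfied e
    ...   | n , n<N , ≢0 = contradiction (≡.trans (≡.cong (_% q) (powerTable-correct xs table k n<N)) (n∣m⇒m%n≡0 _ q (h n))) ≢0

open import Data.Nat.Base using (_+_; _*_)

-- Pairs (r , h), found by linear algebra over ℤ/q: the part of the target polynomial in question plus the sum of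
-- h times the part of class r of (x₁ + … + xₙ)³, or (x₁ + … + xₙ)⁴ for E⁸ and E¹⁰, is divisible by q.

certificate-σ-5-2-1 : List (ℕ × Poly 3)
certificate-σ-5-2-1 =
    (2 , termsᵖ ((1 , 0 ∷ 0 ∷ 2 ∷ []) ∷ []))
    ∷ (3 , termsᵖ ((3 , 0 ∷ 1 ∷ 1 ∷ []) ∷ []))
    ∷ []

certificate-σ-5-3-1 : List (ℕ × Poly 3)
certificate-σ-5-3-1 =
    (2 , termsᵖ ((4 , 0 ∷ 0 ∷ 2 ∷ []) ∷ []))
    ∷ (3 , termsᵖ ((2 , 0 ∷ 1 ∷ 1 ∷ []) ∷ []))
    ∷ []

certificate-σ-5-4-1 : List (ℕ × Poly 3)
certificate-σ-5-4-1 =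
    (3 , termsᵖ ((1 , 0 ∷ 1 ∷ 1 ∷ []) ∷ []))
    ∷ []

certificate-σ-5-4-2 : List (ℕ × Poly 3)
certificate-σ-5-4-2 =
    (3 , termsᵖ ((3 , 0 ∷ 0 ∷ 2 ∷ []) ∷ []))
    ∷ []

certificate-σ-5-4-3 : List (ℕ × Poly 3)
certificate-σ-5-4-3 =
    (4 , termsᵖ ((3 , 0 ∷ 0 ∷ 2 ∷ []) ∷ []))
    ∷ []

certificate-σ-7-2-6 : List (ℕ × Poly 4)
certificate-σ-7-2-6 =
    (2 , termsᵖ ((6 , 0 ∷ 0 ∷ 3 ∷ 1 ∷ []) ∷ (3 , 0 ∷ 4 ∷ 0 ∷ 0 ∷ []) ∷ (6 , 1 ∷ 1 ∷ 0 ∷ 2 ∷ []) ∷ (4 , 1 ∷ 2 ∷ 1 ∷ 0 ∷ []) ∷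
        (5 , 2 ∷ 0 ∷ 2 ∷ 0 ∷ []) ∷ []))
    ∷ (5 , termsᵖ ((6 , 0 ∷ 0 ∷ 4 ∷ 0 ∷ []) ∷ (6 , 0 ∷ 3 ∷ 0 ∷ 1 ∷ []) ∷ (3 , 1 ∷ 0 ∷ 0 ∷ 3 ∷ []) ∷ (6 , 3 ∷ 1 ∷ 0 ∷ 0 ∷ []) ∷ []))
    ∷ (6 , termsᵖ ((2 , 0 ∷ 0 ∷ 2 ∷ 2 ∷ []) ∷ []))
    ∷ []

certificate-σ-7-4-3 : List (ℕ × Poly 4)
certificate-σ-7-4-3 =
    (4 , termsᵖ ((4 , 0 ∷ 0 ∷ 0 ∷ 4 ∷ []) ∷ (3 , 0 ∷ 2 ∷ 2 ∷ 0 ∷ []) ∷ (5 , 1 ∷ 0 ∷ 3 ∷ 0 ∷ []) ∷ (4 , 2 ∷ 1 ∷ 0 ∷ 1 ∷ []) ∷ []))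
    ∷ (5 , termsᵖ ((4 , 0 ∷ 2 ∷ 0 ∷ 2 ∷ []) ∷ (2 , 0 ∷ 3 ∷ 1 ∷ 0 ∷ []) ∷ (5 , 1 ∷ 0 ∷ 1 ∷ 2 ∷ []) ∷ []))
    ∷ (6 , termsᵖ ((2 , 0 ∷ 0 ∷ 3 ∷ 1 ∷ []) ∷ (3 , 0 ∷ 4 ∷ 0 ∷ 0 ∷ []) ∷ []))
    ∷ []

certificate-σ-7-4-6 : List (ℕ × Poly 4)
certificate-σ-7-4-6 =
    (2 , termsᵖ ((6 , 0 ∷ 4 ∷ 0 ∷ 0 ∷ []) ∷ []))
    ∷ (4 , termsᵖ ((1 , 0 ∷ 1 ∷ 0 ∷ 3 ∷ []) ∷ (6 , 2 ∷ 2 ∷ 0 ∷ 0 ∷ []) ∷ []))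
    ∷ (5 , termsᵖ ((2 , 0 ∷ 0 ∷ 4 ∷ 0 ∷ []) ∷ (6 , 0 ∷ 3 ∷ 0 ∷ 1 ∷ []) ∷ (4 , 1 ∷ 0 ∷ 0 ∷ 3 ∷ []) ∷ []))
    ∷ (6 , termsᵖ ((5 , 0 ∷ 1 ∷ 3 ∷ 0 ∷ []) ∷ (5 , 2 ∷ 0 ∷ 1 ∷ 1 ∷ []) ∷ []))
    ∷ []

certificate-σ-7-5-3 : List (ℕ × Poly 4)
certificate-σ-7-5-3 =
    (4 , termsᵖ ((4 , 0 ∷ 0 ∷ 0 ∷ 4 ∷ []) ∷ (6 , 0 ∷ 1 ∷ 1 ∷ 2 ∷ []) ∷ (3 , 0 ∷ 2 ∷ 2 ∷ 0 ∷ []) ∷ (1 , 2 ∷ 1 ∷ 0 ∷ 1 ∷ []) ∷ []))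
    ∷ (6 , termsᵖ ((5 , 0 ∷ 0 ∷ 3 ∷ 1 ∷ []) ∷ (3 , 0 ∷ 4 ∷ 0 ∷ 0 ∷ []) ∷ (3 , 2 ∷ 0 ∷ 2 ∷ 0 ∷ []) ∷ []))
    ∷ []

certificate-E¹⁰ : List (ℕ × Poly 5)
certificate-E¹⁰ =
    (3 , termsᵖ ((1 , 0 ∷ 1 ∷ 1 ∷ 0 ∷ 1 ∷ []) ∷ (1 , 0 ∷ 3 ∷ 0 ∷ 0 ∷ 0 ∷ []) ∷ (7 , 2 ∷ 0 ∷ 1 ∷ 0 ∷ 0 ∷ []) ∷ []))
    ∷ (6 , termsᵖ ((7 , 0 ∷ 0 ∷ 0 ∷ 2 ∷ 1 ∷ []) ∷ (1 , 1 ∷ 1 ∷ 0 ∷ 0 ∷ 1 ∷ []) ∷ (1 , 3 ∷ 0 ∷ 0 ∷ 0 ∷ 0 ∷ []) ∷ []))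
    ∷ (8 , termsᵖ ((1 , 0 ∷ 0 ∷ 3 ∷ 0 ∷ 0 ∷ []) ∷ (7 , 1 ∷ 0 ∷ 0 ∷ 0 ∷ 2 ∷ []) ∷ (1 , 1 ∷ 0 ∷ 1 ∷ 1 ∷ 0 ∷ []) ∷ []))
    ∷ (9 , termsᵖ ((1 , 0 ∷ 0 ∷ 0 ∷ 0 ∷ 3 ∷ []) ∷ (1 , 0 ∷ 0 ∷ 1 ∷ 1 ∷ 1 ∷ []) ∷ (7 , 0 ∷ 2 ∷ 0 ∷ 1 ∷ 0 ∷ []) ∷ []))
    ∷ (10 , termsᵖ ((1 , 0 ∷ 0 ∷ 0 ∷ 3 ∷ 0 ∷ []) ∷ (7 , 0 ∷ 1 ∷ 2 ∷ 0 ∷ 0 ∷ []) ∷ (1 , 1 ∷ 1 ∷ 0 ∷ 1 ∷ 0 ∷ []) ∷ []))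
    ∷ []

certificate-E⁸ : List (ℕ × Poly 5)
certificate-E⁸ =
    (3 , termsᵖ ((8 , 0 ∷ 0 ∷ 0 ∷ 3 ∷ 3 ∷ []) ∷ (8 , 0 ∷ 1 ∷ 3 ∷ 1 ∷ 1 ∷ []) ∷ (10 , 0 ∷ 2 ∷ 0 ∷ 4 ∷ 0 ∷ []) ∷
        (4 , 0 ∷ 3 ∷ 1 ∷ 0 ∷ 2 ∷ []) ∷ (9 , 0 ∷ 3 ∷ 2 ∷ 1 ∷ 0 ∷ []) ∷ (5 , 0 ∷ 5 ∷ 0 ∷ 0 ∷ 1 ∷ []) ∷
        (4 , 1 ∷ 0 ∷ 5 ∷ 0 ∷ 0 ∷ []) ∷ (6 , 1 ∷ 1 ∷ 1 ∷ 2 ∷ 1 ∷ []) ∷ (8 , 1 ∷ 3 ∷ 0 ∷ 2 ∷ 0 ∷ []) ∷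
        (2 , 2 ∷ 0 ∷ 3 ∷ 1 ∷ 0 ∷ []) ∷ (5 , 2 ∷ 2 ∷ 1 ∷ 0 ∷ 1 ∷ []) ∷ (3 , 2 ∷ 4 ∷ 0 ∷ 0 ∷ 0 ∷ []) ∷
        (6 , 3 ∷ 0 ∷ 0 ∷ 1 ∷ 2 ∷ []) ∷ (9 , 3 ∷ 0 ∷ 1 ∷ 2 ∷ 0 ∷ []) ∷ (7 , 4 ∷ 1 ∷ 1 ∷ 0 ∷ 0 ∷ []) ∷ []))
    ∷ (6 , termsᵖ ((9 , 0 ∷ 1 ∷ 4 ∷ 0 ∷ 1 ∷ []) ∷ (4 , 0 ∷ 2 ∷ 0 ∷ 2 ∷ 2 ∷ []) ∷ (9 , 0 ∷ 2 ∷ 1 ∷ 3 ∷ 0 ∷ []) ∷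
        (7 , 1 ∷ 0 ∷ 0 ∷ 4 ∷ 1 ∷ []) ∷ (9 , 1 ∷ 1 ∷ 2 ∷ 1 ∷ 1 ∷ []) ∷ (5 , 1 ∷ 3 ∷ 0 ∷ 0 ∷ 2 ∷ []) ∷
        (1 , 1 ∷ 3 ∷ 1 ∷ 1 ∷ 0 ∷ []) ∷ (7 , 2 ∷ 0 ∷ 4 ∷ 0 ∷ 0 ∷ []) ∷ (2 , 2 ∷ 1 ∷ 0 ∷ 2 ∷ 1 ∷ []) ∷
        (10 , 3 ∷ 0 ∷ 1 ∷ 0 ∷ 2 ∷ []) ∷ (1 , 3 ∷ 0 ∷ 2 ∷ 1 ∷ 0 ∷ []) ∷ (2 , 3 ∷ 2 ∷ 0 ∷ 0 ∷ 1 ∷ []) ∷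
        (3 , 4 ∷ 0 ∷ 0 ∷ 2 ∷ 0 ∷ []) ∷ (5 , 5 ∷ 1 ∷ 0 ∷ 0 ∷ 0 ∷ []) ∷ []))
    ∷ (8 , termsᵖ ((3 , 0 ∷ 0 ∷ 4 ∷ 0 ∷ 2 ∷ []) ∷ (5 , 0 ∷ 0 ∷ 5 ∷ 1 ∷ 0 ∷ []) ∷ (7 , 1 ∷ 0 ∷ 1 ∷ 0 ∷ 4 ∷ []) ∷
        (8 , 2 ∷ 0 ∷ 1 ∷ 3 ∷ 0 ∷ []) ∷ []))
    ∷ (9 , termsᵖ ((5 , 0 ∷ 0 ∷ 1 ∷ 0 ∷ 5 ∷ []) ∷ (10 , 0 ∷ 0 ∷ 3 ∷ 2 ∷ 1 ∷ []) ∷ (4 , 0 ∷ 1 ∷ 0 ∷ 5 ∷ 0 ∷ []) ∷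
        (3 , 0 ∷ 2 ∷ 0 ∷ 0 ∷ 4 ∷ []) ∷ (5 , 0 ∷ 2 ∷ 2 ∷ 2 ∷ 0 ∷ []) ∷ (7 , 0 ∷ 4 ∷ 0 ∷ 1 ∷ 1 ∷ []) ∷
        (8 , 1 ∷ 0 ∷ 0 ∷ 2 ∷ 3 ∷ []) ∷ (10 , 1 ∷ 1 ∷ 3 ∷ 0 ∷ 1 ∷ []) ∷ (4 , 1 ∷ 2 ∷ 0 ∷ 3 ∷ 0 ∷ []) ∷
        (5 , 1 ∷ 3 ∷ 2 ∷ 0 ∷ 0 ∷ []) ∷ (5 , 2 ∷ 1 ∷ 0 ∷ 0 ∷ 3 ∷ []) ∷ (8 , 2 ∷ 3 ∷ 0 ∷ 1 ∷ 0 ∷ []) ∷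
        (10 , 3 ∷ 0 ∷ 3 ∷ 0 ∷ 0 ∷ []) ∷ (2 , 4 ∷ 0 ∷ 1 ∷ 1 ∷ 0 ∷ []) ∷ []))
    ∷ (10 , termsᵖ ((5 , 0 ∷ 0 ∷ 1 ∷ 3 ∷ 2 ∷ []) ∷ (3 , 0 ∷ 0 ∷ 2 ∷ 4 ∷ 0 ∷ []) ∷ (7 , 0 ∷ 1 ∷ 4 ∷ 1 ∷ 0 ∷ []) ∷
        (6 , 0 ∷ 3 ∷ 2 ∷ 0 ∷ 1 ∷ []) ∷ (8 , 0 ∷ 5 ∷ 1 ∷ 0 ∷ 0 ∷ []) ∷ (5 , 1 ∷ 0 ∷ 0 ∷ 5 ∷ 0 ∷ []) ∷
        (2 , 2 ∷ 1 ∷ 0 ∷ 3 ∷ 0 ∷ []) ∷ (3 , 2 ∷ 2 ∷ 2 ∷ 0 ∷ 0 ∷ []) ∷ (8 , 3 ∷ 0 ∷ 0 ∷ 0 ∷ 3 ∷ []) ∷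
        (9 , 3 ∷ 2 ∷ 0 ∷ 1 ∷ 0 ∷ []) ∷ []))
    ∷ []

module Residues (q : ℕ) .{{_ : ℕ.NonZero q}} where
  pentagonal? : ∀ cs → Dec (All (λ i → pent₁ i % q ∈ cs × pent₂ i % q ∈ cs) (upTo q))
  pentagonal? cs = All.all? (λ i → (pent₁ i % q ∈? cs) ×-dec (pent₂ i % q ∈? cs)) (upTo q)

  triangular? : ∀ ds → Dec (All (λ i → suc (i + i) % q ≡ 0 ⊎ tri i % q ∈ ds) (upTo q))
  triangular? ds = All.all? (λ i → (suc (i + i) % q ℕₚ.≟ 0) ⊎-dec (tri i % q ∈? ds)) (upTo q)

  apart? : ∀ cs ds r → Dec (All (λ a → All (λ b → ¬ (a + b) % q ≡ r) ds) cs)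
  apart? cs ds r = All.all? (λ a → All.all? (λ b → ¬? ((a + b) % q ℕₚ.≟ r)) ds) cs

-- cs and ds contain the residues modulo q of the exponents of E and of E ^ 3.
module Modulo (q : ℕ) .{{q≢0 : ℕ.NonZero q}} (q∣tri : True (q ∣? tri q)) (frobenius : T (divisibleᵖ q 1 (freshman q)))
  (cs ds : List ℕ) (zero∈ : True (0 % q ∈? cs)) (pent∈ : True (Residues.pentagonal? q cs)) (tri∈ : True (Residues.triangular? q ds)) where
  open Residues q
  open Modular q using (modularRing; ≈0⇒∣)
  open Congruences modularRing q
  open PowerSeries modularRing using (seriesRing)
  open EulerProduct modularRing using (E) public
  open GeneratingFunctions modularRing using (cast; θ)
  open ResidueClasses modularRing q using (ResiduesIn; Vanishes; Vanishes-resp) public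
  open Prime (Modular.q⋅1≈0 q) (toWitness q∣tri) frobenius renaming (q⋅1≈0 to q⋅1≈0ˢ) public
  open CommutativeRing seriesRing using (sym; *-identityʳ; semiring) renaming (_*_ to _*ˢ_)
  open import Algebra.Properties.Semiring.Exp semiring using (_^_; ^-homo-*) public

  E-in : ResiduesIn cs E
  E-in = E-residues (toWitness q∣tri) (toWitness zero∈) (toWitness pent∈)

  E³-in : ResiduesIn ds (E ^ 3)
  E³-in = E³-residues (toWitness q∣tri) q⋅1≈0ˢ (toWitness tri∈)

  divides-class : ∀ F r → r ℕ.< q → Vanishes r (cast F) → ∀ n → q ∣ F (q * n + r)
  divides-class F r r<q v n = ≈0⇒∣ (v (q * n + r)
    (≡.trans (≡.cong (_% q) (≡.trans (ℕₚ.+-comm (q * n) r) (≡.cong (r ℕ.+_) (ℕₚ.*-comm q n)))) (≡.trans ([m+kn]%n≡m%n r n q) (m<n⇒m%n≡m r<q))))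

  p-divides : ∀ k l r → {True (k + l ℕₚ.≟ q)} → {True (r ℕₚ.<? q)} → Vanishes r (E ^ l) → ∀ n → q ∣ convPow k p (q * n + r)
  p-divides k l r {k+l≡q} {r<q} v = divides-class (convPow k p) r (toWitness r<q) (p-vanishes k {l} (toWitness k+l≡q) v)

  σ-divides : ∀ k l r → {True (k + l ℕₚ.≟ q)} → {True (r ℕₚ.<? q)} → Vanishes r (θ E ^ k *ˢ E ^ l) →
    ∀ n → q ∣ convPow k σ (q * n + r)
  σ-divides k l r {k+l≡q} {r<q} v = divides-class (convPow k σ) r (toWitness r<q) (σ-vanishes k {l} (toWitness k+l≡q) v)

  E¹ : ∀ r → {True (r ∉? cs)} → Vanishes r (E ^ 1)
  E¹ r {r∉} = Vanishes-resp {r} {E} {E ^ 1} (sym (*-identityʳ E)) (ResiduesIn⇒Vanishes {cs} {E} {r} E-in (toWitness r∉))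

  E³ : ∀ r → {True (r ∉? ds)} → Vanishes r (E ^ 3)
  E³ r {r∉} = ResiduesIn⇒Vanishes {ds} {E ^ 3} {r} E³-in (toWitness r∉)

  E⁴ : ∀ r → {True (apart? cs ds r)} → Vanishes r (E ^ 4)
  E⁴ r {apart} = ResiduesIn-*⇒Vanishes {cs} {ds} {E} {E ^ 3} {r} E-in E³-in (toWitness apart)

  E⁶ : ∀ r → {True (apart? ds ds r)} → Vanishes r (E ^ 6)
  E⁶ r {apart} = Vanishes-resp {r} {E ^ 3 *ˢ E ^ 3} {E ^ 6} (sym (^-homo-* E 3 3))
    (ResiduesIn-*⇒Vanishes {ds} {ds} {E ^ 3} {E ^ 3} {r} E³-in E³-in (toWitness apart))

module Mod5 = Modulo 5 tt tt (0 ∷ 1 ∷ 2 ∷ []) (0 ∷ 1 ∷ []) tt tt tt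
module Mod7 = Modulo 7 tt tt (0 ∷ 1 ∷ 2 ∷ 5 ∷ []) (0 ∷ 1 ∷ 3 ∷ []) tt tt tt
module Mod11 = Modulo 11 tt tt (0 ∷ 1 ∷ 2 ∷ 4 ∷ 5 ∷ 7 ∷ []) (0 ∷ 1 ∷ 3 ∷ 6 ∷ 10 ∷ []) tt tt tt
module Mod17 = Modulo 17 tt tt (0 ∷ 1 ∷ 2 ∷ 5 ∷ 6 ∷ 7 ∷ 9 ∷ 12 ∷ 15 ∷ []) (0 ∷ 1 ∷ 3 ∷ 4 ∷ 6 ∷ 10 ∷ 11 ∷ 15 ∷ []) tt tt tt

p-pairs₅ : List (ℕ × ℕ)
p-pairs₅ = (1 , 4) ∷ (2 , 2) ∷ (2 , 3) ∷ (2 , 4) ∷ (4 , 3) ∷ (4 , 4) ∷ []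

p-mod5 : All (λ (k , r) → ∀ n → 5 ∣ convPow k p (5 * n + r)) p-pairs₅
p-mod5 = p-divides 1 4 4 (E⁴ 4)
       ∷ p-divides 2 3 2 (E³ 2) ∷ p-divides 2 3 3 (E³ 3) ∷ p-divides 2 3 4 (E³ 4)
       ∷ p-divides 4 1 3 (E¹ 3) ∷ p-divides 4 1 4 (E¹ 4) ∷ []
  where open Mod5

p-mod17 : ∀ n → 17 ∣ convPow 13 p (17 * n + 14)
p-mod17 = p-divides 13 4 14 (E⁴ 14)
  where open Mod17

p-pairs₇ : List (ℕ × ℕ)
p-pairs₇ = (1 , 5) ∷ (4 , 2) ∷ (4 , 4) ∷ (4 , 5) ∷ (4 , 6) ∷ (6 , 3) ∷ (6 , 4) ∷ (6 , 6) ∷ []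

p-mod7 : All (λ (k , r) → ∀ n → 7 ∣ convPow k p (7 * n + r)) p-pairs₇
p-mod7 = p-divides 1 6 5 (E⁶ 5)
       ∷ p-divides 4 3 2 (E³ 2) ∷ p-divides 4 3 4 (E³ 4) ∷ p-divides 4 3 5 (E³ 5) ∷ p-divides 4 3 6 (E³ 6)
       ∷ p-divides 6 1 3 (E¹ 3) ∷ p-divides 6 1 4 (E¹ 4) ∷ p-divides 6 1 6 (E¹ 6) ∷ []
  where open Mod7

p-pairs₁₁ : List (ℕ × ℕ)
p-pairs₁₁ = (1 , 6) ∷ (3 , 7) ∷ (5 , 8) ∷ (7 , 9) ∷ (8 , 2) ∷ (8 , 4) ∷ (8 , 5) ∷ (8 , 7)
         ∷ (8 , 8) ∷ (8 , 9) ∷ (10 , 3) ∷ (10 , 6) ∷ (10 , 8) ∷ (10 , 9) ∷ (10 , 10) ∷ []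

p-mod11 : All (λ (k , r) → ∀ n → 11 ∣ convPow k p (11 * n + r)) p-pairs₁₁
p-mod11 = p-divides 1 10 6 (lower {10} {6} (certified-E³ E³-in certificate-E¹⁰ (E¹² 3 ∷ E¹² 6 ∷ E¹² 8 ∷ E¹² 9 ∷ E¹² 10 ∷ []) 7 6 tt))
        ∷ p-divides 3 8 7 (lower {8} {7} (lower {19} {7} (certified-E³ E³-in certificate-E⁸ (E¹² 3 ∷ E¹² 6 ∷ E¹² 8 ∷ E¹² 9 ∷ E¹² 10 ∷ []) 10 7 tt)))
        ∷ p-divides 5 6 8 (E⁶ 8)
        ∷ p-divides 7 4 9 (E⁴ 9)
        ∷ p-divides 8 3 2 (E³ 2) ∷ p-divides 8 3 4 (E³ 4) ∷ p-divides 8 3 5 (E³ 5) ∷ p-divides 8 3 7 (E³ 7)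
        ∷ p-divides 8 3 8 (E³ 8) ∷ p-divides 8 3 9 (E³ 9)
        ∷ p-divides 10 1 3 (E¹ 3) ∷ p-divides 10 1 6 (E¹ 6) ∷ p-divides 10 1 8 (E¹ 8) ∷ p-divides 10 1 9 (E¹ 9)
        ∷ p-divides 10 1 10 (E¹ 10) ∷ []
  where
  open Mod11
  E¹² : ∀ r → {True (r ∉? (0 ∷ 1 ∷ 2 ∷ 4 ∷ 5 ∷ 7 ∷ []))} → Vanishes r (E ^ 12)
  E¹² r {r∉} = raise {1} {r} (E¹ r {r∉})

σ-pairs₅ σ-pairs₇ : List (ℕ × ℕ)
σ-pairs₅ = (2 , 1) ∷ (3 , 1) ∷ (3 , 2) ∷ (4 , 1) ∷ (4 , 2) ∷ (4 , 3) ∷ []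
σ-pairs₇ = (2 , 6) ∷ (4 , 3) ∷ (4 , 6) ∷ (5 , 3) ∷ []

σ-mod5 : All (λ (k , r) → ∀ n → 5 ∣ convPow k σ (5 * n + r)) σ-pairs₅
σ-mod5 = σ-divides 2 3 1 (certified-θE E-in certificate-σ-5-2-1 (E³ 2 ∷ E³ 3 ∷ []) 2 3 1 tt)
       ∷ σ-divides 3 2 1 (certified-θE E-in certificate-σ-5-3-1 (E³ 2 ∷ E³ 3 ∷ []) 3 2 1 tt)
       ∷ σ-divides 3 2 2 (certified-θE E-in [] [] 3 2 2 tt)
       ∷ σ-divides 4 1 1 (certified-θE E-in certificate-σ-5-4-1 (E³ 3 ∷ []) 4 1 1 tt)
       ∷ σ-divides 4 1 2 (certified-θE E-in certificate-σ-5-4-2 (E³ 3 ∷ []) 4 1 2 tt)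
       ∷ σ-divides 4 1 3 (certified-θE E-in certificate-σ-5-4-3 (E³ 4 ∷ []) 4 1 3 tt)
       ∷ []
  where open Mod5

σ-mod7 : All (λ (k , r) → ∀ n → 7 ∣ convPow k σ (7 * n + r)) σ-pairs₇
σ-mod7 = σ-divides 2 5 6 (certified-θE E-in certificate-σ-7-2-6 (E³ 2 ∷ E³ 5 ∷ E³ 6 ∷ []) 2 5 6 tt)
       ∷ σ-divides 4 3 3 (certified-θE E-in certificate-σ-7-4-3 (E³ 4 ∷ E³ 5 ∷ E³ 6 ∷ []) 4 3 3 tt)
       ∷ σ-divides 4 3 6 (certified-θE E-in certificate-σ-7-4-6 (E³ 2 ∷ E³ 4 ∷ E³ 5 ∷ E³ 6 ∷ []) 4 3 6 tt)
       ∷ σ-divides 5 2 3 (certified-θE E-in certificate-σ-7-5-3 (E³ 4 ∷ E³ 6 ∷ []) 5 2 3 tt)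
       ∷ []
  where open Mod7

p-exact5 : ExactCongruences (λ k → convPow k p) 5 p-pairs₅
p-exact5 = exactCongruences 5 p-pairs₅ 5 xs ≡.refl (toWitness {a? = rows? 5 p-pairs₅ 5 xs} tt) p-mod5
  where xs = 1 ∷ 1 ∷ 2 ∷ 3 ∷ 5 ∷ []

p-exact7 : ExactCongruences (λ k → convPow k p) 7 p-pairs₇
p-exact7 = exactCongruences 7 p-pairs₇ 7 xs ≡.refl (toWitness {a? = rows? 7 p-pairs₇ 7 xs} tt) p-mod7
  where xs = 1 ∷ 1 ∷ 2 ∷ 3 ∷ 5 ∷ 7 ∷ 11 ∷ []

p-exact11 : ExactCongruences (λ k → convPow k p) 11 p-pairs₁₁
p-exact11 = exactCongruences 11 p-pairs₁₁ 30 xs ≡.refl (toWitness {a? = rows? 11 p-pairs₁₁ 30 xs} tt) p-mod11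
  where
  xs = 1 ∷ 1 ∷ 2 ∷ 3 ∷ 5 ∷ 7 ∷ 11 ∷ 15 ∷ 22 ∷ 30 ∷ 42 ∷ 56 ∷ 77 ∷ 101 ∷ 135 ∷ 176 ∷ 231 ∷ 297 ∷ 385 ∷ 490 ∷ 627 ∷ 792
       ∷ 1002 ∷ 1255 ∷ 1575 ∷ 1958 ∷ 2436 ∷ 3010 ∷ 3718 ∷ 4565 ∷ []

σ-exact5 : ExactCongruences (λ k → convPow k σ) 5 σ-pairs₅
σ-exact5 = exactCongruences 5 σ-pairs₅ 6 xs ≡.refl (toWitness {a? = rows? 5 σ-pairs₅ 6 xs} tt) σ-mod5
  where xs = 0 ∷ 1 ∷ 3 ∷ 4 ∷ 7 ∷ 6 ∷ []

σ-exact7 : ExactCongruences (λ k → convPow k σ) 7 σ-pairs₇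
σ-exact7 = exactCongruences 7 σ-pairs₇ 15 xs ≡.refl (toWitness {a? = rows? 7 σ-pairs₇ 15 xs} tt) σ-mod7
  where xs = 0 ∷ 1 ∷ 3 ∷ 4 ∷ 7 ∷ 6 ∷ 12 ∷ 8 ∷ 15 ∷ 13 ∷ 18 ∷ 12 ∷ 28 ∷ 14 ∷ 24 ∷ []

theorem4p1 : (ExactCongruences (λ k → convPow k p) 5
    ((1 , 4) ∷ (2 , 2) ∷ (2 , 3) ∷ (2 , 4) ∷ (4 , 3) ∷ (4 , 4) ∷ [])
    × ExactCongruences (λ k → convPow k p) 7
    ((1 , 5) ∷ (4 , 2) ∷ (4 , 4) ∷ (4 , 5) ∷ (4 , 6) ∷ (6 , 3) ∷ (6 , 4) ∷ (6 , 6) ∷ [])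
    × ExactCongruences (λ k → convPow k p) 11
    ((1 , 6) ∷ (3 , 7) ∷ (5 , 8) ∷ (7 , 9) ∷ (8 , 2) ∷ (8 , 4) ∷ (8 , 5) ∷ (8 , 7)
    ∷ (8 , 8) ∷ (8 , 9) ∷ (10 , 3) ∷ (10 , 6) ∷ (10 , 8) ∷ (10 , 9) ∷ (10 , 10) ∷ []))
    × (∀ n → 17 ∣ convPow 13 p (17 * n + 14))
    × (ExactCongruences (λ k → convPow k σ) 5
    ((2 , 1) ∷ (3 , 1) ∷ (3 , 2) ∷ (4 , 1) ∷ (4 , 2) ∷ (4 , 3) ∷ [])
    × ExactCongruences (λ k → convPow k σ) 7
    ((2 , 6) ∷ (4 , 3) ∷ (4 , 6) ∷ (5 , 3) ∷ []))
theorem4p1 = (p-exact5 , p-exact7 , p-exact11) , p-mod17 , (σ-exact5 , σ-exact7)
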